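{- The maximum cardinality of an affine equiangular set with norm $3$ with respect to the switching root $\rho$ in $L$ is $57$. Moreover, for every such maximum affine equiangular set $\omega$ in $L$, there exist a unique Latin square $S=(S_{ij})_{i,j\in[6]}$ of order $6$ (with symbols $1,\dots,6$) and unique cliques $C_1,C_2,C_3$ of size $7$ in the distance $2$-or-$3$ graph of the cartesian product of $J(6,3)$ and $K_2$ such that $\omega$ is switching equivalent to $\omega_0\cup\omega_1\cup\omega_2\cup\omega_3$, where $$\omega_0=\{x_{i,j,S_{ij}} : i,j\in[6]\}$$ and $$\omega_i=\{x^{(i)}_{I,\varepsilon,1} : (I,\varepsilon)\in C_i\}\qquad (i=1,2,3).$$
   Context: Notation: $[n]=\{1,\dots,n\}$; $\binom{[n]}{k}$ is the set of $k$-subsets of $[n]$; $(u,v)$ is the standard inner product. Lattices. $A_n=\{x\in\mathbb{Z}^{n+1}: x_1+\cdots+x_{n+1}=0\}$ and $\alpha_n=(\frac1{n+1},\dots,\frac1{n+1},-\frac n{n+1})\in\mathbb{R}^{n+1}$ (so $\alpha_1=(\frac12,-\frac12)$). Let $\Lambda=A_5^3\oplus A_1^4\subset\mathbb{R}^{26}$; vectors of $\mathbb{R}^{26}$ are written $(v_1,\dots,v_7)$ with $v_1,v_2,v_3\in\mathbb{R}^6$ and $v_4,\dots,v_7\in\mathbb{R}^2$. Let $\beta_0=(\alpha_5,\alpha_5,\alpha_5,0,0,0,\alpha_1)$, $\beta_1=(3\alpha_5,0,0,0,\alpha_1,\alpha_1,\alpha_1)$, $\beta_2=(0,3\alpha_5,0,\alpha_1,0,\alpha_1,\alpha_1)$,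 $\beta_3=(0,0,3\alpha_5,\alpha_1,\alpha_1,0,\alpha_1)$. $L$ is the lattice generated by $\Lambda$ and $\beta_0,\beta_1,\beta_2,\beta_3$ (an integral lattice). Let $\rho=(0,0,0,0,0,0,2\alpha_1)$. Affine equiangular sets. A set $\omega$ of vectors is an affine equiangular set with norm $3$ with respect to the switching root $\rho$ if $(u,\rho)=1$ and $(u,u)=3$ for all $u\in\omega$, and $(u,v)\in\{0,1\}$ for all distinct $u,v\in\omega$. It is an affine equiangular set in $L$ if $\omega\subset L$, and it is maximum in $L$ if no such set in $L$ has larger cardinality. Two such sets $\omega,\omega'$ are switching equivalent if there is a bijection $g:\omega\to\omega'$ with $g(u)\in\{u,\rho-u\}$ for every $u\in\omega$. Vectors. With $e_1,\dots,e_6$ the standard basis of $\mathbb{R}^6$, let $\alpha_5^{(i)}=\frac16(1,1,1,1,1,1)-e_i$ for $i\in[6]$ and $\alpha_I=\frac12\big(\sum_{i\in[6]\setminus I}e_i-\sum_{i\in I}e_i\big)$ for $I\in\binom{[6]}3$. For $i_1,i_2,i_3\in[6]$, $x_{i_1,i_2,i_3}=(\alpha_5^{(i_1)},\alpha_5^{(i_2)},\alpha_5^{(i_3)},0,0,0,\alpha_1)$. For $I\in\binom{[6]}3$ and $\varepsilon_1,\varepsilon_2\in\{\pm1\}$, $x^{(1)}_{I,\varepsilon_1,\varepsilon_2}=(\alpha_I,0,0,0,\varepsilon_1\alpha_1,\varepsilon_2\alpha_1,\alpha_1)$, $x^{(2)}_{I,\varepsilon_1,\varepsilon_2}=(0,\alpha_I,0,\varepsilon_2\alpha_1,0,\varepsilon_1\alpha_1,\alpha_1)$,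 $x^{(3)}_{I,\varepsilon_1,\varepsilon_2}=(0,0,\alpha_I,\varepsilon_1\alpha_1,\varepsilon_2\alpha_1,0,\alpha_1)$. Graphs. The Johnson graph $J(6,3)$ has vertex set $\binom{[6]}3$, with two vertices adjacent iff they intersect in exactly $2$ elements. $K_2$ is the complete graph on $\{\pm1\}$. In the cartesian product of graphs $G$ and $H$ (vertex set $V(G)\times V(H)$), $(u,v)$ and $(u',v')$ are adjacent iff ($u=u'$ and $v\sim v'$) or ($v=v'$ and $u\sim u'$). The distance $2$-or-$3$ graph of a connected graph $G$ has the same vertices as $G$, two being adjacent iff their distance in $G$ is $2$ or $3$. -}

module Defs where

open import Level using (0ℓ)
open import Data.Bool.Base using (if_then_else_)
open import Data.Fin.Base using (Fin)
open import Data.Fin.Subset using (Subset; ∣_∣; _∩_; ∁)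
open import Data.Fin.Subset.Properties using (∩-comm; ∩-idem)
open import Data.Integer.Base as ℤ using (ℤ; 0ℤ; +_; _◃_)
open import Data.Nat.Base as ℕ using (ℕ; suc)
open import Data.Product.Base using (Σ; _×_; _,_; ∃; ∃₂; ∃-syntax; proj₁; proj₂)
open import Data.Rational.Base as ℚ using (ℚ; 0ℚ; 1ℚ; ½; _/_)
open import Data.Sign.Base using (Sign)
open import Data.Sum.Base using (_⊎_; inj₁; inj₂)
open import Data.Vec.Base
  using (Vec; _++_; _∷ʳ_; _[_]≔_; foldr′; map; replicate; zipWith)
open import Function.Bundles using (Bijection; Injection)
open import Function.Definitions using (Bijective)
open import Relation.Binary.Bundles using (Setoid)
open import Relation.Binary.Core using (Rel)
open import Relation.Binary.Definitions using (Symmetric; Irreflexive)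
open import Relation.Binary.PropositionalEquality
  using (_≡_; _≢_; refl; sym; trans; cong; setoid)
import Relation.Binary.Construct.On as On
open import Relation.Unary using (Pred; _∈_; _⊆_; _∪_; _≐_; ｛_｝)

------------------------------------------------------------------------
-- Sets and cardinalities

-- A set of elements of A is a predicate.  The elements of ⟦ ω ⟧ are
-- compared without regard to their membership proofs.
⟦_⟧ : {A : Set} → Pred A 0ℓ → Setoid 0ℓ 0ℓ
⟦_⟧ {A} ω = On.setoid {B = ∃ ω} (setoid A) proj₁

HasCardinality : {A : Set} → Pred A 0ℓ → ℕ → Set
HasCardinality ω n = Bijection (setoid (Fin n)) ⟦ ω ⟧

-- ω is not assumed to be finite or decidable: every m-element subset of ω
-- has m ≤ n.
CardinalityAtMost : {A : Set} → Pred A 0ℓ → ℕ → Set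
CardinalityAtMost ω n = ∀ m → Injection (setoid (Fin m)) ⟦ ω ⟧ → m ℕ.≤ n

------------------------------------------------------------------------
-- Vectors.  All vectors under consideration have rational coordinates,
-- so ℚⁿ takes the place of ℝⁿ.

infixl 6 _+ᵛ_ _-ᵛ_
infixr 7 _·_

0ᵛ : ∀ {n} → Vec ℚ n
0ᵛ = replicate _ 0ℚ

_+ᵛ_ : ∀ {n} → Vec ℚ n → Vec ℚ n → Vec ℚ n
_+ᵛ_ = zipWith ℚ._+_

-ᵛ_ : ∀ {n} → Vec ℚ n → Vec ℚ n
-ᵛ_ = map (λ q → ℚ.- q)

_-ᵛ_ : ∀ {n} → Vec ℚ n → Vec ℚ n → Vec ℚ n
_-ᵛ_ = zipWith ℚ._-_

_·_ : ∀ {n} → ℚ → Vec ℚ n → Vec ℚ n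
q · v = map (q ℚ.*_) v

⟨_,_⟩ : ∀ {n} → Vec ℚ n → Vec ℚ n → ℚ
⟨ u , v ⟩ = foldr′ ℚ._+_ 0ℚ (zipWith ℚ._*_ u v)

2ℚ 3ℚ : ℚ
2ℚ = + 2 / 1
3ℚ = + 3 / 1

e : ∀ {n} → Fin n → Vec ℚ n
e i = 0ᵛ [ i ]≔ 1ℚ

-- The sum of the e i over i ∈ I.
χ : ∀ {n} → Subset n → Vec ℚ n
χ = map (λ b → if b then 1ℚ else 0ℚ)

------------------------------------------------------------------------
-- The lattices

data Generated {n} (G : Pred (Vec ℚ n) 0ℓ) : Pred (Vec ℚ n) 0ℓ where
  gen  : ∀ {u} → u ∈ G → Generated G u
  zero : Generated G 0ᵛ
  add  : ∀ {u v} → Generated G u → Generated G v → Generated G (u +ᵛ v)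
  neg  : ∀ {u} → Generated G u → Generated G (-ᵛ u)

infixr 5 _⊕_

_⊕_ : ∀ {m n} → Pred (Vec ℚ m) 0ℓ → Pred (Vec ℚ n) 0ℓ → Pred (Vec ℚ (m ℕ.+ n)) 0ℓ
(P ⊕ Q) u = ∃₂ λ v w → v ∈ P × w ∈ Q × u ≡ v ++ w

A : (n : ℕ) → Pred (Vec ℚ (suc n)) 0ℓ
A n u = ∃[ x ] (foldr′ ℤ._+_ 0ℤ x ≡ 0ℤ × u ≡ map (_/ 1) x)

α : (n : ℕ) → Vec ℚ (suc n)
α n = replicate n (+ 1 / suc n) ∷ʳ (ℤ.- (+ n) / suc n)

E : Set
E = Vec ℚ 26

block : (v₁ v₂ v₃ : Vec ℚ 6) (v₄ v₅ v₆ v₇ : Vec ℚ 2) → E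
block v₁ v₂ v₃ v₄ v₅ v₆ v₇ = v₁ ++ v₂ ++ v₃ ++ v₄ ++ v₅ ++ v₆ ++ v₇

Λ : Pred E 0ℓ
Λ = A 5 ⊕ A 5 ⊕ A 5 ⊕ A 1 ⊕ A 1 ⊕ A 1 ⊕ A 1

β₀ β₁ β₂ β₃ : E
β₀ = block (α 5) (α 5) (α 5) 0ᵛ 0ᵛ 0ᵛ (α 1)
β₁ = block (3ℚ · α 5) 0ᵛ 0ᵛ 0ᵛ (α 1) (α 1) (α 1)
β₂ = block 0ᵛ (3ℚ · α 5) 0ᵛ (α 1) 0ᵛ (α 1) (α 1)
β₃ = block 0ᵛ 0ᵛ (3ℚ · α 5) (α 1) (α 1) 0ᵛ (α 1)

L : Pred E 0ℓ
L = Generated (Λ ∪ ｛ β₀ ｝ ∪ ｛ β₁ ｝ ∪ ｛ β₂ ｝ ∪ ｛ β₃ ｝)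

ρ : E
ρ = block 0ᵛ 0ᵛ 0ᵛ 0ᵛ 0ᵛ 0ᵛ (2ℚ · α 1)

------------------------------------------------------------------------
-- Affine equiangular sets with norm 3

record IsAffineEquiangular {n} (r : Vec ℚ n) (ω : Pred (Vec ℚ n) 0ℓ) : Set where
  field
    root  : ∀ {u} → u ∈ ω → ⟨ u , r ⟩ ≡ 1ℚ
    norm  : ∀ {u} → u ∈ ω → ⟨ u , u ⟩ ≡ 3ℚ
    inner : ∀ {u v} → u ∈ ω → v ∈ ω → u ≢ v → ⟨ u , v ⟩ ≡ 0ℚ ⊎ ⟨ u , v ⟩ ≡ 1ℚ

IsAffineEquiangularIn : ∀ {n} (M : Pred (Vec ℚ n) 0ℓ) (r : Vec ℚ n) (ω : Pred (Vec ℚ n) 0ℓ) → Set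
IsAffineEquiangularIn M r ω = IsAffineEquiangular r ω × ω ⊆ M

MaximumCardinality : ∀ {n} (M : Pred (Vec ℚ n) 0ℓ) (r : Vec ℚ n) → ℕ → Set₁
MaximumCardinality M r k =
  (∃[ ω ] (IsAffineEquiangularIn M r ω × HasCardinality ω k)) ×
  (∀ ω → IsAffineEquiangularIn M r ω → CardinalityAtMost ω k)

-- Finiteness of ω is automatic classically, since a lattice has finitely
-- many vectors of norm 3; here the cardinality k of ω is part of the data.
IsMaximumIn : ∀ {n} (M : Pred (Vec ℚ n) 0ℓ) (r : Vec ℚ n) (ω : Pred (Vec ℚ n) 0ℓ) → Set₁
IsMaximumIn M r ω =
  IsAffineEquiangularIn M r ω ×
  ∃[ k ] (HasCardinality ω k × (∀ ω′ → IsAffineEquiangularIn M r ω′ → CardinalityAtMost ω′ k))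

SwitchingEquivalent : ∀ {n} (r : Vec ℚ n) (ω ω′ : Pred (Vec ℚ n) 0ℓ) → Set
SwitchingEquivalent r ω ω′ =
  Σ (Bijection ⟦ ω ⟧ ⟦ ω′ ⟧) λ g →
    ∀ u → proj₁ (Bijection.to g u) ≡ proj₁ u ⊎ proj₁ (Bijection.to g u) ≡ r -ᵛ proj₁ u

------------------------------------------------------------------------
-- Graphs

record Graph : Set₁ where
  field
    Vertex : Set
    _~_    : Rel Vertex 0ℓ
    ~-sym  : Symmetric _~_
    ~-irr  : Irreflexive _≡_ _~_

open Graph using (Vertex)

data Walk (G : Graph) : ℕ → Rel (Vertex G) 0ℓ where
  []  : ∀ {u} → Walk G 0 u u
  _∷_ : ∀ {k u v w} → Graph._~_ G u v → Walk G k v w → Walk G (suc k) u w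

Distance : (G : Graph) → Vertex G → Vertex G → ℕ → Set
Distance G u v d = Walk G d u v × (∀ k → Walk G k u v → d ℕ.≤ k)

private
  reverse : ∀ G {k u v} → Walk G k u v → Walk G k v u
  reverse G []      = []
  reverse G (a ∷ p) = snoc (reverse G p) (Graph.~-sym G a)
    where
    snoc : ∀ {k u v w} → Walk G k u v → Graph._~_ G v w → Walk G (suc k) u w
    snoc []      b = b ∷ []
    snoc (a ∷ p) b = a ∷ snoc p b

  Distance-sym : ∀ G {u v d} → Distance G u v d → Distance G v u d
  Distance-sym G (p , min) = reverse G p , λ k q → min k (reverse G q)

  Distance-refl : ∀ G {u d} → Distance G u u (suc d) → ∀ {X : Set} → X
  Distance-refl G (_ , min) with () ← min 0 []

distance2or3 : Graph → Graph
distance2or3 G = record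
  { Vertex = Vertex G
  ; _~_    = λ u v → Distance G u v 2 ⊎ Distance G u v 3
  ; ~-sym  = λ { (inj₁ d) → inj₁ (Distance-sym G d)
               ; (inj₂ d) → inj₂ (Distance-sym G d) }
  ; ~-irr  = λ { refl (inj₁ d) → Distance-refl G d
               ; refl (inj₂ d) → Distance-refl G d }
  }

infixr 6 _□_

_□_ : Graph → Graph → Graph
G □ H = record
  { Vertex = Vertex G × Vertex H
  ; _~_    = λ { (u , v) (u′ , v′) →
               (u ≡ u′ × Graph._~_ H v v′) ⊎ (v ≡ v′ × Graph._~_ G u u′) }
  ; ~-sym  = λ { (inj₁ (p , a)) → inj₁ (sym p , Graph.~-sym H a)
               ; (inj₂ (p , a)) → inj₂ (sym p , Graph.~-sym G a) }
  ; ~-irr  = λ { refl (inj₁ (_ , a)) → Graph.~-irr H refl a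
               ; refl (inj₂ (_ , a)) → Graph.~-irr G refl a }
  }

K₂ : Graph
K₂ = record
  { Vertex = Sign
  ; _~_    = _≢_
  ; ~-sym  = λ a p → a (sym p)
  ; ~-irr  = λ p a → a p
  }

ThreeSubset : Set
ThreeSubset = Σ (Subset 6) λ I → ∣ I ∣ ≡ 3

J[6,3] : Graph
J[6,3] = record
  { Vertex = ThreeSubset
  ; _~_    = λ { (I , _) (J , _) → ∣ I ∩ J ∣ ≡ 2 }
  ; ~-sym  = λ { {I , _} {J , _} p → trans (cong ∣_∣ (∩-comm J I)) p }
  ; ~-irr  = λ { {I , q} refl p → 3≢2 (trans (sym q) (trans (sym (cong ∣_∣ (∩-idem I))) p)) }
  }
  where
  3≢2 : 3 ≢ 2
  3≢2 ()

IsClique : (G : Graph) → Pred (Vertex G) 0ℓ → Set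
IsClique G C = ∀ {u v} → u ∈ C → v ∈ C → u ≢ v → Graph._~_ G u v

Γ : Graph
Γ = distance2or3 (J[6,3] □ K₂)

Is7Clique : Pred (Vertex Γ) 0ℓ → Set
Is7Clique C = IsClique Γ C × HasCardinality C 7

------------------------------------------------------------------------
-- Latin squares

Square : ℕ → Set
Square n = Fin n → Fin n → Fin n

record IsLatin {n} (S : Square n) : Set where
  field
    rows    : ∀ i → Bijective _≡_ _≡_ (λ j → S i j)
    columns : ∀ j → Bijective _≡_ _≡_ (λ i → S i j)

------------------------------------------------------------------------
-- The vectors x and the sets ω₀, ω₁, ω₂, ω₃

α₅⁽_⁾ : Fin 6 → Vec ℚ 6
α₅⁽ i ⁾ = (+ 1 / 6) · replicate 6 1ℚ -ᵛ e i

αₛ : Subset 6 → Vec ℚ 6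
αₛ I = ½ · (χ (∁ I) -ᵛ χ I)

infixr 7 _±_

_±_ : ∀ {n} → Sign → Vec ℚ n → Vec ℚ n
ε ± v = ((ε ◃ 1) / 1) · v

x : (i₁ i₂ i₃ : Fin 6) → E
x i₁ i₂ i₃ = block α₅⁽ i₁ ⁾ α₅⁽ i₂ ⁾ α₅⁽ i₃ ⁾ 0ᵛ 0ᵛ 0ᵛ (α 1)

x⁽¹⁾ x⁽²⁾ x⁽³⁾ : ThreeSubset → (ε₁ ε₂ : Sign) → E
x⁽¹⁾ (I , _) ε₁ ε₂ = block (αₛ I) 0ᵛ 0ᵛ 0ᵛ (ε₁ ± α 1) (ε₂ ± α 1) (α 1)
x⁽²⁾ (I , _) ε₁ ε₂ = block 0ᵛ (αₛ I) 0ᵛ (ε₂ ± α 1) 0ᵛ (ε₁ ± α 1) (α 1)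
x⁽³⁾ (I , _) ε₁ ε₂ = block 0ᵛ 0ᵛ (αₛ I) (ε₁ ± α 1) (ε₂ ± α 1) 0ᵛ (α 1)

ω₀ : Square 6 → Pred E 0ℓ
ω₀ S u = ∃₂ λ i j → u ≡ x i j (S i j)

ω₁ ω₂ ω₃ : Pred (Vertex Γ) 0ℓ → Pred E 0ℓ
ω₁ C u = ∃₂ λ I ε → (I , ε) ∈ C × u ≡ x⁽¹⁾ I ε Sign.+
ω₂ C u = ∃₂ λ I ε → (I , ε) ∈ C × u ≡ x⁽²⁾ I ε Sign.+
ω₃ C u = ∃₂ λ I ε → (I , ε) ∈ C × u ≡ x⁽³⁾ I ε Sign.+

record Parameters : Set₁ where
  constructor params
  field
    S        : Square 6
    C₁ C₂ C₃ : Pred (Vertex Γ) 0ℓ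

-- Squares are compared entrywise and cliques as sets.
_≋_ : Rel Parameters 0ℓ
params S C₁ C₂ C₃ ≋ params T D₁ D₂ D₃ =
  (∀ i j → S i j ≡ T i j) × C₁ ≐ D₁ × C₂ ≐ D₂ × C₃ ≐ D₃

{-# OPTIONS --safe #-}
module Submission where

-- Modulo the involution u ↦ ρ - u, which replaces an inner product q by 1 - q, the vectors u of L with ⟨ u , ρ ⟩ = 1
-- and ⟨ u , u ⟩ = 3 are the 216 vectors x i j k and, for c = 1, 2, 3, the 40 vectors x⁽ᶜ⁾ I ε +: among the cosets of Λ
-- on which ⟨ u , ρ ⟩ is odd, none has minimal norm below 3, and these are the minimal vectors of those with norm 3.
-- Inner products of vectors of different kinds are always 0 or 1.  Those of two vectors x i j k count the agreements
-- of the triples, so a compatible set of such vectors is a partial Latin square and has at most 36 elements.  Those of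
-- two vectors x⁽ᶜ⁾ with the same c are 3 minus the distance in the product of J(6,3) and K₂, so a compatible set of
-- such vectors is a clique of Γ; an exhaustive search shows that it has at most 7 elements.  This gives the bound
-- 36 + 3 · 7 = 57, and a set of 57 vectors attains all four bounds.

open import Defs
open Graph using (Vertex; _~_)

import Algebra.Properties.AbelianGroup
import Algebra.Properties.CommutativeSemigroup
open import Algebra.Bundles using (CommutativeMonoid)
open import Data.Bool.Base using (Bool; true; false; if_then_else_; _∧_; T)
import Data.Bool.Properties as Bool
open import Data.Empty using (⊥-elim)
open import Data.Fin.Base using (Fin; zero; suc; toℕ; fromℕ<; combine; splitAt; remQuot)
import Data.Fin.Properties as Fin
open import Data.Fin.Subset using (Subset; ∣_∣; _∩_; ∁)
open import Data.Fin.Subset.Properties using (∣p∩q∣≤∣p∣; ∩-comm; ∩-idem; anySubset?)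
open import Data.Integer.Base as ℤ using (ℤ; 0ℤ; 1ℤ; -1ℤ; +_; -[1+_]; _⊖_)
import Data.Integer.DivMod as ℤ
import Data.Integer.Properties as ℤ
open import Data.Integer.Tactic.RingSolver using (solve-∀)
open import Data.List.Base using (List; []; _∷_; length; lookup; tabulate; filter; cartesianProduct)
import Data.List.Base as List
import Data.List.Membership.DecPropositional as DecMembership
open import Data.List.Membership.Propositional using () renaming (_∈_ to _∈ˡ_)
open import Data.List.Membership.Propositional.Properties
  using (∈-lookup; ∈-tabulate⁺; ∈-tabulate⁻; ∈-filter⁺; ∈-cartesianProduct⁺; ∈-++⁺ˡ; ∈-++⁺ʳ; ∈-map⁺; ∈-map⁻)
open import Data.List.Properties using (length-map; length-tabulate)
open import Data.List.Relation.Unary.All as All using (All; []; _∷_)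
import Data.List.Relation.Unary.All.Properties as All
open import Data.List.Relation.Unary.AllPairs as AllPairs using (AllPairs; []; _∷_)
import Data.List.Relation.Unary.AllPairs.Properties as AllPairs
open import Data.List.Relation.Unary.Any as Any using (here; there)
open import Data.List.Relation.Unary.Any.Properties using (lookup-index)
open import Data.List.Relation.Unary.Unique.Propositional using (Unique)
open import Data.Nat.Base as ℕ using (ℕ; zero; suc)
import Data.Nat.DivMod as ℕ
import Data.Nat.Properties as ℕ
open import Data.Product using (∃!)
open import Data.Product.Base using (Σ; _×_; _,_; ∃; ∃₂; proj₁; proj₂)
open import Data.Rational.Base as ℚ using (ℚ; 0ℚ; 1ℚ; ½; _/_; fromℚᵘ; toℚᵘ)
import Data.Rational.Properties as ℚ
open import Data.Rational.Unnormalised.Base as ℚᵘ using (mkℚᵘ; *≡*)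
import Data.Rational.Unnormalised.Properties as ℚᵘ
open import Data.Sign.Base as Sign using (Sign)
import Data.Sign.Properties as Sign
open import Data.Sum.Base using (_⊎_; inj₁; inj₂; [_,_]′)
open import Data.Vec.Base using (Vec; []; _∷_; _++_; foldr′; fromList; last; map; replicate; zipWith)
import Data.Vec.Base as Vec
open import Data.Vec.Properties using (zipWith-++; map-++; map-cong; map-∘; ≡-dec)
open import Function.Base using (_∘_; _on_)
open import Function.Bundles using (Bijection; Equivalence; Injection)
open import Level using (0ℓ)
open import Relation.Binary.Definitions using (Symmetric; Irreflexive) renaming (Decidable to Decidable₂)
open import Relation.Binary.PropositionalEquality
open import Relation.Nullary.Decidable
  using (Dec; yes; no; does; dec-true; from-yes; map′; ¬?; _⊎-dec_; _×-dec_; _→-dec_)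
open import Relation.Nullary.Negation using (¬_; contradiction)
open import Relation.Unary using (Pred; Decidable; _∈_; _∪_)

-- The minimal vectors come from completing the square. In the coset of index c of A (n - 1) in its
-- dual, a vector has coordinates z - c / n with integers z of sum c, so its norm is c - c² / n plus
-- the sum of all z² - z. That sum is a natural number and vanishes exactly when every z is 0 or 1.
-- The minimal vectors are thus indexed by subsets of size c: size 5 or 1 gives the vectors ±
-- `α₅⁽ i ⁾`, size 3 the vectors `αₛ I`. Over a common denominator, norm 3 becomes an equation of
-- integers, and finding the cosets that can satisfy it is a check of 48 index tuples.
--
-- Vectors are then exchanged for elements of the combinatorial type `Rep` and inner products for
-- natural-number scores. The passage back is faithful because the score is the inner product plus
-- one: no two representative vectors have inner product -2, so a vector determines its
-- representative. Uniqueness of the square and of the cliques rests on this. The square is complete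
-- because 36 compatible cells, projected to any two of their three coordinates, exhaust all 36
-- pairs.

private
  module ℤ+ = Algebra.Properties.AbelianGroup ℤ.+-0-abelianGroup
  module ℚ- = Algebra.Properties.AbelianGroup ℚ.+-0-abelianGroup
  module ℚ+ = Algebra.Properties.CommutativeSemigroup (CommutativeMonoid.commutativeSemigroup ℚ.+-0-commutativeMonoid)

-- Fractions with a fixed denominator and sums of integer vectors

fromℚᵘ-homo-+ : ∀ p q → fromℚᵘ p ℚ.+ fromℚᵘ q ≡ fromℚᵘ (p ℚᵘ.+ q)
fromℚᵘ-homo-+ p q = ℚ.toℚᵘ-injective (begin
  toℚᵘ (fromℚᵘ p ℚ.+ fromℚᵘ q)                ≈⟨ ℚ.toℚᵘ-homo-+ (fromℚᵘ p) (fromℚᵘ q) ⟩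
  toℚᵘ (fromℚᵘ p) ℚᵘ.+ toℚᵘ (fromℚᵘ q)        ≈⟨ ℚᵘ.+-cong (ℚ.toℚᵘ-fromℚᵘ p) (ℚ.toℚᵘ-fromℚᵘ q) ⟩
  p ℚᵘ.+ q                                    ≈⟨ ℚ.toℚᵘ-fromℚᵘ (p ℚᵘ.+ q) ⟨
  toℚᵘ (fromℚᵘ (p ℚᵘ.+ q))                    ∎)
  where open ℚᵘ.≃-Reasoning

fromℚᵘ-homo-* : ∀ p q → fromℚᵘ p ℚ.* fromℚᵘ q ≡ fromℚᵘ (p ℚᵘ.* q)
fromℚᵘ-homo-* p q = ℚ.toℚᵘ-injective (begin
  toℚᵘ (fromℚᵘ p ℚ.* fromℚᵘ q)                ≈⟨ ℚ.toℚᵘ-homo-* (fromℚᵘ p) (fromℚᵘ q) ⟩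
  toℚᵘ (fromℚᵘ p) ℚᵘ.* toℚᵘ (fromℚᵘ q)        ≈⟨ ℚᵘ.*-cong (ℚ.toℚᵘ-fromℚᵘ p) (ℚ.toℚᵘ-fromℚᵘ q) ⟩
  p ℚᵘ.* q                                    ≈⟨ ℚ.toℚᵘ-fromℚᵘ (p ℚᵘ.* q) ⟨
  toℚᵘ (fromℚᵘ (p ℚᵘ.* q))                    ∎)
  where open ℚᵘ.≃-Reasoning

/-+-/ : ∀ p q d → p / suc d ℚ.+ q / suc d ≡ (p ℤ.+ q) / suc d
/-+-/ p q d = trans (fromℚᵘ-homo-+ (mkℚᵘ p d) (mkℚᵘ q d)) (ℚ.fromℚᵘ-cong {mkℚᵘ p d ℚᵘ.+ mkℚᵘ q d} {mkℚᵘ (p ℤ.+ q) d}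
  (*≡* (trans (rearrange p q (+ suc d)) (cong ((p ℤ.+ q) ℤ.*_) (sym (ℤ.pos-* (suc d) (suc d)))))))
  where
  rearrange : ∀ p q s → (p ℤ.* s ℤ.+ q ℤ.* s) ℤ.* s ≡ (p ℤ.+ q) ℤ.* (s ℤ.* s)
  rearrange = solve-∀

-‿/ : ∀ p d → ℚ.- (p / suc d) ≡ (ℤ.- p) / suc d
-‿/ p d = ℚ.toℚᵘ-injective (begin
  toℚᵘ (ℚ.- (p / suc d))        ≈⟨ ℚ.toℚᵘ-homo‿- (p / suc d) ⟩
  ℚᵘ.- toℚᵘ (p / suc d)         ≈⟨ ℚᵘ.-‿cong (ℚ.toℚᵘ-fromℚᵘ (mkℚᵘ p d)) ⟩
  mkℚᵘ (ℤ.- p) d                ≈⟨ ℚ.toℚᵘ-fromℚᵘ (mkℚᵘ (ℤ.- p) d) ⟨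
  toℚᵘ ((ℤ.- p) / suc d)        ∎)
  where open ℚᵘ.≃-Reasoning

/6-*-/6 : ∀ p q → (p / 6) ℚ.* (q / 6) ≡ (p ℤ.* q) / 36
/6-*-/6 p q = fromℚᵘ-homo-* (mkℚᵘ p 5) (mkℚᵘ q 5)

/1≡/6 : ∀ p → p / 1 ≡ (+ 6 ℤ.* p) / 6
/1≡/6 p = ℚ.fromℚᵘ-cong {mkℚᵘ p 0} {mkℚᵘ (+ 6 ℤ.* p) 5} (*≡* (rearrange p))
  where
  rearrange : ∀ p → p ℤ.* + 6 ≡ + 6 ℤ.* p ℤ.* + 1
  rearrange = solve-∀

/-injective : ∀ {p q} d → p / suc d ≡ q / suc d → p ≡ q
/-injective {p} {q} d eq with ℚ./-injective-≃ (mkℚᵘ p d) (mkℚᵘ q d) eq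
... | *≡* ps≡qs = ℤ.*-cancelʳ-≡ p q (+ suc d) ps≡qs

sumℤ : ∀ {n} → Vec ℤ n → ℤ
sumℤ = foldr′ ℤ._+_ 0ℤ

sumℤ-zipWith-+ : ∀ {n} (m k : Vec ℤ n) → sumℤ (zipWith ℤ._+_ m k) ≡ sumℤ m ℤ.+ sumℤ k
sumℤ-zipWith-+ []      []      = refl
sumℤ-zipWith-+ (p ∷ m) (q ∷ k) rewrite sumℤ-zipWith-+ m k = interchange p q (sumℤ m) (sumℤ k)
  where
  interchange : ∀ p q s t → (p ℤ.+ q) ℤ.+ (s ℤ.+ t) ≡ (p ℤ.+ s) ℤ.+ (q ℤ.+ t)
  interchange = solve-∀

sumℤ-neg : ∀ {n} (m : Vec ℤ n) → sumℤ (map ℤ.-_ m) ≡ ℤ.- sumℤ m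
sumℤ-neg []      = refl
sumℤ-neg (p ∷ m) rewrite sumℤ-neg m = sym (ℤ.neg-distrib-+ p (sumℤ m))

sumℤ-shift : ∀ {n} q (m : Vec ℤ n) → sumℤ (map (ℤ._+ q) m) ≡ sumℤ m ℤ.+ + n ℤ.* q
sumℤ-shift q []      = sym (ℤ.*-zeroˡ q)
sumℤ-shift {suc n} q (p ∷ m) rewrite sumℤ-shift q m = rearrange p q (sumℤ m) (+ n)
  where
  rearrange : ∀ p q s n → (p ℤ.+ q) ℤ.+ (s ℤ.+ n ℤ.* q) ≡ (p ℤ.+ s) ℤ.+ (1ℤ ℤ.+ n) ℤ.* q
  rearrange = solve-∀

-- Cosets of A n in its dual lattice

coordinate : (h c z : ℤ) → ℚ
coordinate h c z = (+ 6 ℤ.* z ℤ.- h ℤ.* c) / 6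

-- Where h * n = 6: the coset of index c of A (n - 1) in its dual lattice.  The coordinates of its elements have the
-- form z - c / n, which is written over the denominator 6.
record DualCoset {n} (h c : ℤ) (v : Vec ℚ n) : Set where
  constructor inCoset
  field
    integers    : Vec ℤ n
    sum≡c       : sumℤ integers ≡ c
    coordinates : v ≡ map (coordinate h c) integers

map-zipWith : ∀ {n} (f g k : ℤ → ℚ) → (∀ p q → f p ℚ.+ g q ≡ k (p ℤ.+ q)) →
              (m l : Vec ℤ n) → map f m +ᵛ map g l ≡ map k (zipWith ℤ._+_ m l)
map-zipWith f g k eq []      []      = refl
map-zipWith f g k eq (p ∷ m) (q ∷ l) = cong₂ _∷_ (eq p q) (map-zipWith f g k eq m l)

map-map : ∀ {X Y Z : Set} {n} (f : Y → Z) (g : X → Y) (k : X → Z) → (∀ p → f (g p) ≡ k p) →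
          (m : Vec X n) → map f (map g m) ≡ map k m
map-map f g k eq m = trans (sym (map-∘ f g m)) (map-cong eq m)

coset-+ : ∀ {n} {h c d} {v w : Vec ℚ n} → DualCoset h c v → DualCoset h d w → DualCoset h (c ℤ.+ d) (v +ᵛ w)
coset-+ {h = h} {c} {d} (inCoset m refl refl) (inCoset l refl refl) =
  inCoset (zipWith ℤ._+_ m l) (sumℤ-zipWith-+ m l)
  (map-zipWith (coordinate h c) (coordinate h d) (coordinate h (c ℤ.+ d))
    (λ p q → trans (/-+-/ (+ 6 ℤ.* p ℤ.- h ℤ.* c) (+ 6 ℤ.* q ℤ.- h ℤ.* d) 5) (cong (_/ 6) (rearrange p q h c d))) m l)
  where
  rearrange : ∀ p q h c d → (+ 6 ℤ.* p ℤ.- h ℤ.* c) ℤ.+ (+ 6 ℤ.* q ℤ.- h ℤ.* d)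
                          ≡ + 6 ℤ.* (p ℤ.+ q) ℤ.- h ℤ.* (c ℤ.+ d)
  rearrange = solve-∀

coset-neg : ∀ {n} {h c} {v : Vec ℚ n} → DualCoset h c v → DualCoset h (ℤ.- c) (-ᵛ v)
coset-neg {h = h} {c} (inCoset m refl refl) =
  inCoset (map ℤ.-_ m) (sumℤ-neg m)
  (trans (map-map ℚ.-_ (coordinate h c) (λ p → coordinate h (ℤ.- c) (ℤ.- p))
          (λ p → trans (-‿/ (+ 6 ℤ.* p ℤ.- h ℤ.* c) 5) (cong (_/ 6) (rearrange p h c))) m)
        (sym (map-map _ _ _ (λ _ → refl) m)))
  where
  rearrange : ∀ p h c → ℤ.- (+ 6 ℤ.* p ℤ.- h ℤ.* c) ≡ + 6 ℤ.* (ℤ.- p) ℤ.- h ℤ.* (ℤ.- c)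
  rearrange = solve-∀

-- Raising every integer by q and the index by `n * q` cancels in z - c / n, since `h * n` is 6. The
-- index of a coset therefore matters only modulo n.
coset-shift : ∀ {n} {h c} {v : Vec ℚ n} q → h ℤ.* + n ≡ + 6 → DualCoset h c v → DualCoset h (c ℤ.+ + n ℤ.* q) v
coset-shift {n} {h} {c} q hn≡6 (inCoset m refl refl) =
  inCoset (map (ℤ._+ q) m) (sumℤ-shift q m)
  (sym (map-map _ _ _ (λ p → cong (_/ 6) (begin
    + 6 ℤ.* (p ℤ.+ q) ℤ.- h ℤ.* (c ℤ.+ + n ℤ.* q)
      ≡⟨ rearrange p q h c (+ n) ⟩
    (+ 6 ℤ.* p ℤ.- h ℤ.* c) ℤ.+ (+ 6 ℤ.- h ℤ.* + n) ℤ.* q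
      ≡⟨ cong (λ k → (+ 6 ℤ.* p ℤ.- h ℤ.* c) ℤ.+ (+ 6 ℤ.- k) ℤ.* q) hn≡6 ⟩
    (+ 6 ℤ.* p ℤ.- h ℤ.* c) ℤ.+ 0ℤ ℤ.* q
      ≡⟨ cong (λ k → (+ 6 ℤ.* p ℤ.- h ℤ.* c) ℤ.+ k) (ℤ.*-zeroˡ q) ⟩
    (+ 6 ℤ.* p ℤ.- h ℤ.* c) ℤ.+ 0ℤ
      ≡⟨ ℤ.+-identityʳ _ ⟩
    + 6 ℤ.* p ℤ.- h ℤ.* c ∎)) m))
  where
  open ≡-Reasoning
  rearrange : ∀ p q h c n → + 6 ℤ.* (p ℤ.+ q) ℤ.- h ℤ.* (c ℤ.+ n ℤ.* q)
                          ≡ (+ 6 ℤ.* p ℤ.- h ℤ.* c) ℤ.+ (+ 6 ℤ.- h ℤ.* n) ℤ.* q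
  rearrange = solve-∀

coset-A : ∀ {n} h {v : Vec ℚ (suc n)} → v ∈ A n → DualCoset h 0ℤ v
coset-A h (m , sum≡0 , refl) = inCoset m sum≡0 (map-cong (λ p → trans (/1≡/6 p) (cong (_/ 6) (rearrange p h))) m)
  where
  rearrange : ∀ p h → + 6 ℤ.* p ≡ + 6 ℤ.* p ℤ.- h ℤ.* 0ℤ
  rearrange = solve-∀

-- The lattice L as a union of cosets of Λ

record Blocks : Set where
  constructor blocks
  field
    v₁ v₂ v₃    : Vec ℚ 6
    v₄ v₅ v₆ v₇ : Vec ℚ 2

⌊_⌋ : Blocks → E
⌊ blocks v₁ v₂ v₃ v₄ v₅ v₆ v₇ ⌋ = block v₁ v₂ v₃ v₄ v₅ v₆ v₇

InCosets : Vec ℤ 7 → Blocks → Set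
InCosets (c₁ ∷ c₂ ∷ c₃ ∷ c₄ ∷ c₅ ∷ c₆ ∷ c₇ ∷ []) (blocks v₁ v₂ v₃ v₄ v₅ v₆ v₇) =
  DualCoset 1ℤ c₁ v₁ × DualCoset 1ℤ c₂ v₂ × DualCoset 1ℤ c₃ v₃ ×
  DualCoset (+ 3) c₄ v₄ × DualCoset (+ 3) c₅ v₅ × DualCoset (+ 3) c₆ v₆ × DualCoset (+ 3) c₇ v₇

-- The coset indices, block by block, of -(a β₀ + b₁ β₁ + b₂ β₂ + b₃ β₃) modulo Λ. The sign arises
-- because `α n` has index -1 in the convention z - c / n.
glue : (a b₁ b₂ b₃ : ℤ) → Vec ℤ 7
glue a b₁ b₂ b₃ =
  a ℤ.+ + 3 ℤ.* b₁ ∷ a ℤ.+ + 3 ℤ.* b₂ ∷ a ℤ.+ + 3 ℤ.* b₃ ∷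
  b₂ ℤ.+ b₃ ∷ b₁ ℤ.+ b₃ ∷ b₁ ℤ.+ b₂ ∷ a ℤ.+ b₁ ℤ.+ b₂ ℤ.+ b₃ ∷ []

recoset : ∀ {n} {h c d} {v : Vec ℚ n} → c ≡ d → DualCoset h c v → DualCoset h d v
recoset refl p = p

zipBlocks : (ℚ → ℚ → ℚ) → Blocks → Blocks → Blocks
zipBlocks f (blocks v₁ v₂ v₃ v₄ v₅ v₆ v₇) (blocks w₁ w₂ w₃ w₄ w₅ w₆ w₇) =
  blocks (zipWith f v₁ w₁) (zipWith f v₂ w₂) (zipWith f v₃ w₃) (zipWith f v₄ w₄)
         (zipWith f v₅ w₅) (zipWith f v₆ w₆) (zipWith f v₇ w₇)

zipWith-⌊⌋ : ∀ f v w → zipWith f ⌊ v ⌋ ⌊ w ⌋ ≡ ⌊ zipBlocks f v w ⌋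
zipWith-⌊⌋ f (blocks v₁ v₂ v₃ v₄ v₅ v₆ v₇) (blocks w₁ w₂ w₃ w₄ w₅ w₆ w₇) =
  trans (zipWith-++ f v₁ _ w₁ _) (cong (zipWith f v₁ w₁ ++_)
  (trans (zipWith-++ f v₂ _ w₂ _) (cong (zipWith f v₂ w₂ ++_)
  (trans (zipWith-++ f v₃ _ w₃ _) (cong (zipWith f v₃ w₃ ++_)
  (trans (zipWith-++ f v₄ _ w₄ _) (cong (zipWith f v₄ w₄ ++_)
  (trans (zipWith-++ f v₅ _ w₅ _) (cong (zipWith f v₅ w₅ ++_)
  (zipWith-++ f v₆ v₇ w₆ w₇))))))))))

mapBlocks : (ℚ → ℚ) → Blocks → Blocks
mapBlocks f (blocks v₁ v₂ v₃ v₄ v₅ v₆ v₇) =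
  blocks (map f v₁) (map f v₂) (map f v₃) (map f v₄) (map f v₅) (map f v₆) (map f v₇)

map-⌊⌋ : ∀ f v → map f ⌊ v ⌋ ≡ ⌊ mapBlocks f v ⌋
map-⌊⌋ f (blocks v₁ v₂ v₃ v₄ v₅ v₆ v₇) =
  trans (map-++ f v₁ _) (cong (map f v₁ ++_)
  (trans (map-++ f v₂ _) (cong (map f v₂ ++_)
  (trans (map-++ f v₃ _) (cong (map f v₃ ++_)
  (trans (map-++ f v₄ _) (cong (map f v₄ ++_)
  (trans (map-++ f v₅ _) (cong (map f v₅ ++_)
  (map-++ f v₆ v₇))))))))))

Glued : E → Set
Glued u = ∃ λ a → ∃ λ b₁ → ∃ λ b₂ → ∃ λ b₃ → ∃ λ v → u ≡ ⌊ v ⌋ × InCosets (glue a b₁ b₂ b₃) v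

glued-Λ : ∀ {u} → u ∈ Λ → Glued u
glued-Λ (v₁ , _ , p₁ , (v₂ , _ , p₂ , (v₃ , _ , p₃ , (v₄ , _ , p₄ , (v₅ , _ , p₅ , (v₆ , v₇ , p₆ , p₇ , refl) , refl) , refl) , refl) , refl) , refl) =
  0ℤ , 0ℤ , 0ℤ , 0ℤ , blocks v₁ v₂ v₃ v₄ v₅ v₆ v₇ , refl ,
      coset-A 1ℤ p₁ , coset-A 1ℤ p₂ , coset-A 1ℤ p₃ ,
      coset-A (+ 3) p₄ , coset-A (+ 3) p₅ , coset-A (+ 3) p₆ , coset-A (+ 3) p₇

0-coset₆ : DualCoset {6} 1ℤ 0ℤ 0ᵛ
0-coset₆ = inCoset (replicate 6 0ℤ) refl refl

0-coset₂ : DualCoset {2} (+ 3) 0ℤ 0ᵛ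
0-coset₂ = inCoset (replicate 2 0ℤ) refl refl

α-coset : DualCoset 1ℤ -1ℤ (α 5)
α-coset = inCoset (0ℤ ∷ 0ℤ ∷ 0ℤ ∷ 0ℤ ∷ 0ℤ ∷ -1ℤ ∷ []) refl refl

3α-coset : DualCoset 1ℤ -[1+ 2 ] (3ℚ · α 5)
3α-coset = inCoset (0ℤ ∷ 0ℤ ∷ 0ℤ ∷ 0ℤ ∷ 0ℤ ∷ -[1+ 2 ] ∷ []) refl refl

α₁-coset : DualCoset (+ 3) -1ℤ (α 1)
α₁-coset = inCoset (0ℤ ∷ -1ℤ ∷ []) refl refl

-- `glue` is additive in its four arguments, so sums and negatives keep the form; each generator β
-- has -1 in its own argument and 0 in the others.
glued-L : ∀ {u} → u ∈ L → Glued u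
glued-L (gen (inj₁ p)) = glued-Λ p
glued-L (gen (inj₂ (inj₁ refl))) =
  -1ℤ , 0ℤ , 0ℤ , 0ℤ , blocks (α 5) (α 5) (α 5) 0ᵛ 0ᵛ 0ᵛ (α 1) , refl ,
      α-coset , α-coset , α-coset ,
      0-coset₂ , 0-coset₂ , 0-coset₂ , α₁-coset
glued-L (gen (inj₂ (inj₂ (inj₁ refl)))) =
  0ℤ , -1ℤ , 0ℤ , 0ℤ , blocks (3ℚ · α 5) 0ᵛ 0ᵛ 0ᵛ (α 1) (α 1) (α 1) , refl ,
      3α-coset , 0-coset₆ , 0-coset₆ ,
      0-coset₂ , α₁-coset , α₁-coset , α₁-coset
glued-L (gen (inj₂ (inj₂ (inj₂ (inj₁ refl))))) =
  0ℤ , 0ℤ , -1ℤ , 0ℤ , blocks 0ᵛ (3ℚ · α 5) 0ᵛ (α 1) 0ᵛ (α 1) (α 1) , refl ,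
      0-coset₆ , 3α-coset , 0-coset₆ ,
      α₁-coset , 0-coset₂ , α₁-coset , α₁-coset
glued-L (gen (inj₂ (inj₂ (inj₂ (inj₂ refl))))) =
  0ℤ , 0ℤ , 0ℤ , -1ℤ , blocks 0ᵛ 0ᵛ (3ℚ · α 5) (α 1) (α 1) 0ᵛ (α 1) , refl ,
      0-coset₆ , 0-coset₆ , 3α-coset ,
      α₁-coset , α₁-coset , 0-coset₂ , α₁-coset
glued-L zero =
  0ℤ , 0ℤ , 0ℤ , 0ℤ , blocks 0ᵛ 0ᵛ 0ᵛ 0ᵛ 0ᵛ 0ᵛ 0ᵛ , refl ,
      0-coset₆ , 0-coset₆ , 0-coset₆ ,
      0-coset₂ , 0-coset₂ , 0-coset₂ , 0-coset₂
glued-L (add p q) with glued-L p | glued-L q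
... | a , b₁ , b₂ , b₃ , v , refl , s₁ , s₂ , s₃ , s₄ , s₅ , s₆ , s₇
    | a′ , b₁′ , b₂′ , b₃′ , w , refl , t₁ , t₂ , t₃ , t₄ , t₅ , t₆ , t₇ =
  a ℤ.+ a′ , b₁ ℤ.+ b₁′ , b₂ ℤ.+ b₂′ , b₃ ℤ.+ b₃′ , _ , zipWith-⌊⌋ ℚ._+_ v w ,
      recoset (on₆ a b₁ a′ b₁′) (coset-+ s₁ t₁) , recoset (on₆ a b₂ a′ b₂′) (coset-+ s₂ t₂) , recoset (on₆ a b₃ a′ b₃′) (coset-+ s₃ t₃) ,
      recoset (on₂ b₂ b₃ b₂′ b₃′) (coset-+ s₄ t₄) , recoset (on₂ b₁ b₃ b₁′ b₃′) (coset-+ s₅ t₅) , recoset (on₂ b₁ b₂ b₁′ b₂′) (coset-+ s₆ t₆) , recoset (on₂′ a b₁ b₂ b₃ a′ b₁′ b₂′ b₃′) (coset-+ s₇ t₇)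
  where
  on₆ : ∀ a b a′ b′ → (a ℤ.+ + 3 ℤ.* b) ℤ.+ (a′ ℤ.+ + 3 ℤ.* b′) ≡ (a ℤ.+ a′) ℤ.+ + 3 ℤ.* (b ℤ.+ b′)
  on₆ = solve-∀
  on₂ : ∀ b c b′ c′ → (b ℤ.+ c) ℤ.+ (b′ ℤ.+ c′) ≡ (b ℤ.+ b′) ℤ.+ (c ℤ.+ c′)
  on₂ = solve-∀
  on₂′ : ∀ a b c d a′ b′ c′ d′ → (a ℤ.+ b ℤ.+ c ℤ.+ d) ℤ.+ (a′ ℤ.+ b′ ℤ.+ c′ ℤ.+ d′)
       ≡ (a ℤ.+ a′) ℤ.+ (b ℤ.+ b′) ℤ.+ (c ℤ.+ c′) ℤ.+ (d ℤ.+ d′)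
  on₂′ = solve-∀
glued-L (neg p) with glued-L p
... | a , b₁ , b₂ , b₃ , v , refl , s₁ , s₂ , s₃ , s₄ , s₅ , s₆ , s₇ =
  ℤ.- a , ℤ.- b₁ , ℤ.- b₂ , ℤ.- b₃ , _ , map-⌊⌋ ℚ.-_ v ,
      recoset (on₆ a b₁) (coset-neg s₁) , recoset (on₆ a b₂) (coset-neg s₂) , recoset (on₆ a b₃) (coset-neg s₃) ,
      recoset (on₂ b₂ b₃) (coset-neg s₄) , recoset (on₂ b₁ b₃) (coset-neg s₅) , recoset (on₂ b₁ b₂) (coset-neg s₆) , recoset (on₂′ a b₁ b₂ b₃) (coset-neg s₇)
  where
  on₆ : ∀ a b → ℤ.- (a ℤ.+ + 3 ℤ.* b) ≡ ℤ.- a ℤ.+ + 3 ℤ.* (ℤ.- b)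
  on₆ = solve-∀
  on₂ : ∀ b c → ℤ.- (b ℤ.+ c) ≡ ℤ.- b ℤ.+ ℤ.- c
  on₂ = solve-∀
  on₂′ : ∀ a b c d → ℤ.- (a ℤ.+ b ℤ.+ c ℤ.+ d) ≡ ℤ.- a ℤ.+ ℤ.- b ℤ.+ ℤ.- c ℤ.+ ℤ.- d
  on₂′ = solve-∀

residues : (a b₁ b₂ b₃ : ℕ) → Vec ℕ 7
residues a b₁ b₂ b₃ =
  (a ℕ.+ 3 ℕ.* b₁) ℕ.% 6 ∷ (a ℕ.+ 3 ℕ.* b₂) ℕ.% 6 ∷ (a ℕ.+ 3 ℕ.* b₃) ℕ.% 6 ∷
  (b₂ ℕ.+ b₃) ℕ.% 2 ∷ (b₁ ℕ.+ b₃) ℕ.% 2 ∷ (b₁ ℕ.+ b₂) ℕ.% 2 ∷ (a ℕ.+ b₁ ℕ.+ b₂ ℕ.+ b₃) ℕ.% 2 ∷ []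

coset-reduce : ∀ {n} .{{_ : ℕ.NonZero n}} {h c} {v : Vec ℚ n} m q → h ℤ.* + n ≡ + 6 →
               c ≡ + m ℤ.+ + n ℤ.* q → DualCoset h c v → DualCoset h (+ (m ℕ.% n)) v
coset-reduce {n} m q hn≡6 refl p = recoset index (coset-shift (ℤ.- (q ℤ.+ + (m ℕ./ n))) hn≡6 p)
  where
  open ≡-Reasoning
  cancel : ∀ r d n q → r ℤ.+ d ℤ.* n ℤ.+ n ℤ.* q ℤ.+ n ℤ.* (ℤ.- (q ℤ.+ d)) ≡ r
  cancel = solve-∀
  index : + m ℤ.+ + n ℤ.* q ℤ.+ + n ℤ.* (ℤ.- (q ℤ.+ + (m ℕ./ n))) ≡ + (m ℕ.% n)
  index = begin
    + m ℤ.+ + n ℤ.* q ℤ.+ + n ℤ.* (ℤ.- (q ℤ.+ + (m ℕ./ n)))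
      ≡⟨ cong (λ k → k ℤ.+ + n ℤ.* q ℤ.+ + n ℤ.* (ℤ.- (q ℤ.+ + (m ℕ./ n))))
           (trans (cong +_ (ℕ.m≡m%n+[m/n]*n m n)) (cong (λ k → + (m ℕ.% n) ℤ.+ k) (ℤ.pos-* (m ℕ./ n) n))) ⟩
    + (m ℕ.% n) ℤ.+ + (m ℕ./ n) ℤ.* + n ℤ.+ + n ℤ.* q ℤ.+ + n ℤ.* (ℤ.- (q ℤ.+ + (m ℕ./ n)))
      ≡⟨ cancel (+ (m ℕ.% n)) (+ (m ℕ./ n)) (+ n) q ⟩
    + (m ℕ.% n) ∎

remainder : ∀ (c : ℤ) n .{{_ : ℕ.NonZero n}} → ∃ λ (r : Fin n) → ∃ λ q → c ≡ + toℕ r ℤ.+ + n ℤ.* q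
remainder c n = fromℕ< (ℤ.n%ℕd<d c n) , c ℤ./ℕ n ,
  trans (ℤ.a≡a%ℕn+[a/ℕn]*n c n)
        (cong₂ ℤ._+_ (cong +_ (sym (Fin.toℕ-fromℕ< (ℤ.n%ℕd<d c n)))) (ℤ.*-comm (c ℤ./ℕ n) (+ n)))

-- Changing a by 6 or some bᵢ by 2 changes the first three indices by multiples of 6 and the last
-- four by multiples of 2, hence no coset. This leaves 48 index tuples.
glued-residues : ∀ {u} → Glued u →
  ∃ λ (a : Fin 6) → ∃ λ (b₁ : Fin 2) → ∃ λ (b₂ : Fin 2) → ∃ λ (b₃ : Fin 2) → ∃ λ v →
  u ≡ ⌊ v ⌋ × InCosets (map +_ (residues (toℕ a) (toℕ b₁) (toℕ b₂) (toℕ b₃))) v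
glued-residues (a , b₁ , b₂ , b₃ , v , u≡v , s₁ , s₂ , s₃ , s₄ , s₅ , s₆ , s₇)
  with remainder a 6 | remainder b₁ 2 | remainder b₂ 2 | remainder b₃ 2
... | r , q , refl | r₁ , q₁ , refl | r₂ , q₂ , refl | r₃ , q₃ , refl =
  r , r₁ , r₂ , r₃ , v , u≡v ,
  on₆ r₁ q₁ s₁ , on₆ r₂ q₂ s₂ , on₆ r₃ q₃ s₃ ,
  on₂ r₂ q₂ r₃ q₃ s₄ , on₂ r₁ q₁ r₃ q₃ s₅ , on₂ r₁ q₁ r₂ q₂ s₆ ,
  coset-reduce _ (+ 3 ℤ.* q ℤ.+ q₁ ℤ.+ q₂ ℤ.+ q₃) refl
    (rearrange₇ (+ toℕ r) q (+ toℕ r₁) q₁ (+ toℕ r₂) q₂ (+ toℕ r₃) q₃) s₇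
  where
  rearrange₆ : ∀ a q b p → a ℤ.+ + 6 ℤ.* q ℤ.+ + 3 ℤ.* (b ℤ.+ + 2 ℤ.* p) ≡ a ℤ.+ + 3 ℤ.* b ℤ.+ + 6 ℤ.* (q ℤ.+ p)
  rearrange₆ = solve-∀
  rearrange₂ : ∀ b p c q → b ℤ.+ + 2 ℤ.* p ℤ.+ (c ℤ.+ + 2 ℤ.* q) ≡ b ℤ.+ c ℤ.+ + 2 ℤ.* (p ℤ.+ q)
  rearrange₂ = solve-∀
  rearrange₇ : ∀ a q b p c r d s →
    a ℤ.+ + 6 ℤ.* q ℤ.+ (b ℤ.+ + 2 ℤ.* p) ℤ.+ (c ℤ.+ + 2 ℤ.* r) ℤ.+ (d ℤ.+ + 2 ℤ.* s)
      ≡ a ℤ.+ b ℤ.+ c ℤ.+ d ℤ.+ + 2 ℤ.* (+ 3 ℤ.* q ℤ.+ p ℤ.+ r ℤ.+ s)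
  rearrange₇ = solve-∀
  on₆ : ∀ {v} (s : Fin 2) p → DualCoset 1ℤ (+ toℕ r ℤ.+ + 6 ℤ.* q ℤ.+ + 3 ℤ.* (+ toℕ s ℤ.+ + 2 ℤ.* p)) v →
        DualCoset 1ℤ (+ ((toℕ r ℕ.+ 3 ℕ.* toℕ s) ℕ.% 6)) v
  on₆ s p = coset-reduce {6} _ (q ℤ.+ p) refl
    (trans (rearrange₆ (+ toℕ r) q (+ toℕ s) p)
           (cong (λ k → + toℕ r ℤ.+ k ℤ.+ + 6 ℤ.* (q ℤ.+ p)) (sym (ℤ.pos-* 3 (toℕ s)))))
  on₂ : ∀ {v} (s : Fin 2) p (t : Fin 2) o → DualCoset (+ 3) (+ toℕ s ℤ.+ + 2 ℤ.* p ℤ.+ (+ toℕ t ℤ.+ + 2 ℤ.* o)) v →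
        DualCoset (+ 3) (+ ((toℕ s ℕ.+ toℕ t) ℕ.% 2)) v
  on₂ s p t o = coset-reduce {2} _ (p ℤ.+ o) refl (rearrange₂ (+ toℕ s) p (+ toℕ t) o)

-- Inner products

⟨⟩-++ : ∀ {m n} (v w : Vec ℚ m) (v′ w′ : Vec ℚ n) → ⟨ v ++ v′ , w ++ w′ ⟩ ≡ ⟨ v , w ⟩ ℚ.+ ⟨ v′ , w′ ⟩
⟨⟩-++ []      []      v′ w′ = sym (ℚ.+-identityˡ _)
⟨⟩-++ (p ∷ v) (q ∷ w) v′ w′ =
  trans (cong (p ℚ.* q ℚ.+_) (⟨⟩-++ v w v′ w′)) (sym (ℚ.+-assoc (p ℚ.* q) ⟨ v , w ⟩ ⟨ v′ , w′ ⟩))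

⟨⟩-⌊⌋ : ∀ v w → let module v = Blocks v; module w = Blocks w in
  ⟨ ⌊ v ⌋ , ⌊ w ⌋ ⟩ ≡ ⟨ v.v₁ , w.v₁ ⟩ ℚ.+ (⟨ v.v₂ , w.v₂ ⟩ ℚ.+ (⟨ v.v₃ , w.v₃ ⟩ ℚ.+
    (⟨ v.v₄ , w.v₄ ⟩ ℚ.+ (⟨ v.v₅ , w.v₅ ⟩ ℚ.+ (⟨ v.v₆ , w.v₆ ⟩ ℚ.+ ⟨ v.v₇ , w.v₇ ⟩)))))
⟨⟩-⌊⌋ (blocks v₁ v₂ v₃ v₄ v₅ v₆ v₇) (blocks w₁ w₂ w₃ w₄ w₅ w₆ w₇) =
  trans (⟨⟩-++ v₁ w₁ _ _) (cong (⟨ v₁ , w₁ ⟩ ℚ.+_)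
  (trans (⟨⟩-++ v₂ w₂ _ _) (cong (⟨ v₂ , w₂ ⟩ ℚ.+_)
  (trans (⟨⟩-++ v₃ w₃ _ _) (cong (⟨ v₃ , w₃ ⟩ ℚ.+_)
  (trans (⟨⟩-++ v₄ w₄ _ _) (cong (⟨ v₄ , w₄ ⟩ ℚ.+_)
  (trans (⟨⟩-++ v₅ w₅ _ _) (cong (⟨ v₅ , w₅ ⟩ ℚ.+_)
  (⟨⟩-++ v₆ w₆ v₇ w₇))))))))))

⟨⟩-zeroʳ : ∀ {n} (v : Vec ℚ n) → ⟨ v , 0ᵛ ⟩ ≡ 0ℚ
⟨⟩-zeroʳ []      = refl
⟨⟩-zeroʳ (p ∷ v) = cong₂ ℚ._+_ (ℚ.*-zeroʳ p) (⟨⟩-zeroʳ v)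

⟨⟩-/6 : ∀ {n} (m l : Vec ℤ n) → ⟨ map (_/ 6) m , map (_/ 6) l ⟩ ≡ sumℤ (zipWith ℤ._*_ m l) / 36
⟨⟩-/6 []      []      = refl
⟨⟩-/6 (p ∷ m) (q ∷ l) = trans (cong₂ ℚ._+_ (/6-*-/6 p q) (⟨⟩-/6 m l)) (/-+-/ (p ℤ.* q) _ 35)

-- Norms in the dual cosets

-- This is z² - z as a natural number, positive unless z is 0 or 1.
excess : ℤ → ℕ
excess (+ zero)  = 0
excess (+ suc k) = suc k ℕ.* k
excess -[1+ k ]  = suc k ℕ.* suc (suc k)

square-excess : ∀ z → z ℤ.* z ≡ z ℤ.+ + excess z
square-excess (+ zero)  = refl
square-excess (+ suc k) = begin
  + suc k ℤ.* + suc k           ≡⟨ rearrange (+ k) ⟩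
  + suc k ℤ.+ + suc k ℤ.* + k   ≡⟨ cong (λ s → + suc k ℤ.+ s) (ℤ.pos-* (suc k) k) ⟨
  + suc k ℤ.+ + (suc k ℕ.* k)   ∎
  where
  open ≡-Reasoning
  rearrange : ∀ k → (1ℤ ℤ.+ k) ℤ.* (1ℤ ℤ.+ k) ≡ (1ℤ ℤ.+ k) ℤ.+ (1ℤ ℤ.+ k) ℤ.* k
  rearrange = solve-∀
square-excess -[1+ k ] = begin
  -[1+ k ] ℤ.* -[1+ k ]                       ≡⟨ rearrange (+ k) ⟩
  -[1+ k ] ℤ.+ + suc k ℤ.* + suc (suc k)      ≡⟨ cong (λ s → -[1+ k ] ℤ.+ s) (ℤ.pos-* (suc k) (suc (suc k))) ⟨
  -[1+ k ] ℤ.+ + (suc k ℕ.* suc (suc k))      ∎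
  where
  open ≡-Reasoning
  rearrange : ∀ k → (ℤ.- (1ℤ ℤ.+ k)) ℤ.* (ℤ.- (1ℤ ℤ.+ k)) ≡ ℤ.- (1ℤ ℤ.+ k) ℤ.+ (1ℤ ℤ.+ k) ℤ.* (+ 2 ℤ.+ k)
  rearrange = solve-∀

excesses : ∀ {n} → Vec ℤ n → ℕ
excesses []      = 0
excesses (z ∷ m) = excess z ℕ.+ excesses m

-- Expand (6 z - h c)² and replace z² by z + `excess z`. The index c is not tied to the sum of m,
-- because the induction passes to the tail of m, whose sum is a different number.
sum-squares : ∀ {n} h c (m : Vec ℤ n) → let p = map (λ z → + 6 ℤ.* z ℤ.- h ℤ.* c) m in
  sumℤ (zipWith ℤ._*_ p p)
    ≡ + 36 ℤ.* (+ excesses m) ℤ.+ (+ 36 ℤ.- + 12 ℤ.* h ℤ.* c) ℤ.* sumℤ m ℤ.+ h ℤ.* + n ℤ.* h ℤ.* c ℤ.* c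
sum-squares h c [] = base h c
  where
  base : ∀ h c → 0ℤ ≡ + 36 ℤ.* 0ℤ ℤ.+ (+ 36 ℤ.- + 12 ℤ.* h ℤ.* c) ℤ.* 0ℤ ℤ.+ h ℤ.* 0ℤ ℤ.* h ℤ.* c ℤ.* c
  base = solve-∀
sum-squares {suc n} h c (z ∷ m) rewrite sum-squares h c m = begin
  (+ 6 ℤ.* z ℤ.- h ℤ.* c) ℤ.* (+ 6 ℤ.* z ℤ.- h ℤ.* c) ℤ.+ (+ 36 ℤ.* x′ ℤ.+ (+ 36 ℤ.- + 12 ℤ.* h ℤ.* c) ℤ.* s ℤ.+ h ℤ.* + n ℤ.* h ℤ.* c ℤ.* c)
    ≡⟨ expand z h c x′ s (+ n) ⟩
  + 36 ℤ.* (z ℤ.* z ℤ.- z ℤ.+ x′) ℤ.+ r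
    ≡⟨ cong (λ k → + 36 ℤ.* (k ℤ.- z ℤ.+ x′) ℤ.+ r) (square-excess z) ⟩
  + 36 ℤ.* (z ℤ.+ + excess z ℤ.- z ℤ.+ x′) ℤ.+ r
    ≡⟨ cancel z (+ excess z) x′ r ⟩
  + 36 ℤ.* (+ excess z ℤ.+ x′) ℤ.+ r
    ≡⟨ ℤ.+-assoc (+ 36 ℤ.* (+ excess z ℤ.+ x′)) _ _ ⟨
  + 36 ℤ.* (+ excess z ℤ.+ x′) ℤ.+ (+ 36 ℤ.- + 12 ℤ.* h ℤ.* c) ℤ.* (z ℤ.+ s) ℤ.+ h ℤ.* + suc n ℤ.* h ℤ.* c ℤ.* c ∎
  where
  open ≡-Reasoning
  s x′ r : ℤ
  s = sumℤ m
  x′ = + excesses m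
  r = (+ 36 ℤ.- + 12 ℤ.* h ℤ.* c) ℤ.* (z ℤ.+ s) ℤ.+ h ℤ.* + suc n ℤ.* h ℤ.* c ℤ.* c
  expand : ∀ z h c x s n →
    (+ 6 ℤ.* z ℤ.- h ℤ.* c) ℤ.* (+ 6 ℤ.* z ℤ.- h ℤ.* c) ℤ.+ (+ 36 ℤ.* x ℤ.+ (+ 36 ℤ.- + 12 ℤ.* h ℤ.* c) ℤ.* s ℤ.+ h ℤ.* n ℤ.* h ℤ.* c ℤ.* c)
      ≡ + 36 ℤ.* (z ℤ.* z ℤ.- z ℤ.+ x) ℤ.+ ((+ 36 ℤ.- + 12 ℤ.* h ℤ.* c) ℤ.* (z ℤ.+ s) ℤ.+ h ℤ.* (1ℤ ℤ.+ n) ℤ.* h ℤ.* c ℤ.* c)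
  expand = solve-∀
  cancel : ∀ z e x r → + 36 ℤ.* (z ℤ.+ e ℤ.- z ℤ.+ x) ℤ.+ r ≡ + 36 ℤ.* (e ℤ.+ x) ℤ.+ r
  cancel = solve-∀

cosetExcess : ∀ {n h c} {v : Vec ℚ n} → DualCoset h c v → ℕ
cosetExcess p = excesses (DualCoset.integers p)

-- Six times the minimal norm of the coset, attained when all integers are 0 or 1.
minimum : (h c : ℤ) → ℤ
minimum h c = + 6 ℤ.* c ℤ.- h ℤ.* c ℤ.* c

record SixfoldNorm (q : ℚ) (excess : ℕ) (minimum : ℤ) : Set where
  constructor sixfold
  field
    norm≡ : q ≡ (+ 6 ℤ.* (+ 6 ℤ.* + excess ℤ.+ minimum)) / 36

sixfold-+ : ∀ {k l m n q r} → SixfoldNorm q k m → SixfoldNorm r l n → SixfoldNorm (q ℚ.+ r) (k ℕ.+ l) (m ℤ.+ n)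
sixfold-+ {k} {l} {m} {n} (sixfold refl) (sixfold refl) = sixfold
  (trans (/-+-/ (+ 6 ℤ.* (+ 6 ℤ.* + k ℤ.+ m)) _ 35) (cong (_/ 36) (rearrange (+ k) (+ l) m n)))
  where
  rearrange : ∀ k l m n → + 6 ℤ.* (+ 6 ℤ.* k ℤ.+ m) ℤ.+ + 6 ℤ.* (+ 6 ℤ.* l ℤ.+ n)
                        ≡ + 6 ℤ.* (+ 6 ℤ.* (k ℤ.+ l) ℤ.+ (m ℤ.+ n))
  rearrange = solve-∀

-- Once the integers sum to c and `h * n` is 6, the cross term -12 h c² and the constant term 6 h c²
-- of `sum-squares` combine to -6 h c². A factor 6 then splits off, and what remains over it is six
-- times the norm.
coset-norm : ∀ {n h c} {v : Vec ℚ n} → h ℤ.* + n ≡ + 6 → (p : DualCoset h c v) →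
             SixfoldNorm ⟨ v , v ⟩ (cosetExcess p) (minimum h c)
coset-norm {n} {h} hn≡6 (inCoset m refl refl) = sixfold (begin
  ⟨ map (coordinate h c) m , map (coordinate h c) m ⟩
    ≡⟨ cong₂ ⟨_,_⟩ (map-∘ (_/ 6) f m) (map-∘ (_/ 6) f m) ⟩
  ⟨ map (_/ 6) (map f m) , map (_/ 6) (map f m) ⟩
    ≡⟨ ⟨⟩-/6 (map f m) (map f m) ⟩
  sumℤ (zipWith ℤ._*_ (map f m) (map f m)) / 36
    ≡⟨ cong (_/ 36) (trans (sum-squares h c m) (trans
        (cong (λ k → + 36 ℤ.* + excesses m ℤ.+ (+ 36 ℤ.- + 12 ℤ.* h ℤ.* c) ℤ.* c ℤ.+ k ℤ.* h ℤ.* c ℤ.* c) hn≡6)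
        (rearrange h c (+ excesses m)))) ⟩
  (+ 6 ℤ.* (+ 6 ℤ.* + excesses m ℤ.+ minimum h c)) / 36 ∎)
  where
  open ≡-Reasoning
  c = sumℤ m
  f : ℤ → ℤ
  f z = + 6 ℤ.* z ℤ.- h ℤ.* c
  rearrange : ∀ h c x → + 36 ℤ.* x ℤ.+ (+ 36 ℤ.- + 12 ℤ.* h ℤ.* c) ℤ.* c ℤ.+ + 6 ℤ.* h ℤ.* c ℤ.* c
                      ≡ + 6 ℤ.* (+ 6 ℤ.* x ℤ.+ (+ 6 ℤ.* c ℤ.- h ℤ.* c ℤ.* c))
  rearrange = solve-∀

excess-zero : ∀ z → excess z ≡ 0 → z ≡ 0ℤ ⊎ z ≡ 1ℤ
excess-zero (+ zero)        _ = inj₁ refl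
excess-zero (+ suc zero)    _ = inj₂ refl
excess-zero (+ suc (suc k)) ()
excess-zero -[1+ k ]        ()

bit : Bool → ℤ
bit b = if b then 1ℤ else 0ℤ

excesses-zero : ∀ {n} (m : Vec ℤ n) → excesses m ≡ 0 → ∃ λ (I : Subset n) → m ≡ map bit I
excesses-zero []      _  = [] , refl
excesses-zero (z ∷ m) eq with excess-zero z (ℕ.m+n≡0⇒m≡0 (excess z) eq) | excesses-zero m (ℕ.m+n≡0⇒n≡0 (excess z) eq)
... | inj₁ refl | I , refl = false ∷ I , refl
... | inj₂ refl | I , refl = true ∷ I , refl

sumℤ-bit : ∀ {n} (I : Subset n) → sumℤ (map bit I) ≡ + ∣ I ∣
sumℤ-bit []          = refl
sumℤ-bit (false ∷ I) = trans (ℤ.+-identityˡ _) (sumℤ-bit I)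
sumℤ-bit (true  ∷ I) = cong (λ k → 1ℤ ℤ.+ k) (sumℤ-bit I)

shape : ∀ {n} (h c : ℤ) → Subset n → Vec ℚ n
shape h c I = map (coordinate h c) (map bit I)

Minimal : ∀ {n} (h : ℤ) (r : ℕ) → Vec ℚ n → Set
Minimal {n} h r v = ∃ λ (I : Subset n) → ∣ I ∣ ≡ r × v ≡ shape h (+ r) I

coset-minimal : ∀ {n h r} {v : Vec ℚ n} (p : DualCoset h (+ r) v) → cosetExcess p ≡ 0 → Minimal h r v
coset-minimal (inCoset m sum≡r v≡) eq with excesses-zero m eq
... | I , refl = I , ℤ.+-injective (trans (sym (sumℤ-bit I)) sum≡r) , v≡

cosetMinimum : Vec ℕ 7 → ℤ
cosetMinimum (r₁ ∷ r₂ ∷ r₃ ∷ r₄ ∷ r₅ ∷ r₆ ∷ r₇ ∷ []) =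
  minimum 1ℤ (+ r₁) ℤ.+ (minimum 1ℤ (+ r₂) ℤ.+ (minimum 1ℤ (+ r₃) ℤ.+
  (minimum (+ 3) (+ r₄) ℤ.+ (minimum (+ 3) (+ r₅) ℤ.+ (minimum (+ 3) (+ r₆) ℤ.+ minimum (+ 3) (+ r₇))))))

totalExcess : ∀ rs {v} → InCosets (map +_ rs) v → ℕ
totalExcess (_ ∷ _ ∷ _ ∷ _ ∷ _ ∷ _ ∷ _ ∷ []) (p₁ , p₂ , p₃ , p₄ , p₅ , p₆ , p₇) =
  cosetExcess p₁ ℕ.+ (cosetExcess p₂ ℕ.+ (cosetExcess p₃ ℕ.+
  (cosetExcess p₄ ℕ.+ (cosetExcess p₅ ℕ.+ (cosetExcess p₆ ℕ.+ cosetExcess p₇)))))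

norm-⌊⌋ : ∀ rs v (p : InCosets (map +_ rs) v) →
         SixfoldNorm ⟨ ⌊ v ⌋ , ⌊ v ⌋ ⟩ (totalExcess rs p) (cosetMinimum rs)
norm-⌊⌋ rs@(_ ∷ _ ∷ _ ∷ _ ∷ _ ∷ _ ∷ _ ∷ []) v p@(p₁ , p₂ , p₃ , p₄ , p₅ , p₆ , p₇) =
  subst (λ q → SixfoldNorm q (totalExcess rs p) (cosetMinimum rs)) (sym (⟨⟩-⌊⌋ v v))
  (sixfold-+ (coset-norm refl p₁) (sixfold-+ (coset-norm refl p₂) (sixfold-+ (coset-norm refl p₃)
  (sixfold-+ (coset-norm refl p₄) (sixfold-+ (coset-norm refl p₅) (sixfold-+ (coset-norm refl p₆)
  (coset-norm refl p₇)))))))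

-- The 18 is six times the norm 3, on the scale of `minimum`.
norm-3 : ∀ rs v (p : InCosets (map +_ rs) v) → ⟨ ⌊ v ⌋ , ⌊ v ⌋ ⟩ ≡ 3ℚ →
         + 6 ℤ.* + totalExcess rs p ℤ.+ cosetMinimum rs ≡ + 18
norm-3 rs v p eq = ℤ.*-cancelˡ-≡ (+ 6) _ (+ 18) (/-injective 35 (trans (sym (SixfoldNorm.norm≡ (norm-⌊⌋ rs v p))) eq))

-- Classification of the vectors of norm 3 having inner product 1 with ρ

⟨⟩-ρ : ∀ v → ⟨ ⌊ v ⌋ , ρ ⟩ ≡ ⟨ Blocks.v₇ v , 2ℚ · α 1 ⟩
⟨⟩-ρ v@(blocks v₁ v₂ v₃ v₄ v₅ v₆ v₇) = trans (⟨⟩-⌊⌋ v (blocks 0ᵛ 0ᵛ 0ᵛ 0ᵛ 0ᵛ 0ᵛ (2ℚ · α 1)))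
  (drop v₁ (drop v₂ (drop v₃ (drop v₄ (drop v₅ (drop v₆ refl))))))
  where
  drop : ∀ {n q r} (w : Vec ℚ n) → q ≡ r → ⟨ w , 0ᵛ ⟩ ℚ.+ q ≡ r
  drop {q = q} w refl = trans (cong (ℚ._+ q) (⟨⟩-zeroʳ w)) (ℚ.+-identityˡ q)

-- A vector (p, -p) of the lattice A 1 has inner product 2p ≠ 1 with 2 α 1.
coset-root : ∀ {v} → DualCoset (+ 3) 0ℤ v → ⟨ v , 2ℚ · α 1 ⟩ ≢ 1ℚ
coset-root (inCoset (z₁ ∷ z₂ ∷ []) sum≡0 refl) eq = even z₁ (ℤ.*-cancelˡ-≡ (+ 36) (+ 2 ℤ.* z₁) 1ℤ doubled)
  where
  open ≡-Reasoning
  p₁ p₂ : ℤ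
  p₁ = + 6 ℤ.* z₁ ℤ.- + 3 ℤ.* 0ℤ
  p₂ = + 6 ℤ.* z₂ ℤ.- + 3 ℤ.* 0ℤ
  difference : p₁ ℤ.* + 6 ℤ.+ (p₂ ℤ.* -[1+ 5 ] ℤ.+ 0ℤ) ≡ + 36
  difference = /-injective 35 (trans (sym (⟨⟩-/6 (p₁ ∷ p₂ ∷ []) (+ 6 ∷ -[1+ 5 ] ∷ []))) eq)
  rearrange : ∀ z₁ z₂ → + 36 ℤ.* (+ 2 ℤ.* z₁)
    ≡ ((+ 6 ℤ.* z₁ ℤ.- + 3 ℤ.* 0ℤ) ℤ.* + 6 ℤ.+ ((+ 6 ℤ.* z₂ ℤ.- + 3 ℤ.* 0ℤ) ℤ.* (ℤ.- + 6) ℤ.+ 0ℤ)) ℤ.+ + 36 ℤ.* (z₁ ℤ.+ (z₂ ℤ.+ 0ℤ))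
  rearrange = solve-∀
  doubled : + 36 ℤ.* (+ 2 ℤ.* z₁) ≡ + 36 ℤ.* 1ℤ
  doubled = trans (rearrange z₁ z₂) (cong₂ (λ k l → k ℤ.+ + 36 ℤ.* l) difference sum≡0)
  even : ∀ z → + 2 ℤ.* z ≢ 1ℤ
  even (+ zero)        ()
  even (+ suc zero)    ()
  even (+ suc (suc k)) ()
  even -[1+ k ]        ()

-- The residues of the cosets of norm 3 which contain vectors u with ⟨ u , ρ ⟩ ≡ 1.
data Short : Vec ℕ 7 → Set where
  short₀⁺ : Short (1 ∷ 1 ∷ 1 ∷ 0 ∷ 0 ∷ 0 ∷ 1 ∷ [])
  short₀⁻ : Short (5 ∷ 5 ∷ 5 ∷ 0 ∷ 0 ∷ 0 ∷ 1 ∷ [])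
  short₁  : Short (3 ∷ 0 ∷ 0 ∷ 0 ∷ 1 ∷ 1 ∷ 1 ∷ [])
  short₂  : Short (0 ∷ 3 ∷ 0 ∷ 1 ∷ 0 ∷ 1 ∷ 1 ∷ [])
  short₃  : Short (0 ∷ 0 ∷ 3 ∷ 1 ∷ 1 ∷ 0 ∷ 1 ∷ [])

_≟ᵛ_ : (rs ss : Vec ℕ 7) → Dec (rs ≡ ss)
_≟ᵛ_ = ≡-dec ℕ._≟_

ShortOrLong : Vec ℕ 7 → Set
ShortOrLong rs =
  (rs ≡ 1 ∷ 1 ∷ 1 ∷ 0 ∷ 0 ∷ 0 ∷ 1 ∷ [] ⊎ rs ≡ 5 ∷ 5 ∷ 5 ∷ 0 ∷ 0 ∷ 0 ∷ 1 ∷ [] ⊎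
   rs ≡ 3 ∷ 0 ∷ 0 ∷ 0 ∷ 1 ∷ 1 ∷ 1 ∷ [] ⊎ rs ≡ 0 ∷ 3 ∷ 0 ∷ 1 ∷ 0 ∷ 1 ∷ 1 ∷ [] ⊎
   rs ≡ 0 ∷ 0 ∷ 3 ∷ 1 ∷ 1 ∷ 0 ∷ 1 ∷ []) ⊎
  last rs ≡ 0 ⊎ + 18 ℤ.< cosetMinimum rs

shortOrLong? : ∀ rs → Dec (ShortOrLong rs)
shortOrLong? rs = (rs ≟ᵛ _ ⊎-dec rs ≟ᵛ _ ⊎-dec rs ≟ᵛ _ ⊎-dec rs ≟ᵛ _ ⊎-dec rs ≟ᵛ _)
  ⊎-dec last rs ℕ.≟ 0 ⊎-dec + 18 ℤ.<? cosetMinimum rs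

abstract
  -- An even last index contradicts inner product 1 with ρ, and a minimum above 18 contradicts norm
  -- 3. The five remaining cosets are those of β₀, -β₀, β₁, β₂ and β₃. Different tuples may name the
  -- same coset: (3, 1, 1, 1) and (0, 0, 0, 0) do.
  residues-shortOrLong : ∀ (a : Fin 6) (b₁ b₂ b₃ : Fin 2) → ShortOrLong (residues (toℕ a) (toℕ b₁) (toℕ b₂) (toℕ b₃))
  residues-shortOrLong = from-yes (Fin.all? λ a → Fin.all? λ b₁ → Fin.all? λ b₂ → Fin.all? λ b₃ →
    shortOrLong? (residues (toℕ {6} a) (toℕ {2} b₁) (toℕ {2} b₂) (toℕ {2} b₃)))

short : ∀ {rs} → ShortOrLong rs → Short rs ⊎ last rs ≡ 0 ⊎ + 18 ℤ.< cosetMinimum rs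
short (inj₁ (inj₁ refl))                      = inj₁ short₀⁺
short (inj₁ (inj₂ (inj₁ refl)))               = inj₁ short₀⁻
short (inj₁ (inj₂ (inj₂ (inj₁ refl))))        = inj₁ short₁
short (inj₁ (inj₂ (inj₂ (inj₂ (inj₁ refl))))) = inj₁ short₂
short (inj₁ (inj₂ (inj₂ (inj₂ (inj₂ refl))))) = inj₁ short₃
short (inj₂ p)                                = inj₂ p

AllMinimal : Vec ℕ 7 → Blocks → Set
AllMinimal (r₁ ∷ r₂ ∷ r₃ ∷ r₄ ∷ r₅ ∷ r₆ ∷ r₇ ∷ []) (blocks v₁ v₂ v₃ v₄ v₅ v₆ v₇) =
  Minimal 1ℤ r₁ v₁ × Minimal 1ℤ r₂ v₂ × Minimal 1ℤ r₃ v₃ ×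
  Minimal (+ 3) r₄ v₄ × Minimal (+ 3) r₅ v₅ × Minimal (+ 3) r₆ v₆ × Minimal (+ 3) r₇ v₇

allMinimal : ∀ rs {v} (p : InCosets (map +_ rs) v) → totalExcess rs p ≡ 0 → AllMinimal rs v
allMinimal (_ ∷ _ ∷ _ ∷ _ ∷ _ ∷ _ ∷ _ ∷ []) (p₁ , p₂ , p₃ , p₄ , p₅ , p₆ , p₇) eq₁ =
  coset-minimal p₁ (ℕ.m+n≡0⇒m≡0 _ eq₁) , coset-minimal p₂ (ℕ.m+n≡0⇒m≡0 _ eq₂) ,
  coset-minimal p₃ (ℕ.m+n≡0⇒m≡0 _ eq₃) , coset-minimal p₄ (ℕ.m+n≡0⇒m≡0 _ eq₄) ,
  coset-minimal p₅ (ℕ.m+n≡0⇒m≡0 _ eq₅) , coset-minimal p₆ (ℕ.m+n≡0⇒m≡0 _ eq₆) ,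
  coset-minimal p₇ (ℕ.m+n≡0⇒n≡0 (cosetExcess p₆) eq₆)
  where
  eq₂ = ℕ.m+n≡0⇒n≡0 (cosetExcess p₁) eq₁
  eq₃ = ℕ.m+n≡0⇒n≡0 (cosetExcess p₂) eq₂
  eq₄ = ℕ.m+n≡0⇒n≡0 (cosetExcess p₃) eq₃
  eq₅ = ℕ.m+n≡0⇒n≡0 (cosetExcess p₄) eq₄
  eq₆ = ℕ.m+n≡0⇒n≡0 (cosetExcess p₅) eq₅

short-minimum : ∀ {rs} → Short rs → cosetMinimum rs ≡ + 18
short-minimum short₀⁺ = refl
short-minimum short₀⁻ = refl
short-minimum short₁  = refl
short-minimum short₂  = refl
short-minimum short₃  = refl

minimal-vector : ∀ {u} → u ∈ L → ⟨ u , ρ ⟩ ≡ 1ℚ → ⟨ u , u ⟩ ≡ 3ℚ →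
                 ∃₂ λ rs v → u ≡ ⌊ v ⌋ × Short rs × AllMinimal rs v
minimal-vector {u} u∈L root norm =
  let a , b₁ , b₂ , b₃ , v , u≡v , p = glued-residues (glued-L u∈L) in
  select (residues (toℕ a) (toℕ b₁) (toℕ b₂) (toℕ b₃)) v u≡v p (short (residues-shortOrLong a b₁ b₂ b₃))
  where
  select : ∀ rs v → u ≡ ⌊ v ⌋ → InCosets (map +_ rs) v → Short rs ⊎ last rs ≡ 0 ⊎ + 18 ℤ.< cosetMinimum rs →
           ∃₂ λ rs v → u ≡ ⌊ v ⌋ × Short rs × AllMinimal rs v
  select rs v refl p (inj₁ s) = rs , v , refl , s , allMinimal rs p no-excess
    where
    no-excess : totalExcess rs p ≡ 0
    no-excess = ℤ.+-injective (ℤ.*-cancelˡ-≡ (+ 6) (+ totalExcess rs p) 0ℤ (ℤ+.∙-cancelʳ (cosetMinimum rs) _ _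
      (trans (norm-3 rs v p norm) (trans (sym (short-minimum s)) (sym (ℤ.+-identityˡ (cosetMinimum rs)))))))
  select (_ ∷ _ ∷ _ ∷ _ ∷ _ ∷ _ ∷ _ ∷ []) v refl (_ , _ , _ , _ , _ , _ , p₇) (inj₂ (inj₁ refl)) =
    ⊥-elim (coset-root p₇ (trans (sym (⟨⟩-ρ v)) root))
  select rs v refl p (inj₂ (inj₂ 18<m)) =
    ⊥-elim (ℤ.<⇒≱ 18<m (ℤ.≤-trans below (ℤ.≤-reflexive (norm-3 rs v p norm))))
    where
    below : cosetMinimum rs ℤ.≤ + 6 ℤ.* + totalExcess rs p ℤ.+ cosetMinimum rs
    below = subst (λ k → cosetMinimum rs ℤ.≤ k ℤ.+ cosetMinimum rs) (ℤ.pos-* 6 (totalExcess rs p))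
              (ℤ.i≤j+i (cosetMinimum rs) (+ (6 ℕ.* totalExcess rs p)))

allSubsets? : ∀ {n} {P : Subset n → Set} → Decidable P → Dec (∀ I → P I)
allSubsets? {zero}  P? = map′ (λ p → λ { [] → p }) (λ f → f []) (P? [])
allSubsets? {suc n} P? =
  map′ (λ (p , q) → λ { (true ∷ I) → p I ; (false ∷ I) → q I }) (λ f → f ∘ (true ∷_) , f ∘ (false ∷_))
    (allSubsets? (P? ∘ (true ∷_)) ×-dec allSubsets? (P? ∘ (false ∷_)))

_≟_ : ∀ {n} (v w : Vec ℚ n) → Dec (v ≡ w)
_≟_ = ≡-dec ℚ._≟_

abstract
  shape-0₆ : ∀ (I : Subset 6) → ∣ I ∣ ≡ 0 → shape 1ℤ (+ 0) I ≡ 0ᵛ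
  shape-0₆ = from-yes (allSubsets? {6} λ I → ∣ I ∣ ℕ.≟ 0 →-dec shape 1ℤ (+ 0) I ≟ 0ᵛ)

abstract
  shape-0₂ : ∀ (I : Subset 2) → ∣ I ∣ ≡ 0 → shape (+ 3) (+ 0) I ≡ 0ᵛ
  shape-0₂ = from-yes (allSubsets? {2} λ I → ∣ I ∣ ℕ.≟ 0 →-dec shape (+ 3) (+ 0) I ≟ 0ᵛ)

abstract
  shape-1₆ : ∀ (I : Subset 6) → ∣ I ∣ ≡ 1 → ∃ λ i → shape 1ℤ (+ 1) I ≡ 0ᵛ -ᵛ α₅⁽ i ⁾
  shape-1₆ = from-yes (allSubsets? {6} λ I → ∣ I ∣ ℕ.≟ 1 →-dec Fin.any? λ i → shape 1ℤ (+ 1) I ≟ (0ᵛ -ᵛ α₅⁽ i ⁾))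

abstract
  shape-5₆ : ∀ (I : Subset 6) → ∣ I ∣ ≡ 5 → ∃ λ i → shape 1ℤ (+ 5) I ≡ α₅⁽ i ⁾
  shape-5₆ = from-yes (allSubsets? {6} λ I → ∣ I ∣ ℕ.≟ 5 →-dec Fin.any? λ i → shape 1ℤ (+ 5) I ≟ α₅⁽ i ⁾)

abstract
  -- Two readings of one vector, as `αₛ (∁ I)` is the negative of `αₛ I`. The first serves vectors
  -- that are themselves representatives, the second those whose switch is one.
  shape-3₆ : ∀ (I : Subset 6) → ∣ I ∣ ≡ 3 → ∣ ∁ I ∣ ≡ 3 × shape 1ℤ (+ 3) I ≡ αₛ (∁ I) × shape 1ℤ (+ 3) I ≡ 0ᵛ -ᵛ αₛ I
  shape-3₆ = from-yes (allSubsets? {6} λ I → ∣ I ∣ ℕ.≟ 3 →-dec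
    (∣ ∁ I ∣ ℕ.≟ 3 ×-dec shape 1ℤ (+ 3) I ≟ αₛ (∁ I) ×-dec shape 1ℤ (+ 3) I ≟ (0ᵛ -ᵛ αₛ I)))

shape-1₂ : ∀ (I : Subset 2) → ∣ I ∣ ≡ 1 → ∃ λ ε → shape (+ 3) (+ 1) I ≡ ε ± α 1
shape-1₂ (true ∷ false ∷ [])  refl = Sign.+ , refl
shape-1₂ (false ∷ true ∷ [])  refl = Sign.- , refl
shape-1₂ (true ∷ true ∷ [])   ()
shape-1₂ (false ∷ false ∷ []) ()

Cell Rep : Set
Cell = Fin 6 × Fin 6 × Fin 6
Rep = Cell ⊎ Vertex Γ ⊎ Vertex Γ ⊎ Vertex Γ

-- One vector of each pair u, ρ - u: cell i j k stands for x i j k and triadᵢ (I , ε) for x⁽ⁱ⁾ I ε +.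
pattern cell i j k = inj₁ (i , j , k)
pattern triad₁ v = inj₂ (inj₁ v)
pattern triad₂ v = inj₂ (inj₂ (inj₁ v))
pattern triad₃ v = inj₂ (inj₂ (inj₂ v))

toBlocks : Rep → Blocks
toBlocks (cell i j k)           = blocks α₅⁽ i ⁾ α₅⁽ j ⁾ α₅⁽ k ⁾ 0ᵛ 0ᵛ 0ᵛ (α 1)
toBlocks (triad₁ ((I , _) , ε)) = blocks (αₛ I) 0ᵛ 0ᵛ 0ᵛ (ε ± α 1) (Sign.+ ± α 1) (α 1)
toBlocks (triad₂ ((I , _) , ε)) = blocks 0ᵛ (αₛ I) 0ᵛ (Sign.+ ± α 1) 0ᵛ (ε ± α 1) (α 1)
toBlocks (triad₃ ((I , _) , ε)) = blocks 0ᵛ 0ᵛ (αₛ I) (ε ± α 1) (Sign.+ ± α 1) 0ᵛ (α 1)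

vec : Rep → E
vec r = ⌊ toBlocks r ⌋

data _IsUpToSwitching_ (u : E) (r : Rep) : Set where
  itself   : u ≡ vec r → u IsUpToSwitching r
  switched : u ≡ ρ -ᵛ vec r → u IsUpToSwitching r

private
  opposite : ∀ ε → ε ± α 1 ≡ 0ᵛ -ᵛ Sign.opposite ε ± α 1
  opposite Sign.+ = refl
  opposite Sign.- = refl

  blocks-cong : ∀ {v₁ w₁ v₂ w₂ v₃ w₃ v₄ w₄ v₅ w₅ v₆ w₆ v₇ w₇} → v₁ ≡ w₁ → v₂ ≡ w₂ → v₃ ≡ w₃ →
    v₄ ≡ w₄ → v₅ ≡ w₅ → v₆ ≡ w₆ → v₇ ≡ w₇ → blocks v₁ v₂ v₃ v₄ v₅ v₆ v₇ ≡ blocks w₁ w₂ w₃ w₄ w₅ w₆ w₇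
  blocks-cong refl refl refl refl refl refl refl = refl

  rootBlocks : Blocks
  rootBlocks = blocks 0ᵛ 0ᵛ 0ᵛ 0ᵛ 0ᵛ 0ᵛ (2ℚ · α 1)

  positive : ∀ {v} r → v ≡ toBlocks r → ∃ λ r → ⌊ v ⌋ IsUpToSwitching r
  positive r refl = r , itself refl

  negative : ∀ {v} r → v ≡ zipBlocks ℚ._-_ rootBlocks (toBlocks r) → ∃ λ r → ⌊ v ⌋ IsUpToSwitching r
  negative r refl = r , switched (sym (zipWith-⌊⌋ ℚ._-_ rootBlocks (toBlocks r)))

  -- The two minimal vectors α 1 and -α 1 have inner products 1 and -1 with 2 α 1.
  minimal-α₁ : ∀ {v} → Minimal (+ 3) 1 v → ⟨ v , 2ℚ · α 1 ⟩ ≡ 1ℚ → v ≡ α 1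
  minimal-α₁ (I , ∣I∣≡1 , refl) root with shape-1₂ I ∣I∣≡1
  ... | Sign.+ , eq = eq
  ... | Sign.- , eq with trans (sym (cong ⟨_, 2ℚ · α 1 ⟩ eq)) root
  ...   | ()

-- For cells the coset decides whether u or ρ - u is the representative: index 5 belongs to the
-- vectors x, index 1 to their switches. For triads the sign in the block where representatives
-- carry `Sign.+` decides. If it is `Sign.-`, passing to ρ - u reverses both signs and replaces the
-- triple by its complement.
short-vector : ∀ {rs} v → Short rs → AllMinimal rs v → ⟨ Blocks.v₇ v , 2ℚ · α 1 ⟩ ≡ 1ℚ →
               ∃ λ r → ⌊ v ⌋ IsUpToSwitching r
short-vector v short₀⁺ ((I , p , refl) , (J , q , refl) , (K , r , refl) , (I₄ , p₄ , refl) , (I₅ , p₅ , refl) , (I₆ , p₆ , refl) , m₇) root =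
  negative (cell (proj₁ (shape-1₆ I p)) (proj₁ (shape-1₆ J q)) (proj₁ (shape-1₆ K r)))
    (blocks-cong (proj₂ (shape-1₆ I p)) (proj₂ (shape-1₆ J q)) (proj₂ (shape-1₆ K r))
                 (shape-0₂ I₄ p₄) (shape-0₂ I₅ p₅) (shape-0₂ I₆ p₆) (minimal-α₁ m₇ root))
short-vector v short₀⁻ ((I , p , refl) , (J , q , refl) , (K , r , refl) , (I₄ , p₄ , refl) , (I₅ , p₅ , refl) , (I₆ , p₆ , refl) , m₇) root =
  positive (cell (proj₁ (shape-5₆ I p)) (proj₁ (shape-5₆ J q)) (proj₁ (shape-5₆ K r)))
    (blocks-cong (proj₂ (shape-5₆ I p)) (proj₂ (shape-5₆ J q)) (proj₂ (shape-5₆ K r))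
                 (shape-0₂ I₄ p₄) (shape-0₂ I₅ p₅) (shape-0₂ I₆ p₆) (minimal-α₁ m₇ root))
short-vector v short₁ ((I , p , refl) , (J , q , refl) , (K , r , refl) , (I₄ , p₄ , refl) , (I₅ , p₅ , refl) , (I₆ , p₆ , refl) , m₇) root
  with shape-1₂ I₅ p₅ | shape-1₂ I₆ p₆
... | ε , eq | Sign.+ , eq′ = positive (triad₁ ((∁ I , proj₁ (shape-3₆ I p)) , ε))
  (blocks-cong (proj₁ (proj₂ (shape-3₆ I p))) (shape-0₆ J q) (shape-0₆ K r) (shape-0₂ I₄ p₄) eq eq′ (minimal-α₁ m₇ root))
... | ε , eq | Sign.- , eq′ = negative (triad₁ ((I , p) , Sign.opposite ε))
  (blocks-cong (proj₂ (proj₂ (shape-3₆ I p))) (shape-0₆ J q) (shape-0₆ K r) (shape-0₂ I₄ p₄) (trans eq (opposite ε)) eq′ (minimal-α₁ m₇ root))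
short-vector v short₂ ((J , q , refl) , (I , p , refl) , (K , r , refl) , (I₄ , p₄ , refl) , (I₅ , p₅ , refl) , (I₆ , p₆ , refl) , m₇) root
  with shape-1₂ I₆ p₆ | shape-1₂ I₄ p₄
... | ε , eq | Sign.+ , eq′ = positive (triad₂ ((∁ I , proj₁ (shape-3₆ I p)) , ε))
  (blocks-cong (shape-0₆ J q) (proj₁ (proj₂ (shape-3₆ I p))) (shape-0₆ K r) eq′ (shape-0₂ I₅ p₅) eq (minimal-α₁ m₇ root))
... | ε , eq | Sign.- , eq′ = negative (triad₂ ((I , p) , Sign.opposite ε))
  (blocks-cong (shape-0₆ J q) (proj₂ (proj₂ (shape-3₆ I p))) (shape-0₆ K r) eq′ (shape-0₂ I₅ p₅) (trans eq (opposite ε)) (minimal-α₁ m₇ root))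
short-vector v short₃ ((J , q , refl) , (K , r , refl) , (I , p , refl) , (I₄ , p₄ , refl) , (I₅ , p₅ , refl) , (I₆ , p₆ , refl) , m₇) root
  with shape-1₂ I₄ p₄ | shape-1₂ I₅ p₅
... | ε , eq | Sign.+ , eq′ = positive (triad₃ ((∁ I , proj₁ (shape-3₆ I p)) , ε))
  (blocks-cong (shape-0₆ J q) (shape-0₆ K r) (proj₁ (proj₂ (shape-3₆ I p))) eq eq′ (shape-0₂ I₆ p₆) (minimal-α₁ m₇ root))
... | ε , eq | Sign.- , eq′ = negative (triad₃ ((I , p) , Sign.opposite ε))
  (blocks-cong (shape-0₆ J q) (shape-0₆ K r) (proj₂ (proj₂ (shape-3₆ I p))) (trans eq (opposite ε)) eq′ (shape-0₂ I₆ p₆) (minimal-α₁ m₇ root))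

abstract
  classification : ∀ {u} → u ∈ L → ⟨ u , ρ ⟩ ≡ 1ℚ → ⟨ u , u ⟩ ≡ 3ℚ → ∃ λ r → u IsUpToSwitching r
  classification u∈L root norm =
    let rs , v , u≡v , s , m = minimal-vector u∈L root norm in resolve v u≡v s m root
    where
    resolve : ∀ {u rs} v → u ≡ ⌊ v ⌋ → Short rs → AllMinimal rs v → ⟨ u , ρ ⟩ ≡ 1ℚ → ∃ λ r → u IsUpToSwitching r
    resolve v refl s m root = short-vector v s m (trans (sym (⟨⟩-ρ v)) root)

-- The Gram matrix of the representatives

⟨⟩-comm : ∀ {n} (v w : Vec ℚ n) → ⟨ v , w ⟩ ≡ ⟨ w , v ⟩
⟨⟩-comm []      []      = refl
⟨⟩-comm (p ∷ v) (q ∷ w) = cong₂ ℚ._+_ (ℚ.*-comm p q) (⟨⟩-comm v w)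

⟨⟩-zeroˡ : ∀ {n} (v : Vec ℚ n) → ⟨ 0ᵛ , v ⟩ ≡ 0ℚ
⟨⟩-zeroˡ v = trans (⟨⟩-comm 0ᵛ v) (⟨⟩-zeroʳ v)

indicator : Bool → ℕ
indicator b = if b then 1 else 0

-- Four minus the distance in the product of J(6,3) and K₂, whose diameter is 4: the distance in
-- J(6,3) is 3 - `∣ I ∩ J ∣`, and differing signs add 1.
proximity : Vertex Γ → Vertex Γ → ℕ
proximity ((I , _) , ε) ((J , _) , δ) = ∣ I ∩ J ∣ ℕ.+ indicator (does (ε Sign.≟ δ))

-- One more than the inner product, which is at least -1.
score : Rep → Rep → ℕ
score (cell i j k) (cell i′ j′ k′) = suc (indicator (does (i Fin.≟ i′)) ℕ.+ (indicator (does (j Fin.≟ j′)) ℕ.+ indicator (does (k Fin.≟ k′))))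
score (cell i j k) (triad₁ ((I , _) , _)) = suc (indicator (Vec.lookup I i))
score (cell i j k) (triad₂ ((I , _) , _)) = suc (indicator (Vec.lookup I j))
score (cell i j k) (triad₃ ((I , _) , _)) = suc (indicator (Vec.lookup I k))
score (triad₁ ((I , _) , _)) (cell i j k) = suc (indicator (Vec.lookup I i))
score (triad₂ ((I , _) , _)) (cell i j k) = suc (indicator (Vec.lookup I j))
score (triad₃ ((I , _) , _)) (cell i j k) = suc (indicator (Vec.lookup I k))
score (triad₁ v) (triad₁ w) = proximity v w
score (triad₂ v) (triad₂ w) = proximity v w
score (triad₃ v) (triad₃ w) = proximity v w
score (triad₁ _) (triad₂ (_ , ε)) = suc (indicator (does (ε Sign.≟ Sign.+)))
score (triad₂ (_ , ε)) (triad₁ _) = suc (indicator (does (ε Sign.≟ Sign.+)))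
score (triad₁ (_ , ε)) (triad₃ _) = suc (indicator (does (ε Sign.≟ Sign.+)))
score (triad₃ _) (triad₁ (_ , ε)) = suc (indicator (does (ε Sign.≟ Sign.+)))
score (triad₂ _) (triad₃ (_ , ε)) = suc (indicator (does (ε Sign.≟ Sign.+)))
score (triad₃ (_ , ε)) (triad₂ _) = suc (indicator (does (ε Sign.≟ Sign.+)))

scoreToℚ : ℕ → ℚ
scoreToℚ n = (n ⊖ 1) / 1

α₅-gram : Bool → ℚ
α₅-gram b = if b then + 5 / 6 else ℤ.- (+ 1) / 6

abstract
  ⟨α₅,α₅⟩ : ∀ i j → ⟨ α₅⁽ i ⁾ , α₅⁽ j ⁾ ⟩ ≡ α₅-gram (does (i Fin.≟ j))
  ⟨α₅,α₅⟩ = from-yes (Fin.all? λ i → Fin.all? λ j → ⟨ α₅⁽ i ⁾ , α₅⁽ j ⁾ ⟩ ℚ.≟ α₅-gram (does (i Fin.≟ j)))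

α₅-αₛ-gram : Bool → ℚ
α₅-αₛ-gram b = if b then ½ else ℚ.- ½

abstract
  ⟨α₅,αₛ⟩ : ∀ I → ∣ I ∣ ≡ 3 → ∀ i → ⟨ α₅⁽ i ⁾ , αₛ I ⟩ ≡ α₅-αₛ-gram (Vec.lookup I i)
  ⟨α₅,αₛ⟩ = from-yes (allSubsets? λ I → ∣ I ∣ ℕ.≟ 3 →-dec Fin.all? λ i → ⟨ α₅⁽ i ⁾ , αₛ I ⟩ ℚ.≟ α₅-αₛ-gram (Vec.lookup I i))

abstract
  ⟨αₛ,αₛ⟩ : ∀ I → ∣ I ∣ ≡ 3 → ∀ J → ∣ J ∣ ≡ 3 → ⟨ αₛ I , αₛ J ⟩ ≡ (2 ℕ.* ∣ I ∩ J ∣ ⊖ 3) / 2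
  ⟨αₛ,αₛ⟩ = from-yes (allSubsets? λ I → ∣ I ∣ ℕ.≟ 3 →-dec allSubsets? λ J → ∣ J ∣ ℕ.≟ 3 →-dec
    ⟨ αₛ I , αₛ J ⟩ ℚ.≟ (2 ℕ.* ∣ I ∩ J ∣ ⊖ 3) / 2)

abstract
  ∩-full : ∀ (I : Subset 6) → ∣ I ∣ ≡ 3 → ∀ (J : Subset 6) → ∣ J ∣ ≡ 3 → ∣ I ∩ J ∣ ≡ 3 → I ≡ J
  ∩-full = from-yes (allSubsets? {6} λ I → ∣ I ∣ ℕ.≟ 3 →-dec allSubsets? λ J → ∣ J ∣ ℕ.≟ 3 →-dec
    ∣ I ∩ J ∣ ℕ.≟ 3 →-dec ≡-dec Bool._≟_ I J)

⟨⟩-by-blocks : ∀ v w {q₁ q₂ q₃ q₄ q₅ q₆ q₇} → let module v = Blocks v; module w = Blocks w in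
  ⟨ v.v₁ , w.v₁ ⟩ ≡ q₁ → ⟨ v.v₂ , w.v₂ ⟩ ≡ q₂ → ⟨ v.v₃ , w.v₃ ⟩ ≡ q₃ → ⟨ v.v₄ , w.v₄ ⟩ ≡ q₄ →
  ⟨ v.v₅ , w.v₅ ⟩ ≡ q₅ → ⟨ v.v₆ , w.v₆ ⟩ ≡ q₆ → ⟨ v.v₇ , w.v₇ ⟩ ≡ q₇ →
  ⟨ ⌊ v ⌋ , ⌊ w ⌋ ⟩ ≡ q₁ ℚ.+ (q₂ ℚ.+ (q₃ ℚ.+ (q₄ ℚ.+ (q₅ ℚ.+ (q₆ ℚ.+ q₇)))))
⟨⟩-by-blocks v w refl refl refl refl refl refl refl = ⟨⟩-⌊⌋ v w

⟨α₁,α₁⟩ : Sign → ℚ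
⟨α₁,α₁⟩ Sign.+ = ½
⟨α₁,α₁⟩ Sign.- = ℚ.- ½

⟨ε±,δ±⟩ : ∀ ε δ → ⟨ ε ± α 1 , δ ± α 1 ⟩ ≡ ⟨α₁,α₁⟩ (ε Sign.* δ)
⟨ε±,δ±⟩ Sign.+ Sign.+ = refl
⟨ε±,δ±⟩ Sign.+ Sign.- = refl
⟨ε±,δ±⟩ Sign.- Sign.+ = refl
⟨ε±,δ±⟩ Sign.- Sign.- = refl

⟨αₛ,α₅⟩ : ∀ I → ∣ I ∣ ≡ 3 → ∀ i → ⟨ αₛ I , α₅⁽ i ⁾ ⟩ ≡ α₅-αₛ-gram (Vec.lookup I i)
⟨αₛ,α₅⟩ I p i = trans (⟨⟩-comm (αₛ I) α₅⁽ i ⁾) (⟨α₅,αₛ⟩ I p i)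

cell-sum : ∀ a b c → α₅-gram a ℚ.+ (α₅-gram b ℚ.+ (α₅-gram c ℚ.+ (0ℚ ℚ.+ (0ℚ ℚ.+ (0ℚ ℚ.+ ½)))))
                   ≡ scoreToℚ (suc (indicator a ℕ.+ (indicator b ℕ.+ indicator c)))
cell-sum true  true  true  = refl
cell-sum true  true  false = refl
cell-sum true  false true  = refl
cell-sum true  false false = refl
cell-sum false true  true  = refl
cell-sum false true  false = refl
cell-sum false false true  = refl
cell-sum false false false = refl

triad-sum : ∀ m → m ℕ.≤ 3 → ∀ ε δ → (2 ℕ.* m ⊖ 3) / 2 ℚ.+ (⟨α₁,α₁⟩ (ε Sign.* δ) ℚ.+ (½ ℚ.+ ½))
                                    ≡ scoreToℚ (m ℕ.+ indicator (does (ε Sign.≟ δ)))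
triad-sum 0 _ Sign.+ Sign.+ = refl
triad-sum 0 _ Sign.+ Sign.- = refl
triad-sum 0 _ Sign.- Sign.+ = refl
triad-sum 0 _ Sign.- Sign.- = refl
triad-sum 1 _ Sign.+ Sign.+ = refl
triad-sum 1 _ Sign.+ Sign.- = refl
triad-sum 1 _ Sign.- Sign.+ = refl
triad-sum 1 _ Sign.- Sign.- = refl
triad-sum 2 _ Sign.+ Sign.+ = refl
triad-sum 2 _ Sign.+ Sign.- = refl
triad-sum 2 _ Sign.- Sign.+ = refl
triad-sum 2 _ Sign.- Sign.- = refl
triad-sum 3 _ Sign.+ Sign.+ = refl
triad-sum 3 _ Sign.+ Sign.- = refl
triad-sum 3 _ Sign.- Sign.+ = refl
triad-sum 3 _ Sign.- Sign.- = refl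
triad-sum (suc (suc (suc (suc m)))) (ℕ.s≤s (ℕ.s≤s (ℕ.s≤s ())))

triad-gram : ∀ (I : Subset 6) → ∣ I ∣ ≡ 3 → ∀ J ε δ → (2 ℕ.* ∣ I ∩ J ∣ ⊖ 3) / 2 ℚ.+ (⟨α₁,α₁⟩ (ε Sign.* δ) ℚ.+ (½ ℚ.+ ½))
                                    ≡ scoreToℚ (∣ I ∩ J ∣ ℕ.+ indicator (does (ε Sign.≟ δ)))
triad-gram I p J ε δ = triad-sum ∣ I ∩ J ∣ (subst (∣ I ∩ J ∣ ℕ.≤_) p (∣p∩q∣≤∣p∣ I J)) ε δ

triad₁-sum : ∀ q σ → q ℚ.+ (0ℚ ℚ.+ (0ℚ ℚ.+ (0ℚ ℚ.+ (⟨α₁,α₁⟩ σ ℚ.+ (½ ℚ.+ ½))))) ≡ q ℚ.+ (⟨α₁,α₁⟩ σ ℚ.+ (½ ℚ.+ ½))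
triad₁-sum q σ = cong (q ℚ.+_) (tail σ)
  where
  tail : ∀ σ → 0ℚ ℚ.+ (0ℚ ℚ.+ (0ℚ ℚ.+ (⟨α₁,α₁⟩ σ ℚ.+ (½ ℚ.+ ½)))) ≡ ⟨α₁,α₁⟩ σ ℚ.+ (½ ℚ.+ ½)
  tail Sign.+ = refl
  tail Sign.- = refl

triad₂-sum : ∀ q σ → 0ℚ ℚ.+ (q ℚ.+ (0ℚ ℚ.+ (½ ℚ.+ (0ℚ ℚ.+ (⟨α₁,α₁⟩ σ ℚ.+ ½))))) ≡ q ℚ.+ (⟨α₁,α₁⟩ σ ℚ.+ (½ ℚ.+ ½))
triad₂-sum q σ = trans (ℚ.+-identityˡ _) (cong (q ℚ.+_) (tail σ))
  where
  tail : ∀ σ → 0ℚ ℚ.+ (½ ℚ.+ (0ℚ ℚ.+ (⟨α₁,α₁⟩ σ ℚ.+ ½))) ≡ ⟨α₁,α₁⟩ σ ℚ.+ (½ ℚ.+ ½)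
  tail Sign.+ = refl
  tail Sign.- = refl

triad₃-sum : ∀ q σ → 0ℚ ℚ.+ (0ℚ ℚ.+ (q ℚ.+ (⟨α₁,α₁⟩ σ ℚ.+ (½ ℚ.+ (0ℚ ℚ.+ ½))))) ≡ q ℚ.+ (⟨α₁,α₁⟩ σ ℚ.+ (½ ℚ.+ ½))
triad₃-sum q σ = trans (ℚ.+-identityˡ _) (trans (ℚ.+-identityˡ _) (cong (q ℚ.+_) (tail σ)))
  where
  tail : ∀ σ → ⟨α₁,α₁⟩ σ ℚ.+ (½ ℚ.+ (0ℚ ℚ.+ ½)) ≡ ⟨α₁,α₁⟩ σ ℚ.+ (½ ℚ.+ ½)
  tail Sign.+ = refl
  tail Sign.- = refl

cell-triad₁-sum : ∀ b → α₅-αₛ-gram b ℚ.+ ½ ≡ scoreToℚ (suc (indicator b))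
cell-triad₁-sum true  = refl
cell-triad₁-sum false = refl

cell-triad₂-sum : ∀ b → 0ℚ ℚ.+ (α₅-αₛ-gram b ℚ.+ ½) ≡ scoreToℚ (suc (indicator b))
cell-triad₂-sum true  = refl
cell-triad₂-sum false = refl

cell-triad₃-sum : ∀ b → 0ℚ ℚ.+ (0ℚ ℚ.+ (α₅-αₛ-gram b ℚ.+ ½)) ≡ scoreToℚ (suc (indicator b))
cell-triad₃-sum true  = refl
cell-triad₃-sum false = refl

triads₁₂-sum : ∀ ε → 0ℚ ℚ.+ (0ℚ ℚ.+ (0ℚ ℚ.+ (0ℚ ℚ.+ (0ℚ ℚ.+ (⟨α₁,α₁⟩ ε ℚ.+ ½))))) ≡ scoreToℚ (suc (indicator (does (ε Sign.≟ Sign.+))))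
triads₁₂-sum Sign.+ = refl
triads₁₂-sum Sign.- = refl

triads₁₃-sum : ∀ ε → 0ℚ ℚ.+ (0ℚ ℚ.+ (0ℚ ℚ.+ (0ℚ ℚ.+ (⟨α₁,α₁⟩ ε ℚ.+ (0ℚ ℚ.+ ½))))) ≡ scoreToℚ (suc (indicator (does (ε Sign.≟ Sign.+))))
triads₁₃-sum Sign.+ = refl
triads₁₃-sum Sign.- = refl

triads₂₃-sum : ∀ ε → 0ℚ ℚ.+ (0ℚ ℚ.+ (0ℚ ℚ.+ (⟨α₁,α₁⟩ ε ℚ.+ (0ℚ ℚ.+ (0ℚ ℚ.+ ½))))) ≡ scoreToℚ (suc (indicator (does (ε Sign.≟ Sign.+))))
triads₂₃-sum Sign.+ = refl
triads₂₃-sum Sign.- = refl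

⟨+±,ε±⟩ : ∀ ε → ⟨ Sign.+ ± α 1 , ε ± α 1 ⟩ ≡ ⟨α₁,α₁⟩ ε
⟨+±,ε±⟩ = ⟨ε±,δ±⟩ Sign.+

⟨ε±,+±⟩ : ∀ ε → ⟨ ε ± α 1 , Sign.+ ± α 1 ⟩ ≡ ⟨α₁,α₁⟩ ε
⟨ε±,+±⟩ Sign.+ = refl
⟨ε±,+±⟩ Sign.- = refl

gram : ∀ r s → ⟨ vec r , vec s ⟩ ≡ scoreToℚ (score r s)
gram r@(cell i j k) s@(cell i′ j′ k′) =
  trans (⟨⟩-by-blocks (toBlocks r) (toBlocks s) (⟨α₅,α₅⟩ i i′) (⟨α₅,α₅⟩ j j′) (⟨α₅,α₅⟩ k k′) refl refl refl refl)
        (cell-sum (does (i Fin.≟ i′)) (does (j Fin.≟ j′)) (does (k Fin.≟ k′)))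
gram r@(cell i j k) s@(triad₁ ((I , p) , ε)) =
  trans (⟨⟩-by-blocks (toBlocks r) (toBlocks s) (⟨α₅,αₛ⟩ I p i) (⟨⟩-zeroʳ α₅⁽ j ⁾) (⟨⟩-zeroʳ α₅⁽ k ⁾) refl (⟨⟩-zeroˡ (ε ± α 1)) refl refl)
        (cell-triad₁-sum (Vec.lookup I i))
gram r@(triad₁ ((I , p) , ε)) s@(cell i j k) =
  trans (⟨⟩-by-blocks (toBlocks r) (toBlocks s) (⟨αₛ,α₅⟩ I p i) (⟨⟩-zeroˡ α₅⁽ j ⁾) (⟨⟩-zeroˡ α₅⁽ k ⁾) refl (⟨⟩-zeroʳ (ε ± α 1)) refl refl)
        (cell-triad₁-sum (Vec.lookup I i))
gram r@(cell i j k) s@(triad₂ ((I , p) , ε)) =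
  trans (⟨⟩-by-blocks (toBlocks r) (toBlocks s) (⟨⟩-zeroʳ α₅⁽ i ⁾) (⟨α₅,αₛ⟩ I p j) (⟨⟩-zeroʳ α₅⁽ k ⁾) refl refl (⟨⟩-zeroˡ (ε ± α 1)) refl)
        (cell-triad₂-sum (Vec.lookup I j))
gram r@(triad₂ ((I , p) , ε)) s@(cell i j k) =
  trans (⟨⟩-by-blocks (toBlocks r) (toBlocks s) (⟨⟩-zeroˡ α₅⁽ i ⁾) (⟨αₛ,α₅⟩ I p j) (⟨⟩-zeroˡ α₅⁽ k ⁾) refl refl (⟨⟩-zeroʳ (ε ± α 1)) refl)
        (cell-triad₂-sum (Vec.lookup I j))
gram r@(cell i j k) s@(triad₃ ((I , p) , ε)) =
  trans (⟨⟩-by-blocks (toBlocks r) (toBlocks s) (⟨⟩-zeroʳ α₅⁽ i ⁾) (⟨⟩-zeroʳ α₅⁽ j ⁾) (⟨α₅,αₛ⟩ I p k) (⟨⟩-zeroˡ (ε ± α 1)) refl refl refl)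
        (cell-triad₃-sum (Vec.lookup I k))
gram r@(triad₃ ((I , p) , ε)) s@(cell i j k) =
  trans (⟨⟩-by-blocks (toBlocks r) (toBlocks s) (⟨⟩-zeroˡ α₅⁽ i ⁾) (⟨⟩-zeroˡ α₅⁽ j ⁾) (⟨αₛ,α₅⟩ I p k) (⟨⟩-zeroʳ (ε ± α 1)) refl refl refl)
        (cell-triad₃-sum (Vec.lookup I k))
gram r@(triad₁ ((I , p) , ε)) s@(triad₁ ((J , q) , δ)) =
  trans (⟨⟩-by-blocks (toBlocks r) (toBlocks s) (⟨αₛ,αₛ⟩ I p J q) refl refl refl (⟨ε±,δ±⟩ ε δ) refl refl)
        (trans (triad₁-sum ((2 ℕ.* ∣ I ∩ J ∣ ⊖ 3) / 2) (ε Sign.* δ)) (triad-gram I p J ε δ))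
gram r@(triad₂ ((I , p) , ε)) s@(triad₂ ((J , q) , δ)) =
  trans (⟨⟩-by-blocks (toBlocks r) (toBlocks s) refl (⟨αₛ,αₛ⟩ I p J q) refl refl refl (⟨ε±,δ±⟩ ε δ) refl)
        (trans (triad₂-sum ((2 ℕ.* ∣ I ∩ J ∣ ⊖ 3) / 2) (ε Sign.* δ)) (triad-gram I p J ε δ))
gram r@(triad₃ ((I , p) , ε)) s@(triad₃ ((J , q) , δ)) =
  trans (⟨⟩-by-blocks (toBlocks r) (toBlocks s) refl refl (⟨αₛ,αₛ⟩ I p J q) (⟨ε±,δ±⟩ ε δ) refl refl refl)
        (trans (triad₃-sum ((2 ℕ.* ∣ I ∩ J ∣ ⊖ 3) / 2) (ε Sign.* δ)) (triad-gram I p J ε δ))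
gram r@(triad₁ ((I , _) , ε)) s@(triad₂ ((J , _) , δ)) =
  trans (⟨⟩-by-blocks (toBlocks r) (toBlocks s) (⟨⟩-zeroʳ (αₛ I)) (⟨⟩-zeroˡ (αₛ J)) refl refl (⟨⟩-zeroʳ (ε ± α 1)) (⟨+±,ε±⟩ δ) refl)
        (triads₁₂-sum δ)
gram r@(triad₁ ((I , _) , ε)) s@(triad₃ ((J , _) , δ)) =
  trans (⟨⟩-by-blocks (toBlocks r) (toBlocks s) (⟨⟩-zeroʳ (αₛ I)) refl (⟨⟩-zeroˡ (αₛ J)) (⟨⟩-zeroˡ (δ ± α 1)) (⟨ε±,+±⟩ ε) refl refl)
        (triads₁₃-sum ε)
gram r@(triad₂ ((I , _) , ε)) s@(triad₁ ((J , _) , δ)) =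
  trans (⟨⟩-by-blocks (toBlocks r) (toBlocks s) (⟨⟩-zeroˡ (αₛ J)) (⟨⟩-zeroʳ (αₛ I)) refl refl (⟨⟩-zeroˡ (δ ± α 1)) (⟨ε±,+±⟩ ε) refl)
        (triads₁₂-sum ε)
gram r@(triad₂ ((I , _) , ε)) s@(triad₃ ((J , _) , δ)) =
  trans (⟨⟩-by-blocks (toBlocks r) (toBlocks s) refl (⟨⟩-zeroʳ (αₛ I)) (⟨⟩-zeroˡ (αₛ J)) (⟨+±,ε±⟩ δ) refl (⟨⟩-zeroʳ (ε ± α 1)) refl)
        (triads₂₃-sum δ)
gram r@(triad₃ ((I , _) , ε)) s@(triad₁ ((J , _) , δ)) =
  trans (⟨⟩-by-blocks (toBlocks r) (toBlocks s) (⟨⟩-zeroˡ (αₛ J)) refl (⟨⟩-zeroʳ (αₛ I)) (⟨⟩-zeroʳ (ε ± α 1)) (⟨+±,ε±⟩ δ) refl refl)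
        (triads₁₃-sum δ)
gram r@(triad₃ ((I , _) , ε)) s@(triad₂ ((J , _) , δ)) =
  trans (⟨⟩-by-blocks (toBlocks r) (toBlocks s) refl (⟨⟩-zeroˡ (αₛ J)) (⟨⟩-zeroʳ (αₛ I)) (⟨ε±,+±⟩ ε) refl (⟨⟩-zeroˡ (δ ± α 1)) refl)
        (triads₂₃-sum ε)

∩≤3 : ∀ (I J : ThreeSubset) → ∣ proj₁ I ∩ proj₁ J ∣ ℕ.≤ 3
∩≤3 (I , p) (J , _) = subst (∣ I ∩ J ∣ ℕ.≤_) p (∣p∩q∣≤∣p∣ I J)

proximity-self : ∀ v → proximity v v ≡ 4
proximity-self ((I , p) , ε) =
  cong₂ ℕ._+_ (trans (cong ∣_∣ (∩-idem I)) p) (cong indicator (dec-true (ε Sign.≟ ε) refl))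

proximity-4 : ∀ v w → proximity v w ≡ 4 → v ≡ w
proximity-4 ((I , p) , ε) ((J , q) , δ) eq with ε Sign.≟ δ
... | no _ = contradiction (subst (ℕ._≤ 3) (trans (sym (ℕ.+-identityʳ _)) eq) (∩≤3 (I , p) (J , q))) λ { (ℕ.s≤s (ℕ.s≤s (ℕ.s≤s ()))) }
... | yes refl with ∩-full I p J q (ℕ.+-cancelʳ-≡ 1 _ 3 eq)
...   | refl = cong (λ p → (I , p) , ε) (ℕ.≡-irrelevant p q)

score-self : ∀ r → score r r ≡ 4
score-self (cell i j k)
  rewrite dec-true (i Fin.≟ i) refl | dec-true (j Fin.≟ j) refl | dec-true (k Fin.≟ k) refl = refl
score-self (triad₁ v) = proximity-self v
score-self (triad₂ v) = proximity-self v
score-self (triad₃ v) = proximity-self v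

suc-indicator≢4 : ∀ b → suc (indicator b) ≢ 4
suc-indicator≢4 true  ()
suc-indicator≢4 false ()

-- The equality case of the Cauchy-Schwarz inequality in combinatorial form: score 4 means inner
-- product 3, the common norm. It makes `vec` injective.
score-4 : ∀ r s → score r s ≡ 4 → r ≡ s
score-4 (cell i j k) (cell i′ j′ k′) eq with i Fin.≟ i′ | j Fin.≟ j′ | k Fin.≟ k′
... | yes refl | yes refl | yes refl = refl
... | yes _    | yes _    | no _ with () ← eq
... | yes _    | no _     | yes _ with () ← eq
... | yes _    | no _     | no _ with () ← eq
... | no _     | yes _    | yes _ with () ← eq
... | no _     | yes _    | no _ with () ← eq
... | no _     | no _     | yes _ with () ← eq
... | no _     | no _     | no _ with () ← eq
score-4 (triad₁ v) (triad₁ w) eq = cong triad₁ (proximity-4 v w eq)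
score-4 (triad₂ v) (triad₂ w) eq = cong triad₂ (proximity-4 v w eq)
score-4 (triad₃ v) (triad₃ w) eq = cong triad₃ (proximity-4 v w eq)
score-4 (cell _ _ _) (triad₁ _) eq = ⊥-elim (suc-indicator≢4 _ eq)
score-4 (cell _ _ _) (triad₂ _) eq = ⊥-elim (suc-indicator≢4 _ eq)
score-4 (cell _ _ _) (triad₃ _) eq = ⊥-elim (suc-indicator≢4 _ eq)
score-4 (triad₁ _) (cell _ _ _) eq = ⊥-elim (suc-indicator≢4 _ eq)
score-4 (triad₂ _) (cell _ _ _) eq = ⊥-elim (suc-indicator≢4 _ eq)
score-4 (triad₃ _) (cell _ _ _) eq = ⊥-elim (suc-indicator≢4 _ eq)
score-4 (triad₁ _) (triad₂ _) eq = ⊥-elim (suc-indicator≢4 _ eq)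
score-4 (triad₁ _) (triad₃ _) eq = ⊥-elim (suc-indicator≢4 _ eq)
score-4 (triad₂ _) (triad₁ _) eq = ⊥-elim (suc-indicator≢4 _ eq)
score-4 (triad₂ _) (triad₃ _) eq = ⊥-elim (suc-indicator≢4 _ eq)
score-4 (triad₃ _) (triad₁ _) eq = ⊥-elim (suc-indicator≢4 _ eq)
score-4 (triad₃ _) (triad₂ _) eq = ⊥-elim (suc-indicator≢4 _ eq)

vec-norm : ∀ r → ⟨ vec r , vec r ⟩ ≡ 3ℚ
vec-norm r = trans (gram r r) (cong scoreToℚ (score-self r))

vec-root : ∀ r → ⟨ vec r , ρ ⟩ ≡ 1ℚ
vec-root r = trans (⟨⟩-ρ (toBlocks r)) (last-block r)
  where
  last-block : ∀ r → ⟨ Blocks.v₇ (toBlocks r) , 2ℚ · α 1 ⟩ ≡ 1ℚ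
  last-block (cell _ _ _) = refl
  last-block (triad₁ _)   = refl
  last-block (triad₂ _)   = refl
  last-block (triad₃ _)   = refl

scoreToℚ-injective : ∀ {m n} → scoreToℚ m ≡ scoreToℚ n → m ≡ n
scoreToℚ-injective {m} {n} eq = ⊖1-injective m n (/-injective {m ⊖ 1} {n ⊖ 1} 0 eq)
  where
  ⊖1-injective : ∀ m n → m ⊖ 1 ≡ n ⊖ 1 → m ≡ n
  ⊖1-injective zero    zero    _  = refl
  ⊖1-injective (suc m) (suc n) eq = cong suc (ℤ.+-injective eq)
  ⊖1-injective zero    (suc n) ()
  ⊖1-injective (suc m) zero    ()

scoreToℚ≢-2 : ∀ n → scoreToℚ n ≢ ℚ.- 2ℚ
scoreToℚ≢-2 n eq = ⊖1≢-2 n (/-injective {n ⊖ 1} { -[1+ 1 ]} 0 eq)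
  where
  ⊖1≢-2 : ∀ n → n ⊖ 1 ≢ -[1+ 1 ]
  ⊖1≢-2 zero    ()
  ⊖1≢-2 (suc n) ()

vec-injective : ∀ {r s} → vec r ≡ vec s → r ≡ s
vec-injective {r} {s} eq = score-4 r s (scoreToℚ-injective
  (trans (sym (gram r s)) (trans (cong ⟨ vec r ,_⟩ (sym eq)) (vec-norm r))))

-- Switching and compatibility

sub-sub : ∀ p q → p ℚ.- (p ℚ.- q) ≡ q
sub-sub p q = begin
  p ℚ.- (p ℚ.- q)             ≡⟨ cong (λ r → p ℚ.+ r) (ℚ.neg-distrib-+ p (ℚ.- q)) ⟩
  p ℚ.+ (ℚ.- p ℚ.- ℚ.- q)     ≡⟨ cong (λ r → p ℚ.+ (ℚ.- p ℚ.+ r)) (ℚ-.⁻¹-involutive q) ⟩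
  p ℚ.+ (ℚ.- p ℚ.+ q)         ≡⟨ ℚ.+-assoc p (ℚ.- p) q ⟨
  p ℚ.- p ℚ.+ q               ≡⟨ cong (ℚ._+ q) (ℚ.+-inverseʳ p) ⟩
  0ℚ ℚ.+ q                    ≡⟨ ℚ.+-identityˡ q ⟩
  q                           ∎
  where open ≡-Reasoning

⟨⟩-subˡ : ∀ {n} (u v w : Vec ℚ n) → ⟨ u -ᵛ v , w ⟩ ≡ ⟨ u , w ⟩ ℚ.- ⟨ v , w ⟩
⟨⟩-subˡ []      []      []      = refl
⟨⟩-subˡ (p ∷ u) (q ∷ v) (r ∷ w) =
  trans (cong ((p ℚ.- q) ℚ.* r ℚ.+_) (⟨⟩-subˡ u v w)) (rearrange p q r ⟨ u , w ⟩ ⟨ v , w ⟩)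
  where
  open ≡-Reasoning
  rearrange : ∀ p q r s t → (p ℚ.- q) ℚ.* r ℚ.+ (s ℚ.- t) ≡ (p ℚ.* r ℚ.+ s) ℚ.- (q ℚ.* r ℚ.+ t)
  rearrange p q r s t = begin
    (p ℚ.- q) ℚ.* r ℚ.+ (s ℚ.- t)                   ≡⟨ cong (ℚ._+ (s ℚ.- t)) (ℚ.*-distribʳ-+ r p (ℚ.- q)) ⟩
    p ℚ.* r ℚ.+ (ℚ.- q) ℚ.* r ℚ.+ (s ℚ.- t)         ≡⟨ ℚ+.interchange (p ℚ.* r) _ s (ℚ.- t) ⟩
    p ℚ.* r ℚ.+ s ℚ.+ ((ℚ.- q) ℚ.* r ℚ.- t)         ≡⟨ cong (λ k → p ℚ.* r ℚ.+ s ℚ.+ (k ℚ.- t)) (ℚ.neg-distribˡ-* q r) ⟨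
    p ℚ.* r ℚ.+ s ℚ.+ (ℚ.- (q ℚ.* r) ℚ.- t)         ≡⟨ cong (λ k → p ℚ.* r ℚ.+ s ℚ.+ k) (ℚ.neg-distrib-+ (q ℚ.* r) t) ⟨
    p ℚ.* r ℚ.+ s ℚ.- (q ℚ.* r ℚ.+ t)               ∎

sub-involutive : ∀ {n} (u v : Vec ℚ n) → u -ᵛ (u -ᵛ v) ≡ v
sub-involutive []      []      = refl
sub-involutive (p ∷ u) (q ∷ v) = cong₂ _∷_ (sub-sub p q) (sub-involutive u v)

⟨⟩-switch : ∀ u v → ⟨ v , ρ ⟩ ≡ 1ℚ → ⟨ ρ -ᵛ u , v ⟩ ≡ 1ℚ ℚ.- ⟨ u , v ⟩
⟨⟩-switch u v root = trans (⟨⟩-subˡ ρ u v) (cong (ℚ._- ⟨ u , v ⟩) (trans (⟨⟩-comm ρ v) root))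

⟨⟩-switch-self : ∀ r → ⟨ ρ -ᵛ vec r , vec r ⟩ ≡ ℚ.- 2ℚ
⟨⟩-switch-self r = trans (⟨⟩-switch (vec r) (vec r) (vec-root r)) (cong (λ q → 1ℚ ℚ.- q) (vec-norm r))

-- Otherwise the inner product of `vec r` and `vec s` would be 1 - 3 = -2, while a score is a
-- natural number and so the inner product is at least -1.
vec≢switch : ∀ r s → vec r ≢ ρ -ᵛ vec s
vec≢switch r s eq = scoreToℚ≢-2 (score r s)
  (trans (sym (gram r s)) (trans (cong ⟨_, vec s ⟩ eq) (⟨⟩-switch-self s)))

-- This makes the map from vectors to representatives well defined and later forces the parameters
-- of a normal form.
upToSwitching-unique : ∀ {u r s} → u IsUpToSwitching r → u IsUpToSwitching s → r ≡ s
upToSwitching-unique {u} {r} {s} (itself u≡r)   (itself u≡s)   = vec-injective {r} {s} (trans (sym u≡r) u≡s)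
upToSwitching-unique {u} {r} {s} (itself u≡r)   (switched u≡s) = ⊥-elim (vec≢switch r s (trans (sym u≡r) u≡s))
upToSwitching-unique {u} {r} {s} (switched u≡r) (itself u≡s)   = ⊥-elim (vec≢switch s r (trans (sym u≡s) u≡r))
upToSwitching-unique {u} {r} {s} (switched u≡r) (switched u≡s) = vec-injective {r} {s}
  (trans (sym (sub-involutive ρ (vec r))) (trans (cong (λ u → ρ -ᵛ u) (trans (sym u≡r) u≡s)) (sub-involutive ρ (vec s))))

Compatible : Rep → Rep → Set
Compatible r s = score r s ≡ 1 ⊎ score r s ≡ 2

compatible-irreflexive : ∀ {r s} → Compatible r s → r ≢ s
compatible-irreflexive {r} (inj₁ eq) refl with () ← trans (sym eq) (score-self r)
compatible-irreflexive {r} (inj₂ eq) refl with () ← trans (sym eq) (score-self r)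

ZeroOrOne : ℚ → Set
ZeroOrOne q = q ≡ 0ℚ ⊎ q ≡ 1ℚ

compatible⇒zeroOrOne : ∀ r s → Compatible r s → ZeroOrOne ⟨ vec r , vec s ⟩
compatible⇒zeroOrOne r s (inj₁ eq) = inj₁ (trans (gram r s) (cong scoreToℚ eq))
compatible⇒zeroOrOne r s (inj₂ eq) = inj₂ (trans (gram r s) (cong scoreToℚ eq))

zeroOrOne⇒compatible : ∀ r s → ZeroOrOne ⟨ vec r , vec s ⟩ → Compatible r s
zeroOrOne⇒compatible r s (inj₁ eq) = inj₁ (scoreToℚ-injective (trans (sym (gram r s)) eq))
zeroOrOne⇒compatible r s (inj₂ eq) = inj₂ (scoreToℚ-injective (trans (sym (gram r s)) eq))

unswitch : ∀ {u v r} → u IsUpToSwitching r → ⟨ v , ρ ⟩ ≡ 1ℚ → ZeroOrOne ⟨ u , v ⟩ → ZeroOrOne ⟨ vec r , v ⟩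
unswitch {v = v} (itself u≡r) _ p = subst (λ u → ZeroOrOne ⟨ u , v ⟩) u≡r p
unswitch {v = v} {r} (switched u≡r) root p =
  flip (subst ZeroOrOne (⟨⟩-switch (vec r) v root) (subst (λ u → ZeroOrOne ⟨ u , v ⟩) u≡r p))
  where
  flip : ∀ {q} → ZeroOrOne (1ℚ ℚ.- q) → ZeroOrOne q
  flip {q} (inj₁ eq) = inj₂ (trans (sym (sub-sub 1ℚ q)) (cong (λ q → 1ℚ ℚ.- q) eq))
  flip {q} (inj₂ eq) = inj₁ (trans (sym (sub-sub 1ℚ q)) (cong (λ q → 1ℚ ℚ.- q) eq))

compatible : ∀ {u v r s} → u IsUpToSwitching r → v IsUpToSwitching s → ⟨ v , ρ ⟩ ≡ 1ℚ →
             ZeroOrOne ⟨ u , v ⟩ → Compatible r s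
compatible {v = v} {r} {s} u~r v~s root p = zeroOrOne⇒compatible r s
  (subst ZeroOrOne (⟨⟩-comm (vec s) (vec r))
    (unswitch v~s (vec-root r) (subst ZeroOrOne (⟨⟩-comm (vec r) v) (unswitch u~r root p))))

-- Exhaustive clique search

module CliqueSearch {X : Set} (R : X → X → Set) (R? : Decidable₂ R) (R-sym : Symmetric R) (R-irr : Irreflexive _≡_ R) where

  -- The value `true` certifies that the list contains no k pairwise related elements. A clique
  -- either uses the head, and then its other members are among the later neighbours of the head, or
  -- it avoids the head. Size 0 yields `false` because the empty clique always exists.
  noClique : ℕ → List X → Bool
  noClique zero    _        = false
  noClique (suc k) []       = true
  noClique (suc k) (v ∷ vs) = noClique k (filter (R? v) vs) ∧ noClique (suc k) vs

  -- The last component says that l consists of v and of the elements of l′.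
  Removal : X → List X → List X → Set₁
  Removal v vs l = Σ (List X) λ l′ →
    length l ≡ suc (length l′) × All (_∈ˡ filter (R? v) vs) l′ × AllPairs R l′ ×
    (∀ {P : X → Set} → All P l → P v × All P l′)

  -- Splits on whether v belongs to the clique l. By irreflexivity v occurs at most once, so after
  -- its removal everything left lies in vs and is a neighbour of v.
  remove : ∀ {v vs} l → AllPairs R l → All (_∈ˡ v ∷ vs) l → Removal v vs l ⊎ All (_∈ˡ vs) l
  remove [] _ _ = inj₂ []
  remove {v} {vs} (x ∷ l) (Rxl ∷ Rl) (here refl ∷ l⊆) = inj₁ (l , refl , neighbours l Rxl l⊆ , Rl , λ { (p ∷ ps) → p , ps })
    where
    neighbours : ∀ l → All (R v) l → All (_∈ˡ v ∷ vs) l → All (_∈ˡ filter (R? v) vs) l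
    neighbours [] _ _ = []
    neighbours (y ∷ l) (Rvy ∷ _)  (here refl ∷ _)    = ⊥-elim (R-irr refl Rvy)
    neighbours (y ∷ l) (Rvy ∷ Rvl) (there y∈vs ∷ l⊆) = ∈-filter⁺ (R? v) y∈vs Rvy ∷ neighbours l Rvl l⊆
  remove {v} (x ∷ l) (Rxl ∷ Rl) (there x∈vs ∷ l⊆) with remove l Rl l⊆
  ... | inj₂ l⊆vs = inj₂ (x∈vs ∷ l⊆vs)
  ... | inj₁ (l′ , eq , l′⊆ , Rl′ , restrict) =
    -- `Rxl` relates x to all of l, hence to v and to all of l′; the former is turned round by
    -- symmetry.
    inj₁ (x ∷ l′ , cong suc eq , ∈-filter⁺ (R? v) x∈vs (R-sym (proj₁ (restrict Rxl))) ∷ l′⊆ ,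
          proj₂ (restrict Rxl) ∷ Rl′ ,
          λ { (p ∷ ps) → proj₁ (restrict ps) , p ∷ proj₂ (restrict ps) })

  noClique-sound : ∀ k vs → T (noClique k vs) → ∀ l → AllPairs R l → All (_∈ˡ vs) l → length l ℕ.< k
  noClique-sound (suc k) []       t []      _  _ = ℕ.s≤s ℕ.z≤n
  noClique-sound (suc k) []       t (x ∷ l) _  (() ∷ _)
  noClique-sound (suc k) (v ∷ vs) t l Rl l⊆ =
    [ (λ (l′ , eq , l′⊆ , Rl′ , _) → subst (ℕ._< suc k) (sym eq)
        (ℕ.s≤s (noClique-sound k (filter (R? v) vs) (proj₁ (Equivalence.to Bool.T-∧ t)) l′ Rl′ l′⊆)))
    , (λ l⊆vs → noClique-sound (suc k) vs (proj₂ (Equivalence.to Bool.T-∧ t)) l Rl l⊆vs)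
    ]′ (remove l Rl l⊆)

  -- The strict upper triangle of an adjacency matrix: the row of a vertex covers only the vertices
  -- after it, which is all that the search consults.
  data Triangle : ℕ → Set where
    []  : Triangle 0
    _∷_ : ∀ {n} → Vec Bool n → Triangle n → Triangle (suc n)

  adjacencies : ∀ {n} → Vec X n → Triangle n
  adjacencies []       = []
  adjacencies (v ∷ vs) = map (λ w → does (R? v w)) vs ∷ adjacencies vs

  -- A search equivalent to noClique which decides every adjacency only once.
  search : ∀ {n} → ℕ → Vec Bool n → Triangle n → Bool
  search zero    _           _        = false
  search (suc k) []          []       = true
  search (suc k) (false ∷ m) (_ ∷ rs) = search (suc k) m rs
  search (suc k) (true  ∷ m) (r ∷ rs) = search k (zipWith _∧_ r m) rs ∧ search (suc k) m rs

  select : ∀ {n} → Vec Bool n → Vec X n → List X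
  select []          []       = []
  select (false ∷ m) (_ ∷ vs) = select m vs
  select (true  ∷ m) (v ∷ vs) = v ∷ select m vs

  -- Intersecting a mask with a row of the triangle is filtering by adjacency; this is the link
  -- between the masks of `search` and the lists of `noClique`.
  select-filter : ∀ {n} v m (vs : Vec X n) →
    select (zipWith _∧_ (map (λ w → does (R? v w)) vs) m) vs ≡ filter (R? v) (select m vs)
  select-filter v []          []       = refl
  select-filter v (false ∷ m) (w ∷ vs) with does (R? v w)
  ... | true  = select-filter v m vs
  ... | false = select-filter v m vs
  select-filter v (true ∷ m)  (w ∷ vs) with does (R? v w)
  ... | true  = cong (w ∷_) (select-filter v m vs)
  ... | false = select-filter v m vs

  search-noClique : ∀ {n} k m (vs : Vec X n) → search k m (adjacencies vs) ≡ noClique k (select m vs)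
  search-noClique zero    m           vs       = refl
  search-noClique (suc k) []          []       = refl
  search-noClique (suc k) (false ∷ m) (v ∷ vs) = search-noClique (suc k) m vs
  search-noClique (suc k) (true ∷ m)  (v ∷ vs) = cong₂ _∧_
    (trans (search-noClique k _ vs) (cong (noClique k) (select-filter v m vs))) (search-noClique (suc k) m vs)

  select-all : ∀ vs → select (replicate (length vs) true) (fromList vs) ≡ vs
  select-all []       = refl
  select-all (v ∷ vs) = cong (v ∷_) (select-all vs)

  search-sound : ∀ k vs → search k (replicate (length vs) true) (adjacencies (fromList vs)) ≡ true →
                 ∀ l → AllPairs R l → All (_∈ˡ vs) l → length l ℕ.< k
  search-sound k vs t = noClique-sound k vs
    (subst T (trans (sym t) (trans (search-noClique k _ (fromList vs)) (cong (noClique k) (select-all vs)))) _)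

-- Adjacency through proximity, and the bound on cliques

record Adjacent (v w : Vertex Γ) : Set where
  constructor adjacent
  field
    1or2 : proximity v w ≡ 1 ⊎ proximity v w ≡ 2

-- Proximities 1 and 2 stand for distances 3 and 2. They can be computed, whereas adjacency in `Γ`
-- is phrased through `Distance`, which quantifies over all walks.
adjacent? : Decidable₂ Adjacent
adjacent? v w = map′ adjacent Adjacent.1or2 (proximity v w ℕ.≟ 1 ⊎-dec proximity v w ℕ.≟ 2)

subsets : ∀ n → List (Subset n)
subsets zero    = [] ∷ []
subsets (suc n) = List.map (true ∷_) (subsets n) List.++ List.map (false ∷_) (subsets n)

∈-subsets : ∀ {n} (I : Subset n) → I ∈ˡ subsets n
∈-subsets []          = here refl
∈-subsets (true  ∷ I) = ∈-++⁺ˡ (∈-map⁺ (true ∷_) (∈-subsets I))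
∈-subsets {suc n} (false ∷ I) = ∈-++⁺ʳ (List.map (true ∷_) (subsets n)) (∈-map⁺ (false ∷_) (∈-subsets I))

threes : List (Subset 6) → List ThreeSubset
threes []       = []
threes (I ∷ Is) with ∣ I ∣ ℕ.≟ 3
... | yes p = (I , p) ∷ threes Is
... | no _  = threes Is

∈-threes : ∀ {I Is} → I ∈ˡ Is → (p : ∣ I ∣ ≡ 3) → (I , p) ∈ˡ threes Is
∈-threes {Is = J ∷ Is} I∈ p with ∣ J ∣ ℕ.≟ 3
∈-threes (here refl) p | yes q = here (cong (_ ,_) (ℕ.≡-irrelevant p q))
∈-threes (here refl) p | no ¬p = ⊥-elim (¬p p)
∈-threes (there I∈)  p | yes _ = there (∈-threes I∈ p)
∈-threes (there I∈)  p | no _  = ∈-threes I∈ p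

threeSubsets : List ThreeSubset
threeSubsets = threes (subsets 6)

∈-threeSubsets : ∀ I → I ∈ˡ threeSubsets
∈-threeSubsets (I , p) = ∈-threes (∈-subsets I) p

vertices : List (Vertex Γ)
vertices = cartesianProduct threeSubsets (Sign.+ ∷ Sign.- ∷ [])

∈-vertices : ∀ v → v ∈ˡ vertices
∈-vertices (I , ε) = ∈-cartesianProduct⁺ (∈-threeSubsets I) (signs ε)
  where
  signs : ∀ ε → ε ∈ˡ Sign.+ ∷ Sign.- ∷ []
  signs Sign.+ = here refl
  signs Sign.- = there (here refl)

proximity-sym : ∀ v w → proximity v w ≡ proximity w v
proximity-sym ((I , _) , ε) ((J , _) , δ) = cong₂ ℕ._+_ (cong ∣_∣ (∩-comm I J)) (signs ε δ)
  where
  signs : ∀ ε δ → indicator (does (ε Sign.≟ δ)) ≡ indicator (does (δ Sign.≟ ε))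
  signs Sign.+ Sign.+ = refl
  signs Sign.+ Sign.- = refl
  signs Sign.- Sign.+ = refl
  signs Sign.- Sign.- = refl

adjacent-sym : Symmetric Adjacent
adjacent-sym {v} {w} (adjacent p) = adjacent (subst (λ m → m ≡ 1 ⊎ m ≡ 2) (proximity-sym v w) p)

adjacent-irreflexive : Irreflexive _≡_ Adjacent
adjacent-irreflexive {v} refl (adjacent (inj₁ eq)) with () ← trans (sym eq) (proximity-self v)
adjacent-irreflexive {v} refl (adjacent (inj₂ eq)) with () ← trans (sym eq) (proximity-self v)

open CliqueSearch Adjacent adjacent? adjacent-sym adjacent-irreflexive

abstract
  no-8-clique : search 8 (replicate (length vertices) true) (adjacencies (fromList vertices)) ≡ true
  no-8-clique = refl

clique≤7 : ∀ l → AllPairs Adjacent l → length l ℕ.≤ 7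
clique≤7 l Rl = ℕ.s≤s⁻¹ (search-sound 8 vertices no-8-clique l Rl (All.universal ∈-vertices l))

-- Splitting lists by kind, and the pigeonhole principle

module _ {X Y : Set} where

  lefts : List (X ⊎ Y) → List X
  lefts []           = []
  lefts (inj₁ x ∷ l) = x ∷ lefts l
  lefts (inj₂ y ∷ l) = lefts l

  rights : List (X ⊎ Y) → List Y
  rights []           = []
  rights (inj₁ x ∷ l) = rights l
  rights (inj₂ y ∷ l) = y ∷ rights l

  length-lefts-rights : ∀ l → length l ≡ length (lefts l) ℕ.+ length (rights l)
  length-lefts-rights []           = refl
  length-lefts-rights (inj₁ x ∷ l) = cong suc (length-lefts-rights l)
  length-lefts-rights (inj₂ y ∷ l) =
    trans (cong suc (length-lefts-rights l)) (sym (ℕ.+-suc (length (lefts l)) (length (rights l))))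

  ∈-lefts⁻ : ∀ {x} l → x ∈ˡ lefts l → inj₁ x ∈ˡ l
  ∈-lefts⁻ (inj₁ x ∷ l) (here refl) = here refl
  ∈-lefts⁻ (inj₁ x ∷ l) (there x∈)  = there (∈-lefts⁻ l x∈)
  ∈-lefts⁻ (inj₂ y ∷ l) x∈          = there (∈-lefts⁻ l x∈)

  ∈-rights⁻ : ∀ {y} l → y ∈ˡ rights l → inj₂ y ∈ˡ l
  ∈-rights⁻ (inj₁ x ∷ l) y∈          = there (∈-rights⁻ l y∈)
  ∈-rights⁻ (inj₂ y ∷ l) (here refl) = here refl
  ∈-rights⁻ (inj₂ y ∷ l) (there y∈)  = there (∈-rights⁻ l y∈)

  ∈-lefts⁺ : ∀ {x} l → inj₁ x ∈ˡ l → x ∈ˡ lefts l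
  ∈-lefts⁺ (inj₁ x ∷ l) (here refl) = here refl
  ∈-lefts⁺ (inj₁ x ∷ l) (there x∈)  = there (∈-lefts⁺ l x∈)
  ∈-lefts⁺ (inj₂ y ∷ l) (there x∈)  = ∈-lefts⁺ l x∈

  ∈-rights⁺ : ∀ {y} l → inj₂ y ∈ˡ l → y ∈ˡ rights l
  ∈-rights⁺ (inj₁ x ∷ l) (there y∈)  = ∈-rights⁺ l y∈
  ∈-rights⁺ (inj₂ y ∷ l) (here refl) = here refl
  ∈-rights⁺ (inj₂ y ∷ l) (there y∈)  = there (∈-rights⁺ l y∈)

  module _ {R : X ⊎ Y → X ⊎ Y → Set} where

    lefts-AllPairs : ∀ {l} → AllPairs R l → AllPairs (R on inj₁) (lefts l)
    lefts-AllPairs []                      = []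
    lefts-AllPairs {inj₁ x ∷ l} (Rxl ∷ Rl) = All.tabulate (λ y∈ → All.lookup Rxl (∈-lefts⁻ l y∈)) ∷ lefts-AllPairs Rl
    lefts-AllPairs {inj₂ y ∷ l} (_ ∷ Rl)   = lefts-AllPairs Rl

    rights-AllPairs : ∀ {l} → AllPairs R l → AllPairs (R on inj₂) (rights l)
    rights-AllPairs []                      = []
    rights-AllPairs {inj₁ x ∷ l} (_ ∷ Rl)   = rights-AllPairs Rl
    rights-AllPairs {inj₂ y ∷ l} (Ryl ∷ Rl) = All.tabulate (λ z∈ → All.lookup Ryl (∈-rights⁻ l z∈)) ∷ rights-AllPairs Rl

lookup-injective : ∀ {X : Set} {l : List X} → Unique l → ∀ {i j} → lookup l i ≡ lookup l j → i ≡ j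
lookup-injective (x∉ ∷ u) {zero}  {zero}  eq = refl
lookup-injective {l = _ ∷ l} (x∉ ∷ u) {zero}  {suc j} eq = ⊥-elim (All.lookup x∉ (∈-lookup {xs = l} j) eq)
lookup-injective {l = _ ∷ l} (x∉ ∷ u) {suc i} {zero}  eq = ⊥-elim (All.lookup x∉ (∈-lookup {xs = l} i) (sym eq))
lookup-injective (x∉ ∷ u) {suc i} {suc j} eq = cong suc (lookup-injective u eq)

unique-length : ∀ {n} (l : List (Fin n)) → Unique l → length l ℕ.≤ n
unique-length l u = Fin.injective⇒≤ (lookup-injective u)

-- A missing i could be added, giving more than n distinct elements of `Fin n`.
unique-full : ∀ {n} (l : List (Fin n)) → Unique l → length l ≡ n → ∀ i → i ∈ˡ l
unique-full {n} l u len i with i ∈? l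
  where open DecMembership Fin._≟_
... | yes i∈l = i∈l
... | no i∉l  = ⊥-elim (ℕ.<-irrefl len (unique-length (i ∷ l) (All.¬Any⇒All¬ l i∉l ∷ u)))

module _ {X : Set} {n} (f : X → Fin n) {R : X → X → Set} (separated : ∀ {x y} → R x y → f x ≢ f y) where

  map-unique : ∀ {l} → AllPairs R l → Unique (List.map f l)
  map-unique Rl = AllPairs.map⁺ (AllPairs.map separated Rl)

  separated-length : ∀ {l} → AllPairs R l → length l ℕ.≤ n
  separated-length {l} Rl = subst (ℕ._≤ n) (length-map f l) (unique-length (List.map f l) (map-unique Rl))

  -- Pairwise related elements have distinct values under f, and n distinct values exhaust `Fin n`.
  -- Applied to the three pairs of coordinates of a cell, this fills the Latin square and makes its
  -- rows and columns surjective.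
  separated-full : ∀ {l} → AllPairs R l → length l ≡ n → ∀ i → ∃ λ x → x ∈ˡ l × i ≡ f x
  separated-full {l} Rl len i = ∈-map⁻ f (unique-full (List.map f l) (map-unique Rl) (trans (length-map f l) len) i)

-- Compatible cells form a partial Latin square

abstract
  pair : Fin 6 → Fin 6 → Fin 36
  pair = combine

  pair-injective : ∀ i j i′ j′ → pair i j ≡ pair i′ j′ → i ≡ i′ × j ≡ j′
  pair-injective = Fin.combine-injective

CellCompatible : Cell → Cell → Set
CellCompatible = Compatible on inj₁

private
  too-large : ∀ {n} → ¬ (3 ℕ.+ n ≡ 1 ⊎ 3 ℕ.+ n ≡ 2)
  too-large (inj₁ ())
  too-large (inj₂ ())

-- Agreement in two coordinates already gives score 3 or more, beyond the compatible values 1 and 2.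
-- In the two analogues that follow, commutativity moves the one undecided indicator to the end, so
-- that the score visibly has the form 3 + n.
cells-ij : ∀ {i j k i′ j′ k′} → CellCompatible (i , j , k) (i′ , j′ , k′) → pair i j ≢ pair i′ j′
cells-ij {i} {j} {k} {i′} {j′} c eq with pair-injective i j i′ j′ eq
... | refl , refl rewrite dec-true (i Fin.≟ i) refl | dec-true (j Fin.≟ j) refl = too-large c

cells-ik : ∀ {i j k i′ j′ k′} → CellCompatible (i , j , k) (i′ , j′ , k′) → pair i k ≢ pair i′ k′
cells-ik {i} {j} {k} {i′} {j′} {k′} c eq with pair-injective i k i′ k′ eq
... | refl , refl rewrite dec-true (i Fin.≟ i) refl | dec-true (k Fin.≟ k) refl
                        | ℕ.+-comm (indicator (does (j Fin.≟ j′))) 1 = too-large c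

cells-jk : ∀ {i j k i′ j′ k′} → CellCompatible (i , j , k) (i′ , j′ , k′) → pair j k ≢ pair j′ k′
cells-jk {i} {j} {k} {i′} {j′} {k′} c eq with pair-injective j k j′ k′ eq
... | refl , refl rewrite dec-true (j Fin.≟ j) refl | dec-true (k Fin.≟ k) refl
                        | ℕ.+-comm (indicator (does (i Fin.≟ i′))) 2 = too-large c

-- Distances in the product of J(6,3) and K₂

private
  B : Graph
  B = J[6,3] □ K₂

-- Inclusion and exclusion inside K: the union of K ∩ J and I ∩ K lies in K, and their intersection
-- lies in I ∩ J.
∩-triangle : ∀ {n} (I J K : Subset n) → ∣ K ∩ J ∣ ℕ.+ ∣ I ∩ K ∣ ℕ.≤ ∣ I ∩ J ∣ ℕ.+ ∣ K ∣
∩-triangle []          []          []          = ℕ.z≤n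
∩-triangle (a ∷ I)     (b ∷ J)     (false ∷ K) rewrite Bool.∧-zeroʳ a =
  ℕ.≤-trans (∩-triangle I J K) (ℕ.+-monoˡ-≤ ∣ K ∣ (grow (a ∧ b)))
  where
  grow : ∀ c → ∣ I ∩ J ∣ ℕ.≤ ∣ c ∷ (I ∩ J) ∣
  grow true  = ℕ.n≤1+n _
  grow false = ℕ.≤-refl
∩-triangle (true ∷ I)  (true ∷ J)  (true ∷ K)
  rewrite ℕ.+-suc ∣ K ∩ J ∣ ∣ I ∩ K ∣ | ℕ.+-suc ∣ I ∩ J ∣ ∣ K ∣ = ℕ.s≤s (ℕ.s≤s (∩-triangle I J K))
∩-triangle (true ∷ I)  (false ∷ J) (true ∷ K)
  rewrite ℕ.+-suc ∣ K ∩ J ∣ ∣ I ∩ K ∣ | ℕ.+-suc ∣ I ∩ J ∣ ∣ K ∣ = ℕ.s≤s (∩-triangle I J K)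
∩-triangle (false ∷ I) (true ∷ J)  (true ∷ K)
  rewrite ℕ.+-suc ∣ I ∩ J ∣ ∣ K ∣ = ℕ.s≤s (∩-triangle I J K)
∩-triangle (false ∷ I) (false ∷ J) (true ∷ K)
  rewrite ℕ.+-suc ∣ I ∩ J ∣ ∣ K ∣ = ℕ.m≤n⇒m≤1+n (∩-triangle I J K)

-- A step in K₂ affects only the indicator. For a step in J(6,3), `∩-triangle` with `∣ I ∩ K ∣`
-- equal to 2 and `∣ K ∣` equal to 3 bounds the gain by 1.
step-proximity : ∀ v u w → _~_ B v u → proximity u w ℕ.≤ suc (proximity v w)
step-proximity ((I , _) , ε) (_ , ε′) ((J , _) , δ) (inj₁ (refl , _)) =
  ℕ.≤-trans (ℕ.+-monoʳ-≤ ∣ I ∩ J ∣ (ℕ.≤-trans (indicator≤1 _) (ℕ.s≤s ℕ.z≤n))) (ℕ.≤-reflexive (ℕ.+-suc ∣ I ∩ J ∣ _))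
  where
  indicator≤1 : ∀ b → indicator b ℕ.≤ 1
  indicator≤1 true  = ℕ.≤-refl
  indicator≤1 false = ℕ.z≤n
step-proximity ((I , _) , ε) ((K , ∣K∣≡3) , _) ((J , _) , δ) (inj₂ (refl , ∣I∩K∣≡2)) =
  ℕ.+-monoˡ-≤ (indicator (does (ε Sign.≟ δ))) (ℕ.+-cancelʳ-≤ 2 _ _ (begin
    ∣ K ∩ J ∣ ℕ.+ 2           ≡⟨ cong (∣ K ∩ J ∣ ℕ.+_) ∣I∩K∣≡2 ⟨
    ∣ K ∩ J ∣ ℕ.+ ∣ I ∩ K ∣   ≤⟨ ∩-triangle I J K ⟩
    ∣ I ∩ J ∣ ℕ.+ ∣ K ∣       ≡⟨ cong (∣ I ∩ J ∣ ℕ.+_) ∣K∣≡3 ⟩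
    ∣ I ∩ J ∣ ℕ.+ 3           ≡⟨ ℕ.+-suc ∣ I ∩ J ∣ 2 ⟩
    suc ∣ I ∩ J ∣ ℕ.+ 2       ∎))
  where open ℕ.≤-Reasoning

-- The lower bound on distances: the end of the walk has proximity 4 to itself, and each step gains
-- at most 1.
walk-proximity : ∀ {k v w} → Walk B k v w → 4 ℕ.≤ k ℕ.+ proximity v w
walk-proximity {v = v} [] = ℕ.≤-reflexive (sym (proximity-self v))
walk-proximity {suc k} {v} {w} (_∷_ {v = u} v~u p) = begin
  4                               ≤⟨ walk-proximity p ⟩
  k ℕ.+ proximity u w             ≤⟨ ℕ.+-monoʳ-≤ k (step-proximity v u w v~u) ⟩
  k ℕ.+ suc (proximity v w)       ≡⟨ ℕ.+-suc k (proximity v w) ⟩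
  suc (k ℕ.+ proximity v w)       ∎
  where open ℕ.≤-Reasoning

abstract
  -- K trades an element of I outside J for an element of J outside I. Together with a change of
  -- sign, these are the steps of a geodesic.
  exchange : ∀ (I : Subset 6) → ∣ I ∣ ≡ 3 → ∀ (J : Subset 6) → ∣ J ∣ ≡ 3 → ∣ I ∩ J ∣ ≢ 3 →
             ∃ λ (K : Subset 6) → ∣ K ∣ ≡ 3 × ∣ I ∩ K ∣ ≡ 2 × ∣ K ∩ J ∣ ≡ suc ∣ I ∩ J ∣
  exchange = from-yes (allSubsets? {6} λ I → ∣ I ∣ ℕ.≟ 3 →-dec allSubsets? {6} λ J → ∣ J ∣ ℕ.≟ 3 →-dec
    ¬? (∣ I ∩ J ∣ ℕ.≟ 3) →-dec
    anySubset? λ K → ∣ K ∣ ℕ.≟ 3 ×-dec ∣ I ∩ K ∣ ℕ.≟ 2 ×-dec ∣ K ∩ J ∣ ℕ.≟ suc ∣ I ∩ J ∣)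

closer : ∀ v w → v ≢ w → ∃ λ u → _~_ B v u × proximity u w ≡ suc (proximity v w)
closer ((I , p) , ε) ((J , q) , δ) v≢w with ε Sign.≟ δ
... | no ε≢δ = ((I , p) , δ) , inj₁ (refl , ε≢δ) ,
  trans (cong (λ b → ∣ I ∩ J ∣ ℕ.+ indicator b) (dec-true (δ Sign.≟ δ) refl)) (ℕ.+-suc ∣ I ∩ J ∣ 0)
... | yes refl with exchange I p J q (λ eq → v≢w (proximity-4 _ _ (cong₂ ℕ._+_ eq (cong indicator (dec-true (ε Sign.≟ ε) refl)))))
...   | K , r , I∩K , K∩J = ((K , r) , ε) , inj₂ (refl , I∩K) ,
  trans (cong (λ b → ∣ K ∩ J ∣ ℕ.+ indicator b) (dec-true (ε Sign.≟ ε) refl)) (cong (ℕ._+ 1) K∩J)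

geodesic : ∀ k v w → k ℕ.+ proximity v w ≡ 4 → Walk B k v w
geodesic zero    v w eq with proximity-4 v w eq
... | refl = []
geodesic (suc k) v w eq with closer v w (λ { refl → ℕ.1+n≢0 (ℕ.+-cancelʳ-≡ 4 (suc k) 0 (trans (cong (suc k ℕ.+_) (sym (proximity-self v))) eq)) })
... | u , v~u , prox = v~u ∷ geodesic k u w (trans (cong (k ℕ.+_) prox) (trans (ℕ.+-suc k _) eq))

distance : ∀ k v w → k ℕ.+ proximity v w ≡ 4 → Distance B v w k
distance k v w eq = geodesic k v w eq ,
  λ l p → ℕ.+-cancelʳ-≤ (proximity v w) k l (subst (ℕ._≤ l ℕ.+ proximity v w) (sym eq) (walk-proximity p))

adjacent⇒Γ : ∀ {v w} → Adjacent v w → _~_ Γ v w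
adjacent⇒Γ {v} {w} (adjacent (inj₁ eq)) = inj₂ (distance 3 v w (cong (3 ℕ.+_) eq))
adjacent⇒Γ {v} {w} (adjacent (inj₂ eq)) = inj₁ (distance 2 v w (cong (2 ℕ.+_) eq))

-- The representatives lie in L

+-sub : ∀ {n} (u v : Vec ℚ n) → u +ᵛ (v -ᵛ u) ≡ v
+-sub []      []      = refl
+-sub (p ∷ u) (q ∷ v) = cong₂ _∷_
  (trans (ℚ.+-comm p (q ℚ.- p)) (trans (ℚ.+-assoc q (ℚ.- p) p) (trans (cong (λ r → q ℚ.+ r) (ℚ.+-inverseˡ p)) (ℚ.+-identityʳ q))))
  (+-sub u v)

-- The numerators are the only candidate for an integral preimage of v, so naming them turns
-- membership in A n into a decidable condition.
HasIntegerCoordinates : ∀ {n} → Vec ℚ n → Set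
HasIntegerCoordinates v = sumℤ (map ℚ.numerator v) ≡ 0ℤ × v ≡ map (_/ 1) (map ℚ.numerator v)

hasIntegerCoordinates? : ∀ {n} (v : Vec ℚ n) → Dec (HasIntegerCoordinates v)
hasIntegerCoordinates? v = sumℤ (map ℚ.numerator v) ℤ.≟ 0ℤ ×-dec v ≟ map (_/ 1) (map ℚ.numerator v)

∈-A : ∀ {n} {v : Vec ℚ (suc n)} → HasIntegerCoordinates v → v ∈ A n
∈-A {v = v} p = map ℚ.numerator v , p

BlocksInΛ : Blocks → Set
BlocksInΛ (blocks v₁ v₂ v₃ v₄ v₅ v₆ v₇) = v₁ ∈ A 5 × v₂ ∈ A 5 × v₃ ∈ A 5 × v₄ ∈ A 1 × v₅ ∈ A 1 × v₆ ∈ A 1 × v₇ ∈ A 1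

∈-Λ : ∀ v → BlocksInΛ v → ⌊ v ⌋ ∈ Λ
∈-Λ v (p₁ , p₂ , p₃ , p₄ , p₅ , p₆ , p₇) =
  _ , _ , p₁ , (_ , _ , p₂ , (_ , _ , p₃ , (_ , _ , p₄ , (_ , _ , p₅ , (_ , _ , p₆ , p₇ , refl) , refl) , refl) , refl) , refl) , refl

-- Write v as b + (v - b): b is one of the generators β in each use, and the difference is checked
-- to lie in Λ block by block.
coset-∈-L : ∀ b v → ⌊ b ⌋ ∈ L → BlocksInΛ (zipBlocks ℚ._-_ v b) → ⌊ v ⌋ ∈ L
coset-∈-L b v b∈L p = subst L
  (trans (cong (⌊ b ⌋ +ᵛ_) (sym (zipWith-⌊⌋ ℚ._-_ v b))) (+-sub ⌊ b ⌋ ⌊ v ⌋))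
  (add b∈L (gen (inj₁ (∈-Λ (zipBlocks ℚ._-_ v b) p))))

abstract
  α₅-A : ∀ i → α₅⁽ i ⁾ -ᵛ α 5 ∈ A 5
  α₅-A i = ∈-A (from-yes (Fin.all? λ i → hasIntegerCoordinates? (α₅⁽ i ⁾ -ᵛ α 5)) i)

  αₛ-A : ∀ I → ∣ I ∣ ≡ 3 → αₛ I -ᵛ 3ℚ · α 5 ∈ A 5
  αₛ-A I p = ∈-A (from-yes (allSubsets? {6} λ I → ∣ I ∣ ℕ.≟ 3 →-dec hasIntegerCoordinates? (αₛ I -ᵛ 3ℚ · α 5)) I p)

0-A₅ : 0ᵛ -ᵛ 0ᵛ ∈ A 5
0-A₅ = ∈-A (refl , refl)

0-A₁ : 0ᵛ -ᵛ 0ᵛ ∈ A 1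
0-A₁ = ∈-A (refl , refl)

±α₁-A : ∀ ε → (ε ± α 1) -ᵛ α 1 ∈ A 1
±α₁-A Sign.+ = ∈-A (refl , refl)
±α₁-A Sign.- = ∈-A (refl , refl)

vec∈L : ∀ r → vec r ∈ L
vec∈L r@(cell i j k) = coset-∈-L (blocks (α 5) (α 5) (α 5) 0ᵛ 0ᵛ 0ᵛ (α 1)) (toBlocks r)
  (gen (inj₂ (inj₁ refl))) (α₅-A i , α₅-A j , α₅-A k , 0-A₁ , 0-A₁ , 0-A₁ , ±α₁-A Sign.+)
vec∈L r@(triad₁ ((I , p) , ε)) = coset-∈-L (blocks (3ℚ · α 5) 0ᵛ 0ᵛ 0ᵛ (α 1) (α 1) (α 1)) (toBlocks r)
  (gen (inj₂ (inj₂ (inj₁ refl)))) (αₛ-A I p , 0-A₅ , 0-A₅ , 0-A₁ , ±α₁-A ε , ±α₁-A Sign.+ , ±α₁-A Sign.+)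
vec∈L r@(triad₂ ((I , p) , ε)) = coset-∈-L (blocks 0ᵛ (3ℚ · α 5) 0ᵛ (α 1) 0ᵛ (α 1) (α 1)) (toBlocks r)
  (gen (inj₂ (inj₂ (inj₂ (inj₁ refl))))) (0-A₅ , αₛ-A I p , 0-A₅ , ±α₁-A Sign.+ , 0-A₁ , ±α₁-A ε , ±α₁-A Sign.+)
vec∈L r@(triad₃ ((I , p) , ε)) = coset-∈-L (blocks 0ᵛ 0ᵛ (3ℚ · α 5) (α 1) (α 1) 0ᵛ (α 1)) (toBlocks r)
  (gen (inj₂ (inj₂ (inj₂ (inj₂ refl))))) (0-A₅ , 0-A₅ , αₛ-A I p , ±α₁-A ε , ±α₁-A Sign.+ , 0-A₁ , ±α₁-A Sign.+)

-- Lists of compatible representatives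

cells : List Rep → List Cell
cells = lefts

triads₁ triads₂ triads₃ : List Rep → List (Vertex Γ)
triads₁ l = lefts (rights l)
triads₂ l = lefts (rights (rights l))
triads₃ l = rights (rights (rights l))

length-parts : ∀ l → length l ≡ length (cells l) ℕ.+ (length (triads₁ l) ℕ.+ (length (triads₂ l) ℕ.+ length (triads₃ l)))
length-parts l = trans (length-lefts-rights l) (cong (length (cells l) ℕ.+_)
  (trans (length-lefts-rights (rights l)) (cong (length (triads₁ l) ℕ.+_) (length-lefts-rights (rights (rights l))))))

module _ {l} (Rl : AllPairs Compatible l) where

  cells-compatible : AllPairs CellCompatible (cells l)
  cells-compatible = lefts-AllPairs Rl

  triads₁-adjacent : AllPairs Adjacent (triads₁ l)
  triads₁-adjacent = AllPairs.map adjacent (lefts-AllPairs (rights-AllPairs Rl))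

  triads₂-adjacent : AllPairs Adjacent (triads₂ l)
  triads₂-adjacent = AllPairs.map adjacent (lefts-AllPairs (rights-AllPairs (rights-AllPairs Rl)))

  triads₃-adjacent : AllPairs Adjacent (triads₃ l)
  triads₃-adjacent = AllPairs.map adjacent (rights-AllPairs (rights-AllPairs (rights-AllPairs Rl)))

  cells≤36 : length (cells l) ℕ.≤ 36
  cells≤36 = separated-length (λ (i , j , k) → pair i j) (λ {(i , j , k)} {(i′ , j′ , k′)} → cells-ij {i} {j} {k} {i′} {j′} {k′}) cells-compatible

  compatible-length : length l ℕ.≤ 57
  compatible-length = ℕ.≤-trans (ℕ.≤-reflexive (length-parts l))
    (ℕ.+-mono-≤ cells≤36 (ℕ.+-mono-≤ (clique≤7 _ triads₁-adjacent) (ℕ.+-mono-≤ (clique≤7 _ triads₂-adjacent) (clique≤7 _ triads₃-adjacent))))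

-- Peels one summand at a time off 57 = 36 + (7 + (7 + 7)), so that a list of length 57 attains
-- every one of the four bounds.
+-tight : ∀ {a b c d} → a ℕ.≤ c → b ℕ.≤ d → a ℕ.+ b ≡ c ℕ.+ d → a ≡ c × b ≡ d
+-tight {a} {b} {c} {d} a≤c b≤d eq with ℕ.≤⇒≤′ a≤c
... | ℕ.≤′-refl = refl , ℕ.+-cancelˡ-≡ a b d eq
... | ℕ.≤′-step a≤n = ⊥-elim (ℕ.<-irrefl eq (ℕ.+-mono-<-≤ (ℕ.s≤s (ℕ.≤′⇒≤ a≤n)) b≤d))

module _ {l} (Rl : AllPairs Compatible l) (len : length l ≡ 57) where

  private
    full₀ = +-tight (cells≤36 Rl) (ℕ.+-mono-≤ (clique≤7 _ (triads₁-adjacent Rl)) (ℕ.+-mono-≤ (clique≤7 _ (triads₂-adjacent Rl)) (clique≤7 _ (triads₃-adjacent Rl))))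
              (trans (sym (length-parts l)) len)
    full₁ = +-tight (clique≤7 _ (triads₁-adjacent Rl)) (ℕ.+-mono-≤ (clique≤7 _ (triads₂-adjacent Rl)) (clique≤7 _ (triads₃-adjacent Rl))) (proj₂ full₀)
    full₂ = +-tight (clique≤7 _ (triads₂-adjacent Rl)) (clique≤7 _ (triads₃-adjacent Rl)) (proj₂ full₁)

  cells≡36 : length (cells l) ≡ 36
  cells≡36 = proj₁ full₀

  triads₁≡7 : length (triads₁ l) ≡ 7
  triads₁≡7 = proj₁ full₁

  triads₂≡7 : length (triads₂ l) ≡ 7
  triads₂≡7 = proj₁ full₂

  triads₃≡7 : length (triads₃ l) ≡ 7
  triads₃≡7 = proj₂ full₂

AllPairs-lookup : ∀ {X : Set} {R : X → X → Set} {l x y} → AllPairs R l → x ∈ˡ l → y ∈ˡ l → x ≡ y ⊎ R x y ⊎ R y x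
AllPairs-lookup (_ ∷ _)   (here refl) (here refl) = inj₁ refl
AllPairs-lookup (Rxl ∷ _) (here refl) (there y∈)  = inj₂ (inj₁ (All.lookup Rxl y∈))
AllPairs-lookup (Ryl ∷ _) (there x∈)  (here refl) = inj₂ (inj₂ (All.lookup Ryl x∈))
AllPairs-lookup (_ ∷ Rl)  (there x∈)  (there y∈)  = AllPairs-lookup Rl x∈ y∈

list-cardinality : ∀ {X : Set} {ω : Pred X 0ℓ} (l : List X) → Unique l → (∀ {u} → u ∈ˡ l → u ∈ ω) → (∀ {u} → u ∈ ω → u ∈ˡ l) →
                   HasCardinality ω (length l)
list-cardinality l unique l⊆ω ω⊆l = record
  { to        = λ i → lookup l i , l⊆ω (∈-lookup {xs = l} i)
  ; cong      = cong (lookup l)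
  ; bijective = lookup-injective unique ,
                λ (u , u∈ω) → Any.index (ω⊆l u∈ω) , λ { refl → sym (lookup-index (ω⊆l u∈ω)) }
  }

adjacent-clique : ∀ {l C} → AllPairs Adjacent l → length l ≡ 7 → (∀ {v} → v ∈ˡ l → v ∈ C) → (∀ {v} → v ∈ C → v ∈ˡ l) → Is7Clique C
adjacent-clique {l} {C} Rl len l⊆C C⊆l =
  clique , subst (HasCardinality C) len (list-cardinality l (AllPairs.map (λ a eq → adjacent-irreflexive eq a) Rl) l⊆C C⊆l)
  where
  clique : IsClique Γ C
  clique u∈C v∈C u≢v with AllPairs-lookup Rl (C⊆l u∈C) (C⊆l v∈C)
  ... | inj₁ u≡v        = ⊥-elim (u≢v u≡v)
  ... | inj₂ (inj₁ adj) = adjacent⇒Γ adj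
  ... | inj₂ (inj₂ adj) = adjacent⇒Γ (adjacent-sym adj)

module LatinSquare {l} (Rl : AllPairs Compatible l) (len : length l ≡ 57) where

  private
    Rc : AllPairs CellCompatible (cells l)
    Rc = cells-compatible Rl

  cell-ij : ∀ i j → ∃ λ k → cell i j k ∈ˡ l
  cell-ij i j = locate (separated-full (λ (i , j , k) → pair i j)
    (λ {(i , j , k)} {(i′ , j′ , k′)} → cells-ij {i} {j} {k} {i′} {j′} {k′}) Rc (cells≡36 Rl len) (pair i j))
    where
    locate : (∃ λ ((i′ , j′ , k′) : Cell) → (i′ , j′ , k′) ∈ˡ cells l × pair i j ≡ pair i′ j′) → ∃ λ k → cell i j k ∈ˡ l
    locate ((i′ , j′ , k) , c∈ , eq) with pair-injective i j i′ j′ eq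
    ... | refl , refl = k , ∈-lefts⁻ l c∈

  cell-ik : ∀ i k → ∃ λ j → cell i j k ∈ˡ l
  cell-ik i k = locate (separated-full (λ (i , j , k) → pair i k)
    (λ {(i , j , k)} {(i′ , j′ , k′)} → cells-ik {i} {j} {k} {i′} {j′} {k′}) Rc (cells≡36 Rl len) (pair i k))
    where
    locate : (∃ λ ((i′ , j′ , k′) : Cell) → (i′ , j′ , k′) ∈ˡ cells l × pair i k ≡ pair i′ k′) → ∃ λ j → cell i j k ∈ˡ l
    locate ((i′ , j , k′) , c∈ , eq) with pair-injective i k i′ k′ eq
    ... | refl , refl = j , ∈-lefts⁻ l c∈

  cell-jk : ∀ j k → ∃ λ i → cell i j k ∈ˡ l
  cell-jk j k = locate (separated-full (λ (i , j , k) → pair j k)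
    (λ {(i , j , k)} {(i′ , j′ , k′)} → cells-jk {i} {j} {k} {i′} {j′} {k′}) Rc (cells≡36 Rl len) (pair j k))
    where
    locate : (∃ λ ((i′ , j′ , k′) : Cell) → (i′ , j′ , k′) ∈ˡ cells l × pair j k ≡ pair j′ k′) → ∃ λ i → cell i j k ∈ˡ l
    locate ((i , j′ , k′) , c∈ , eq) with pair-injective j k j′ k′ eq
    ... | refl , refl = i , ∈-lefts⁻ l c∈

  -- Applied to cells of l that agree in two coordinates. Such cells are never compatible, so they
  -- coincide, and their third coordinates agree as well.
  cells-≡ : ∀ {c c′} → inj₁ c ∈ˡ l → inj₁ c′ ∈ˡ l → ¬ CellCompatible c c′ → ¬ CellCompatible c′ c → c ≡ c′
  cells-≡ c∈ c′∈ ¬R ¬R′ with AllPairs-lookup Rc (∈-lefts⁺ l c∈) (∈-lefts⁺ l c′∈)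
  ... | inj₁ eq       = eq
  ... | inj₂ (inj₁ R) = ⊥-elim (¬R R)
  ... | inj₂ (inj₂ R) = ⊥-elim (¬R′ R)

  square : Square 6
  square i j = proj₁ (cell-ij i j)

  square-∈ : ∀ i j → cell i j (square i j) ∈ˡ l
  square-∈ i j = proj₂ (cell-ij i j)

  ∈-square : ∀ {i j k} → cell i j k ∈ˡ l → square i j ≡ k
  ∈-square {i} {j} {k} c∈ = cong (proj₂ ∘ proj₂)
    (cells-≡ (square-∈ i j) c∈ (λ c → cells-ij {i} {j} {square i j} {i} {j} {k} c refl)
                               (λ c → cells-ij {i} {j} {k} {i} {j} {square i j} c refl))

  isLatin : IsLatin square
  isLatin = record
    { rows    = λ i → (λ {j} {j′} eq → row-injective i j j′ eq) , λ k → proj₁ (cell-ik i k) , λ { refl → ∈-square (proj₂ (cell-ik i k)) }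
    ; columns = λ j → (λ {i} {i′} eq → column-injective j i i′ eq) , λ k → proj₁ (cell-jk j k) , λ { refl → ∈-square (proj₂ (cell-jk j k)) }
    }
    where
    row-injective : ∀ i j j′ → square i j ≡ square i j′ → j ≡ j′
    row-injective i j j′ eq = cong (proj₁ ∘ proj₂)
      (cells-≡ (square-∈ i j) (square-∈ i j′)
        (λ c → cells-ik {i} {j} {square i j} {i} {j′} {square i j′} c (cong (pair i) eq))
        (λ c → cells-ik {i} {j′} {square i j′} {i} {j} {square i j} c (cong (pair i) (sym eq))))
    column-injective : ∀ j i i′ → square i j ≡ square i′ j → i ≡ i′
    column-injective j i i′ eq = cong proj₁
      (cells-≡ (square-∈ i j) (square-∈ i′ j)
        (λ c → cells-jk {i} {j} {square i j} {i′} {j} {square i′ j} c (cong (pair j) eq))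
        (λ c → cells-jk {i′} {j} {square i′ j} {i} {j} {square i j} c (cong (pair j) (sym eq))))

-- The normal form and its representatives

Union : Parameters → Pred E 0ℓ
Union (params S C₁ C₂ C₃) = ω₀ S ∪ ω₁ C₁ ∪ ω₂ C₂ ∪ ω₃ C₃

Represents : Parameters → Rep → Set
Represents (params S _ _ _)  (cell i j k) = S i j ≡ k
Represents (params _ C₁ _ _) (triad₁ v)   = v ∈ C₁
Represents (params _ _ C₂ _) (triad₂ v)   = v ∈ C₂
Represents (params _ _ _ C₃) (triad₃ v)   = v ∈ C₃

vec-∈-Union : ∀ P r → Represents P r → vec r ∈ Union P
vec-∈-Union P (cell i j k)     refl = inj₁ (i , j , refl)
vec-∈-Union P (triad₁ (I , ε)) v∈   = inj₂ (inj₁ (I , ε , v∈ , refl))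
vec-∈-Union P (triad₂ (I , ε)) v∈   = inj₂ (inj₂ (inj₁ (I , ε , v∈ , refl)))
vec-∈-Union P (triad₃ (I , ε)) v∈   = inj₂ (inj₂ (inj₂ (I , ε , v∈ , refl)))

∈-Union-vec : ∀ P {u} → u ∈ Union P → ∃ λ r → Represents P r × u ≡ vec r
∈-Union-vec P@(params S _ _ _) (inj₁ (i , j , eq)) = cell i j (S i j) , refl , eq
∈-Union-vec P (inj₂ (inj₁ (I , ε , v∈ , eq)))        = triad₁ (I , ε) , v∈ , eq
∈-Union-vec P (inj₂ (inj₂ (inj₁ (I , ε , v∈ , eq)))) = triad₂ (I , ε) , v∈ , eq
∈-Union-vec P (inj₂ (inj₂ (inj₂ (I , ε , v∈ , eq)))) = triad₃ (I , ε) , v∈ , eq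

-- For the squares one inclusion is enough, because each is a function: the cell with entry `S i j`
-- being represented in Q says what the entry of Q is. The cliques take both inclusions.
represents-≋ : ∀ P Q → (∀ r → Represents P r → Represents Q r) → (∀ r → Represents Q r → Represents P r) → P ≋ Q
represents-≋ P@(params S _ _ _) Q P⊆Q Q⊆P =
  (λ i j → sym (P⊆Q (cell i j (S i j)) refl)) ,
  (P⊆Q (triad₁ _) , Q⊆P (triad₁ _)) , (P⊆Q (triad₂ _) , Q⊆P (triad₂ _)) , (P⊆Q (triad₃ _) , Q⊆P (triad₃ _))

_RepresentedIn_ : Rep → Pred E 0ℓ → Set
r RepresentedIn ω = ∃ λ u → u ∈ ω × u IsUpToSwitching r

switch-back : ∀ {u r} → vec r ≡ u ⊎ vec r ≡ ρ -ᵛ u → u IsUpToSwitching r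
switch-back         (inj₁ eq) = itself (sym eq)
switch-back {u} {r} (inj₂ eq) = switched (trans (sym (sub-involutive ρ u)) (cong (λ v → ρ -ᵛ v) (sym eq)))

module _ {ω P} (switching : SwitchingEquivalent ρ ω (Union P)) where

  private
    module g = Bijection (proj₁ switching)

  -- With its converse below, this shows that `Represents P` consists of exactly the representatives
  -- of ω, whatever the bijection is. Two normal forms of ω therefore have the same parameters.
  switching⇒represents : ∀ r → r RepresentedIn ω → Represents P r
  switching⇒represents r (u , u∈ω , u~r) with ∈-Union-vec P (proj₂ (g.to (u , u∈ω)))
  ... | s , Ps , gu≡ = subst (Represents P) (upToSwitching-unique {u} {s} {r} u~s u~r) Ps
    where
    u~s : u IsUpToSwitching s
    u~s = switch-back (subst (λ v → v ≡ u ⊎ v ≡ ρ -ᵛ u) gu≡ (proj₂ switching (u , u∈ω)))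

  represents⇒switching : ∀ r → Represents P r → r RepresentedIn ω
  represents⇒switching r Pr with g.surjective (vec r , vec-∈-Union P r Pr)
  ... | (u , u∈ω) , g≡ = u , u∈ω ,
    switch-back (subst (λ v → v ≡ u ⊎ v ≡ ρ -ᵛ u) (g≡ {u , u∈ω} refl) (proj₂ switching (u , u∈ω)))

-- An example: the cyclic Latin square and three copies of one clique.
exampleClique : Fin 7 → Vertex Γ
exampleClique = Vec.lookup
  ( ((1′ ∷ 1′ ∷ 1′ ∷ 0′ ∷ 0′ ∷ 0′ ∷ [] , refl) , Sign.+)
  ∷ ((1′ ∷ 0′ ∷ 0′ ∷ 1′ ∷ 1′ ∷ 0′ ∷ [] , refl) , Sign.+)
  ∷ ((0′ ∷ 1′ ∷ 0′ ∷ 1′ ∷ 0′ ∷ 1′ ∷ [] , refl) , Sign.+)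
  ∷ ((0′ ∷ 0′ ∷ 1′ ∷ 0′ ∷ 1′ ∷ 1′ ∷ [] , refl) , Sign.+)
  ∷ ((1′ ∷ 1′ ∷ 0′ ∷ 0′ ∷ 1′ ∷ 0′ ∷ [] , refl) , Sign.-)
  ∷ ((1′ ∷ 0′ ∷ 1′ ∷ 0′ ∷ 0′ ∷ 1′ ∷ [] , refl) , Sign.-)
  ∷ ((0′ ∷ 1′ ∷ 1′ ∷ 1′ ∷ 0′ ∷ 0′ ∷ [] , refl) , Sign.-) ∷ [])
  where
  0′ 1′ : Bool
  0′ = false
  1′ = true

abstract
  example : Fin 57 → Rep
  example = [ cyclic ∘ remQuot 6 , [ triad₁ ∘ exampleClique , [ triad₂ ∘ exampleClique , triad₃ ∘ exampleClique ]′ ∘ splitAt 7 ]′ ∘ splitAt 7 ]′ ∘ splitAt 36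
    where
    cyclic : Fin 6 × Fin 6 → Rep
    cyclic (i , j) = cell i j ((toℕ i ℕ.+ toℕ j) ℕ.mod 6)

  -- Cells of a Latin square agree in at most one coordinate. In `exampleClique`, the triples 123,
  -- 145, 246, 356 with sign + meet pairwise in one point, as do 125, 136, 234 with sign -, and two
  -- triples of opposite signs are distinct and never disjoint. All proximities are thus 1 or 2.
  example-compatible : ∀ k l → k ≡ l ⊎ Compatible (example k) (example l)
  example-compatible = from-yes (Fin.all? {57} λ k → Fin.all? {57} λ l → k Fin.≟ l ⊎-dec
    (score (example k) (example l) ℕ.≟ 1 ⊎-dec score (example k) (example l) ℕ.≟ 2))

exampleSet : Pred E 0ℓ
exampleSet u = ∃ λ k → u ≡ vec (example k)

exampleSet-affineEquiangular : IsAffineEquiangularIn L ρ exampleSet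
exampleSet-affineEquiangular = record
  { root  = λ { (k , refl) → vec-root (example k) }
  ; norm  = λ { (k , refl) → vec-norm (example k) }
  ; inner = inner
  } , λ { (k , refl) → vec∈L (example k) }
  where
  inner : ∀ {u v} → u ∈ exampleSet → v ∈ exampleSet → u ≢ v → ⟨ u , v ⟩ ≡ 0ℚ ⊎ ⟨ u , v ⟩ ≡ 1ℚ
  inner (k , refl) (l , refl) u≢v = [ (λ k≡l → ⊥-elim (u≢v (cong (vec ∘ example) k≡l)))
                                    , compatible⇒zeroOrOne (example k) (example l) ]′ (example-compatible k l)

exampleSet-cardinality : HasCardinality exampleSet 57
exampleSet-cardinality = record
  { to        = λ k → vec (example k) , k , refl
  ; cong      = cong (vec ∘ example)
  ; bijective = (λ {k} {l} → injective k l) , λ (u , k , u≡) → k , λ { refl → sym u≡ }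
  }
  where
  injective : ∀ k l → vec (example k) ≡ vec (example l) → k ≡ l
  injective k l eq = [ (λ k≡l → k≡l)
                     , (λ c → ⊥-elim (compatible-irreflexive {example k} {example l} c (vec-injective {example k} {example l} eq)))
                     ]′ (example-compatible k l)

-- From affine equiangular sets to normal forms

module AffineEquiangularSet {ω : Pred E 0ℓ} (affine : IsAffineEquiangularIn L ρ ω) where

  open IsAffineEquiangular (proj₁ affine)

  representative : ∀ {u} → u ∈ ω → ∃ λ r → u IsUpToSwitching r
  representative u∈ω = classification (proj₂ affine u∈ω) (root u∈ω) (norm u∈ω)

  distinct-compatible : ∀ {u v r s} → u ∈ ω → v ∈ ω → u ≢ v → u IsUpToSwitching r → v IsUpToSwitching s → Compatible r s
  distinct-compatible u∈ω v∈ω u≢v u~r v~s = compatible u~r v~s (root v∈ω) (inner u∈ω v∈ω u≢v)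

  -- Distinct members sharing r would make r compatible with itself, although its self-score is 4.
  -- In particular ω cannot contain both u and ρ - u.
  representative-injective : ∀ {u v r} → u ∈ ω → v ∈ ω → u IsUpToSwitching r → v IsUpToSwitching r → u ≡ v
  representative-injective {u} {v} {r} u∈ω v∈ω u~r v~r with u ≟ v
  ... | yes u≡v = u≡v
  ... | no u≢v  = ⊥-elim (compatible-irreflexive {r} {r} (distinct-compatible u∈ω v∈ω u≢v u~r v~r) refl)

  module _ {m} (f : Fin m → ∃ ω) (f-injective : ∀ {i j} → proj₁ (f i) ≡ proj₁ (f j) → i ≡ j) where

    representatives : List Rep
    representatives = tabulate (λ i → proj₁ (representative (proj₂ (f i))))

    representatives-compatible : AllPairs Compatible representatives
    representatives-compatible = AllPairs.tabulate⁺ λ {i} {j} i≢j →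
      distinct-compatible (proj₂ (f i)) (proj₂ (f j)) (i≢j ∘ f-injective)
        (proj₂ (representative (proj₂ (f i)))) (proj₂ (representative (proj₂ (f j))))

    size≤57 : m ℕ.≤ 57
    size≤57 = subst (ℕ._≤ 57) (length-tabulate _) (compatible-length representatives-compatible)

cardinality≤57 : ∀ ω → IsAffineEquiangularIn L ρ ω → CardinalityAtMost ω 57
cardinality≤57 ω affine m f = AffineEquiangularSet.size≤57 affine f.to (λ {i} {j} → f.injective {i} {j})
  where module f = Injection f

module MaximumSet {ω : Pred E 0ℓ} (affine : IsAffineEquiangularIn L ρ ω) (enumeration : HasCardinality ω 57) where

  open AffineEquiangularSet affine

  private
    module f = Bijection enumeration

    chosen : Fin 57 → Rep
    chosen i = proj₁ (representative (proj₂ (f.to i)))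

    chosen-upToSwitching : ∀ i → proj₁ (f.to i) IsUpToSwitching chosen i
    chosen-upToSwitching i = proj₂ (representative (proj₂ (f.to i)))

  l : List Rep
  l = representatives f.to (λ {i} {j} → f.injective {i} {j})

  l-compatible : AllPairs Compatible l
  l-compatible = representatives-compatible f.to (λ {i} {j} → f.injective {i} {j})

  l-length : length l ≡ 57
  l-length = length-tabulate chosen

  open LatinSquare l-compatible l-length

  parameters : Parameters
  parameters = params square (λ v → triad₁ v ∈ˡ l) (λ v → triad₂ v ∈ˡ l) (λ v → triad₃ v ∈ˡ l)

  ∈⇒represented : ∀ {r} → r ∈ˡ l → r RepresentedIn ω
  ∈⇒represented {r} r∈l =
    let i , r≡ = ∈-tabulate⁻ {f = chosen} r∈l in
    proj₁ (f.to i) , proj₂ (f.to i) , subst (proj₁ (f.to i) IsUpToSwitching_) (sym r≡) (chosen-upToSwitching i)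

  represented⇒∈ : ∀ {r} → r RepresentedIn ω → r ∈ˡ l
  represented⇒∈ {r} (u , u∈ω , u~r) = subst (_∈ˡ l) (sym r≡) (∈-tabulate⁺ {f = chosen} i)
    where
    i : Fin 57
    i = proj₁ (f.surjective (u , u∈ω))
    fi≡u : proj₁ (f.to i) ≡ u
    fi≡u = proj₂ (f.surjective (u , u∈ω)) refl
    r≡ : r ≡ chosen i
    r≡ = upToSwitching-unique {u} u~r (subst (_IsUpToSwitching chosen i) fi≡u (chosen-upToSwitching i))

  represents⇒∈ : ∀ {r} → Represents parameters r → r ∈ˡ l
  represents⇒∈ {cell i j _} refl = square-∈ i j
  represents⇒∈ {triad₁ _} r∈l = r∈l
  represents⇒∈ {triad₂ _} r∈l = r∈l
  represents⇒∈ {triad₃ _} r∈l = r∈l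

  ∈⇒represents : ∀ {r} → r ∈ˡ l → Represents parameters r
  ∈⇒represents {cell i j k} r∈l = ∈-square r∈l
  ∈⇒represents {triad₁ _} r∈l = r∈l
  ∈⇒represents {triad₂ _} r∈l = r∈l
  ∈⇒represents {triad₃ _} r∈l = r∈l

  clique₁ : Is7Clique (Parameters.C₁ parameters)
  clique₁ = adjacent-clique (triads₁-adjacent l-compatible) (triads₁≡7 l-compatible l-length)
    (λ v∈ → ∈-rights⁻ l (∈-lefts⁻ (rights l) v∈)) (λ v∈ → ∈-lefts⁺ (rights l) (∈-rights⁺ l v∈))

  clique₂ : Is7Clique (Parameters.C₂ parameters)
  clique₂ = adjacent-clique (triads₂-adjacent l-compatible) (triads₂≡7 l-compatible l-length)
    (λ v∈ → ∈-rights⁻ l (∈-rights⁻ (rights l) (∈-lefts⁻ (rights (rights l)) v∈)))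
    (λ v∈ → ∈-lefts⁺ (rights (rights l)) (∈-rights⁺ (rights l) (∈-rights⁺ l v∈)))

  clique₃ : Is7Clique (Parameters.C₃ parameters)
  clique₃ = adjacent-clique (triads₃-adjacent l-compatible) (triads₃≡7 l-compatible l-length)
    (λ v∈ → ∈-rights⁻ l (∈-rights⁻ (rights l) (∈-rights⁻ (rights (rights l)) v∈)))
    (λ v∈ → ∈-rights⁺ (rights (rights l)) (∈-rights⁺ (rights l) (∈-rights⁺ l v∈)))

  rep : ∃ ω → Rep
  rep (_ , u∈ω) = proj₁ (representative u∈ω)
  rep-upToSwitching : ∀ u → proj₁ u IsUpToSwitching rep u
  rep-upToSwitching (_ , u∈ω) = proj₂ (representative u∈ω)
  to : ∃ ω → ∃ (Union parameters)
  to u = vec (rep u) , vec-∈-Union parameters (rep u)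
    (∈⇒represents {rep u} (represented⇒∈ {rep u} (proj₁ u , proj₂ u , rep-upToSwitching u)))
  rep-unique : ∀ u {r} → proj₁ u IsUpToSwitching r → rep u ≡ r
  rep-unique u = upToSwitching-unique {proj₁ u} {rep u} (rep-upToSwitching u)
  -- `rep` is computed from a membership proof, which the equality of `⟦ ω ⟧` ignores; uniqueness of
  -- representatives removes the dependence.
  to-cong : ∀ u v → proj₁ u ≡ proj₁ v → proj₁ (to u) ≡ proj₁ (to v)
  to-cong u v eq = cong vec {rep u} {rep v}
    (rep-unique u (subst (_IsUpToSwitching rep v) (sym eq) (rep-upToSwitching v)))
  to-injective : ∀ u v → proj₁ (to u) ≡ proj₁ (to v) → proj₁ u ≡ proj₁ v
  to-injective u v eq = representative-injective (proj₂ u) (proj₂ v) (rep-upToSwitching u)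
    (subst (proj₁ v IsUpToSwitching_) (sym (vec-injective {rep u} {rep v} eq)) (rep-upToSwitching v))
  -- The form of surjectivity for setoids, where the value has to be y for every membership proof of
  -- the chosen vector. As a predicate on y alone, it can be transported along y ≡ `vec r`.
  Preimage : E → Set
  Preimage y = ∃ λ (u : ∃ ω) → ∀ {v : ∃ ω} → proj₁ v ≡ proj₁ u → proj₁ (to v) ≡ y

  vec-preimage : ∀ r → r RepresentedIn ω → Preimage (vec r)
  vec-preimage r (u , u∈ω , u~r) = (u , u∈ω) , λ {v} v≡u →
    cong vec {rep v} {r} (rep-unique v {r} (subst (_IsUpToSwitching r) (sym v≡u) u~r))

  to-surjective : ∀ (y : ∃ (Union parameters)) → Preimage (proj₁ y)
  to-surjective (y , y∈) = preimage (∈-Union-vec parameters {y} y∈)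
    where
    preimage : (∃ λ r → Represents parameters r × y ≡ vec r) → Preimage y
    preimage (r , Pr , y≡) = subst Preimage (sym y≡) (vec-preimage r (∈⇒represented {r} (represents⇒∈ {r} Pr)))

  switch : ∀ {u r} → u IsUpToSwitching r → vec r ≡ u ⊎ vec r ≡ ρ -ᵛ u
  switch {u} {r} (itself u≡)   = inj₁ (sym u≡)
  switch {u} {r} (switched u≡) = inj₂ (trans (sym (sub-involutive ρ (vec r))) (cong (λ v → ρ -ᵛ v) (sym u≡)))

  switching : SwitchingEquivalent ρ ω (Union parameters)
  switching = record
    { to        = to
    ; cong      = λ {u} {v} → to-cong u v
    ; bijective = (λ {u} {v} → to-injective u v) , to-surjective
    } , λ u → switch {proj₁ u} {rep u} (rep-upToSwitching u)

  unique : ∀ Q → SwitchingEquivalent ρ ω (Union Q) → parameters ≋ Q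
  unique Q s = represents-≋ parameters Q
    (λ r Pr → switching⇒represents {P = Q} s r (∈⇒represented (represents⇒∈ {r} Pr)))
    (λ r Qr → ∈⇒represents {r} (represented⇒∈ (represents⇒switching {P = Q} s r Qr)))

  normalForm : ∃! _≋_ λ (params S C₁ C₂ C₃) →
    IsLatin S × Is7Clique C₁ × Is7Clique C₂ × Is7Clique C₃ ×
    SwitchingEquivalent ρ ω (ω₀ S ∪ ω₁ C₁ ∪ ω₂ C₂ ∪ ω₃ C₃)
  normalForm = parameters , (isLatin , clique₁ , clique₂ , clique₃ , switching) ,
    λ {Q} (_ , _ , _ , _ , s) → unique Q s

theorem6p1 : MaximumCardinality L ρ 57 ×
    (∀ ω → IsMaximumIn L ρ ω →
    ∃! _≋_ λ (params S C₁ C₂ C₃) →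
    IsLatin S × Is7Clique C₁ × Is7Clique C₂ × Is7Clique C₃ ×
    SwitchingEquivalent ρ ω (ω₀ S ∪ ω₁ C₁ ∪ ω₂ C₂ ∪ ω₃ C₃))
theorem6p1 =
  ((exampleSet , exampleSet-affineEquiangular , exampleSet-cardinality) , cardinality≤57) ,
  λ ω (affine , k , enumeration , maximum) →
    MaximumSet.normalForm affine (subst (HasCardinality ω)
      -- The cardinality k that comes with a maximum set is 57: it obeys the general bound, and
      -- maximality compares it with `exampleSet`.
      (ℕ.≤-antisym (cardinality≤57 ω affine k (Bijection.injection enumeration))
                   (maximum exampleSet exampleSet-affineEquiangular 57 (Bijection.injection exampleSet-cardinality)))
      enumeration)
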